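{- Let $V$ be a finite set and let $f:2^V\to\mathbb{Z}$ be a submodular function. For a constant positive integer $k$, a set attaining the $k$-th smallest value of $f$ can be obtained in polynomial time.
   Context: A set function $f:2^V\to\mathbb{Z}$ is submodular if $f(X)+f(Y)\ge f(X\cup Y)+f(X\cap Y)$ for all $X,Y\subseteq V$. It is accessed in the evaluation oracle model, i.e. through an oracle returning $f(X)$ for any given $X\subseteq V$. The $k$-th smallest value of $f$ is the $k$-th smallest element of the set of values $\{f(X)\mid X\subseteq V\}$ (distinct values are counted); the algorithm is required to output a set attaining it whenever $f$ has at least $k$ distinct values. Polynomial time means polynomial in $n=|V|$ for fixed $k$ (the polynomial may depend on $k$), counting oracle queries and elementary operations. -}

module Defs where

open import Data.Bool using (Bool; _∧_; not; if_then_else_)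
open import Data.Fin using (Fin; toℕ)
open import Data.Fin.Subset using (Subset; _∪_; _∩_)
import Data.Fin as Fin
open import Data.Integer using (ℤ; +_; -[1+_]; 0ℤ; ∣_∣; _+_; _-_; _*_; _/_; _≤_; _<_)
import Data.Integer as ℤ
open import Data.Nat using (ℕ; suc)
import Data.Nat as ℕ
open import Data.Product using (∃; ∃-syntax; _×_)
open import Data.Vec using (tabulate)
open import Function using (_∘_; Injective)
open import Relation.Binary.PropositionalEquality using (_≡_)
open import Relation.Nullary using (¬_; does)

-- The ground set V with |V| = n is Fin n.
SetFunction : ℕ → Set
SetFunction n = Subset n → ℤ

Submodular : ∀ {n} → SetFunction n → Set
Submodular f = ∀ X Y → f (X ∪ Y) + f (X ∩ Y) ≤ f X + f Y

HasDistinctValues : ∀ {n} → ℕ → SetFunction n → Set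
HasDistinctValues {n} k f =
  ∃ λ (X : Fin k → Subset n) → Injective _≡_ _≡_ (f ∘ X)

-- `value` lists the set {f(X) ∣ X ⊆ V} in increasing order, each element once.
record SortedValues {n} (f : SetFunction n) (m : ℕ) : Set where
  field
    value      : Fin m → ℤ
    increasing : ∀ {i j} → i Fin.< j → value i < value j
    attained   : ∀ i → ∃[ X ] f X ≡ value i
    complete   : ∀ X → ∃[ i ] f X ≡ value i

-- Ranks start at 1: the minimum of f is its first smallest value.
KthSmallestValue : ∀ {n} → ℕ → SetFunction n → ℤ → Set
KthSmallestValue k f v =
  ∃[ m ] ∃ λ (S : SortedValues f m) →
    ∃[ i ] suc (toℕ i) ≡ k × SortedValues.value S i ≡ v

------------------------------------------------------------------------
-- Machine model: a random access machine over ℤ with an evaluation oracle,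
-- presented as a while language.  Memory is a collection of named integer
-- arrays; a scalar is the entry of an array at index 0.  Arrays are named by
-- numerals occurring in the program text, so a program uses a fixed finite
-- number of them, and all dynamic addressing is through the index.

Name : Set
Name = ℕ

Memory : Set
Memory = Name → ℤ → ℤ

_[_,_]≔_ : Memory → Name → ℤ → ℤ → Memory
(s [ a , i ]≔ v) b j =
  if does (b ℕ.≟ a) ∧ does (j ℤ.≟ i) then v else s b j

-- Division with nonnegative remainder, extended by x ÷ 0 = 0.
_÷_ : ℤ → ℤ → ℤ
x ÷ (+ 0)          = 0ℤ
x ÷ y@(+ (suc _))  = x / y
x ÷ y@(-[1+ _ ])   = x / y

data Expr : Set where
  lit              : ℤ → Expr
  get              : Name → Expr → Expr
  add sub mul quot : Expr → Expr → Expr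

eval : Memory → Expr → ℤ
eval s (lit z)    = z
eval s (get a e)  = s a (eval s e)
eval s (add d e)  = eval s d + eval s e
eval s (sub d e)  = eval s d - eval s e
eval s (mul d e)  = eval s d * eval s e
eval s (quot d e) = eval s d ÷ eval s e

cost : Expr → ℕ
cost (lit _)    = 1
cost (get _ e)  = 1 ℕ.+ cost e
cost (add d e)  = 1 ℕ.+ (cost d ℕ.+ cost e)
cost (sub d e)  = 1 ℕ.+ (cost d ℕ.+ cost e)
cost (mul d e)  = 1 ℕ.+ (cost d ℕ.+ cost e)
cost (quot d e) = 1 ℕ.+ (cost d ℕ.+ cost e)

record Test : Set where
  constructor _≤?_
  field
    lhs rhs : Expr

Holds : Memory → Test → Set
Holds s (d ≤? e) = eval s d ≤ eval s e

testCost : Test → ℕ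
testCost (d ≤? e) = 1 ℕ.+ (cost d ℕ.+ cost e)

infixr 5 _⨾_

data Program : Set where
  skip   : Program
  put    : Name → Expr → Expr → Program   -- put a i e    :  a[i] := e
  query  : Name → Expr → Name → Program   -- query a i b  :  a[i] := f(readSet b)
  _⨾_    : Program → Program → Program
  choose : Test → Program → Program → Program
  while  : Test → Program → Program

-- An array encodes a subset of V through its entries at 0, …, n - 1:
-- an entry is nonzero iff the corresponding element belongs to the set.
readSet : ∀ n → Memory → Name → Subset n
readSet n s a = tabulate λ i → not (does (s a (+ toℕ i) ℤ.≟ 0ℤ))

-- Run f w P s t s′: started in memory s, with oracle f, program P halts in
-- memory s′ after t elementary operations and oracle queries, and every
-- integer written to memory on the way has absolute value at most w.
-- (Expressions have constant size, so intermediate results are at most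
-- a constant factor longer than the integers in memory.)
data Run {n} (f : SetFunction n) (w : ℕ) :
         Program → Memory → ℕ → Memory → Set where

  skip : ∀ {s} → Run f w skip s 1 s

  put : ∀ {s a i e} →
        ∣ eval s e ∣ ℕ.≤ w →
        Run f w (put a i e) s (1 ℕ.+ (cost i ℕ.+ cost e))
            (s [ a , eval s i ]≔ eval s e)

  query : ∀ {s a i b} →
          ∣ f (readSet n s b) ∣ ℕ.≤ w →
          Run f w (query a i b) s (1 ℕ.+ cost i)
              (s [ a , eval s i ]≔ f (readSet n s b))

  _⨾_ : ∀ {P Q s s′ s″ t u} →
        Run f w P s t s′ → Run f w Q s′ u s″ →
        Run f w (P ⨾ Q) s (t ℕ.+ u) s″

  choose-yes : ∀ {b P Q s s′ t} →
               Holds s b → Run f w P s t s′ →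
               Run f w (choose b P Q) s (testCost b ℕ.+ t) s′

  choose-no : ∀ {b P Q s s′ t} →
              ¬ Holds s b → Run f w Q s t s′ →
              Run f w (choose b P Q) s (testCost b ℕ.+ t) s′

  while-stop : ∀ {b P s} →
               ¬ Holds s b →
               Run f w (while b P) s (testCost b) s

  while-step : ∀ {b P s s′ s″ t u} →
               Holds s b → Run f w P s t s′ → Run f w (while b P) s′ u s″ →
               Run f w (while b P) s (testCost b ℕ.+ (t ℕ.+ u)) s″

-- The program receives n in entry 0 of array 0; all other entries are 0.
initial : ℕ → Memory
initial n = (λ _ _ → 0ℤ) [ 0 , 0ℤ ]≔ (+ n)

-- The set it returns is read from array 1.
output : ∀ n → Memory → Subset n
output n s = readSet n s 1

PolynomiallyBounded : (ℕ → ℕ) → Set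
PolynomiallyBounded p = ∃[ c ] ∃[ d ] ∀ n → p n ℕ.≤ c ℕ.* n ℕ.^ d ℕ.+ c

-- One program, uniform in n and f, such that for every admissible f the number
-- of operations and queries is at most p(n).  Since operations on integers of
-- any length have unit cost, integers in memory are moreover confined to length
-- O(p(n) · log (2 + max ∣f∣)), polynomial in the input size; otherwise repeated
-- multiplication would let a unit-cost operation do exponential work.
-- `Correct f X` is what the returned set X has to satisfy.
PolynomialTime : (∀ {n} → SetFunction n → Set) →
                 (∀ {n} → SetFunction n → Subset n → Set) → Set
PolynomialTime Admissible Correct =
  ∃ λ (P : Program) → ∃ λ (p : ℕ → ℕ) → PolynomiallyBounded p ×
    (∀ n (f : SetFunction n) → Admissible f →
     ∀ M → (∀ X → ∣ f X ∣ ℕ.≤ M) →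
     ∃[ t ] ∃[ s ] Run f ((2 ℕ.+ M) ℕ.^ p n) P (initial n) t s
       × t ℕ.≤ p n
       × Correct f (output n s))

module Submission where

-- The k-th smallest value of f is its minimum on some interval {X ∣ A ⊆ X ⊆ V ∖ B} with ∣A∣, ∣B∣ < k.
-- Indeed the minimisers on an interval form a lattice, so a set X of the interval that is not one of them
-- is separated from all of them by fixing at most one element of X and one element outside X, and every
-- such step increases the minimum.  So k passes over these intervals suffice, each of which keeps the
-- least value above the value found before.
--
-- The minimum on an interval is found in strongly polynomial time with additions and comparisons only, so
-- that the running time also bounds the length of the integers.  The algorithm keeps a preorder r on V,
-- where r u w means that every minimiser containing u contains w.  For each u it restricts f to the
-- closed sets containing u, penalises violations of r by a scale β proportional to the largest marginal,
-- and adds up N²⁰ extreme bases, each chosen greedily in the order of the sum S of its predecessors.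
-- A clipped quadratic potential shows that S is an almost optimal dual solution, with an error that is
-- small compared with β.  An entry S w below the duality gap certifies that w lies in every minimiser
-- containing u, and is recorded in r.  When no u gives a new pair, all values on closed sets are so close
-- together that β has to be 1, and then integrality makes the best value found an exact minimum.  As r
-- can grow at most N² times, N² rounds suffice.

-- The number of operations may depend on `n` only while the values of `f` are arbitrary integers,
-- so methods whose iteration count grows with the logarithm of max ∣f∣ are excluded. Approximation
-- alone cannot help either, since its error is relative to the scale β; facts about minimisers have
-- to be extracted until β has collapsed.
--
-- The bases are best responses to weights: a node w has the weight obtained by clipping - S w to
-- [0, K], and increasing S is decreasing weight, hence the greedy order. With B = 2Nβ bounding the
-- entries of a base, m² bases and K = mB, the two error terms of the regret bound both equal N m²
-- B², and division by 2K leaves an error of N m B, that is, N B / m per base. No average is formed: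
-- S is compared with m² times the values of `f`, which avoids division.
--
-- The constants come from the last step. Without a new pair one obtains m (β - 1) ≤ (4N + 1) 2N³ β,
-- and m ≥ 40 N⁴ turns this into β = 1. The choice m = N¹⁰, hence N²⁰ bases, achieves this for N ≥
-- 2.

module Compilation where

  open import Defs
  open import Data.Bool using (Bool; T; true; false; not; if_then_else_)
  open import Data.Empty using (⊥-elim)
  open import Data.Fin using (Fin; zero; suc; toℕ)
  open import Data.Fin.Properties using (toℕ<n)
  open import Data.Fin.Subset using (Subset)
  open import Data.Integer using (ℤ; +_; 0ℤ; 1ℤ; ∣_∣)
  import Data.Integer as ℤ
  import Data.Integer.Properties as ℤP
  open import Data.Nat using (ℕ; zero; suc; z≤n; s≤s; _+_; _*_; _^_; _≤_; _<_)
  import Data.Nat as ℕ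
  open import Data.Nat.Properties hiding (_≤?_)
  open import Data.Product using (∃-syntax; _×_; _,_; proj₁; proj₂)
  open import Data.Unit using (tt)
  open import Data.Vec using (Vec; []; _∷_; lookup; tabulate)
  open import Data.Vec.Properties using (tabulate-cong)
  open import Relation.Binary.PropositionalEquality
  open import Relation.Nullary using (¬_; yes; no; does)
  open import Relation.Nullary.Decidable using (dec-true; dec-false)

  -- A language of whole-array assignments and its semantics

  data Atom (d : ℕ) : Set where
    ctr     : Fin d → Atom d
    top org : Atom d

  infixl 6 _⊕_ _⊖_
  infix 5 _≼_

  -- An array language whose commands assign a whole (n + 1) × (n + 1) array at once, with bounded sums and
  -- oracle queries as expressions.  There is no multiplication, so a command of cost c lengthens integers
  -- by at most c bits.  The number d counts the loop counters in scope, the innermost being the first.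
  data Ex (d : ℕ) : Set where
    lit         : ℤ → Ex d
    idx         : Atom d → Ex d
    var         : ℕ → Atom d → Atom d → Ex d
    _⊕_ _⊖_ _≼_ : Ex d → Ex d → Ex d
    ite         : Ex d → Ex d → Ex d → Ex d
    sum qry     : Ex (suc d) → Ex d

  infixr 4 _▸_

  data Cmd (d : ℕ) : Set where
    fill : ℕ → Ex (suc (suc d)) → Cmd d
    _▸_  : Cmd d → Cmd d → Cmd d
    for  : Cmd (suc d) → Cmd d

  St : Set
  St = ℕ → ℕ → ℕ → ℤ

  nz : ℤ → Bool
  nz z = not (does (z ℤ.≟ 0ℤ))

  bit : Bool → ℤ
  bit b = if b then 1ℤ else 0ℤ

  ∑ : ℕ → (ℕ → ℤ) → ℤ
  ∑ zero    g = 0ℤ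
  ∑ (suc m) g = ∑ m g ℤ.+ g m

  iter : {A : Set} → (ℕ → A → A) → ℕ → A → A
  iter g zero    a = a
  iter g (suc m) a = g m (iter g m a)

  -- Opaque, so that the semantics of a loop does not unfold during type checking.
  opaque
    repeat : {A : Set} → ℕ → (ℕ → A → A) → A → A
    repeat n g = iter g (suc n)

    repeat-iter : ∀ {A : Set} n (g : ℕ → A → A) a → repeat n g a ≡ iter g (suc n) a
    repeat-iter n g a = refl

    repeat-inv : ∀ {A : Set} (I : ℕ → A → Set) {n} {g : ℕ → A → A} {a} →
                 (∀ {i a} → i ≤ n → I i a → I (suc i) (g i a)) → I 0 a → I (suc n) (repeat n g a)
    repeat-inv {A} I {n} {g} {a} h z = go (suc n) ≤-refl
      where
      go : ∀ m → m ≤ suc n → I m (iter g m a)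
      go zero    _ = z
      go (suc m) l = h (≤-pred l) (go m (≤-trans (n≤1+n m) l))

  _⟪_⟫≔_ : St → ℕ → (ℕ → ℕ → ℤ) → St
  (σ ⟪ x ⟫≔ g) y = if does (y ℕ.≟ x) then g else σ y

  module Semantics (n : ℕ) (f : SetFunction n) where

    ⟦_⟧ᵃ : ∀ {d} → Atom d → Vec ℕ d → ℕ
    ⟦ ctr i ⟧ᵃ ρ = lookup ρ i
    ⟦ top ⟧ᵃ   ρ = n
    ⟦ org ⟧ᵃ   ρ = 0

    ⟦_⟧ : ∀ {d} → Ex d → Vec ℕ d → St → ℤ
    ⟦ lit z ⟧     ρ σ = z
    ⟦ idx a ⟧     ρ σ = + ⟦ a ⟧ᵃ ρ
    ⟦ var x a b ⟧ ρ σ = σ x (⟦ a ⟧ᵃ ρ) (⟦ b ⟧ᵃ ρ)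
    ⟦ a ⊕ b ⟧     ρ σ = ⟦ a ⟧ ρ σ ℤ.+ ⟦ b ⟧ ρ σ
    ⟦ a ⊖ b ⟧     ρ σ = ⟦ a ⟧ ρ σ ℤ.- ⟦ b ⟧ ρ σ
    ⟦ a ≼ b ⟧     ρ σ = bit (does (⟦ a ⟧ ρ σ ℤ.≤? ⟦ b ⟧ ρ σ))
    ⟦ ite c a b ⟧ ρ σ = if nz (⟦ c ⟧ ρ σ) then ⟦ a ⟧ ρ σ else ⟦ b ⟧ ρ σ
    ⟦ sum e ⟧     ρ σ = ∑ (suc n) (λ v → ⟦ e ⟧ (v ∷ ρ) σ)
    -- The index `n`, over which sums and loops also range, is invisible to the oracle, so it is
    -- free to serve as an auxiliary node.
    ⟦ qry e ⟧     ρ σ = f (tabulate λ i → nz (⟦ e ⟧ (toℕ i ∷ ρ) σ))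

    ⟪_⟫ : ∀ {d} → Cmd d → Vec ℕ d → St → St
    ⟪ fill x e ⟫ ρ σ = σ ⟪ x ⟫≔ λ i j → ⟦ e ⟧ (j ∷ i ∷ ρ) σ
    ⟪ c ▸ c′ ⟫   ρ σ = ⟪ c′ ⟫ ρ (⟪ c ⟫ ρ σ)
    ⟪ for c ⟫    ρ σ = repeat n (λ i → ⟪ c ⟫ (i ∷ ρ)) σ

  -- Data arrays live under odd names, counters and temporaries under even ones.
  scr dat : ℕ → Name
  scr j = suc (suc (2 * j))
  dat x = suc (2 * x)

  scr-inj : ∀ {i j} → scr i ≡ scr j → i ≡ j
  scr-inj {i} {j} e = *-cancelˡ-≡ i j 2 (suc-injective (suc-injective e))

  dat-inj : ∀ {i j} → dat i ≡ dat j → i ≡ j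
  dat-inj {i} {j} e = *-cancelˡ-≡ i j 2 (suc-injective e)

  dat≢scr : ∀ {x j} → dat x ≢ scr j
  dat≢scr {x} {j} e = even≢odd x j (suc-injective e)

  -- Translation into while programs

  zeroE : Expr
  zeroE = lit 0ℤ

  cell : ℕ → Expr
  cell j = get (scr j) zeroE

  atomE : ∀ {d} → Vec ℕ d → Atom d → Expr
  atomE env (ctr i) = cell (lookup env i)
  atomE env top     = get 0 zeroE
  atomE env org     = zeroE

  -- Row-major addressing with stride n + 1. The product occurs in addresses only and is never
  -- stored, so it does not lengthen the integers in memory.
  ixE : Expr → Expr → Expr
  ixE a b = add (mul a (add (get 0 zeroE) (lit 1ℤ))) b

  -- The guard gives n + 1 iterations and leaves the counter at n + 1, which is why the word bound
  -- is later assumed to be at least `suc n`.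
  loop : Name → Program → Program
  loop c P = put c zeroE zeroE ⨾
    while (get c zeroE ≤? get 0 zeroE) (P ⨾ put c zeroE (add (get c zeroE) (lit 1ℤ)))

  matrixLoop : Name → Program → ℕ → Program
  matrixLoop a P δ = loop (scr δ) (loop (scr (1 + δ))
    (P ⨾ put a (ixE (cell δ) (cell (1 + δ))) (cell (3 + δ))))

  compileE : ∀ {d} → Ex d → ℕ → Vec ℕ d → Program
  compileE (lit z)     δ env = put (scr δ) zeroE (lit z)
  compileE (idx a)     δ env = put (scr δ) zeroE (atomE env a)
  compileE (var x a b) δ env = put (scr δ) zeroE (get (dat x) (ixE (atomE env a) (atomE env b)))
  compileE (a ⊕ b)     δ env = compileE a δ env ⨾ compileE b (1 + δ) env ⨾
    put (scr δ) zeroE (add (cell δ) (cell (1 + δ)))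
  compileE (a ⊖ b)     δ env = compileE a δ env ⨾ compileE b (1 + δ) env ⨾
    put (scr δ) zeroE (sub (cell δ) (cell (1 + δ)))
  compileE (a ≼ b)     δ env = compileE a δ env ⨾ compileE b (1 + δ) env ⨾
    choose (cell δ ≤? cell (1 + δ)) (put (scr δ) zeroE (lit 1ℤ)) (put (scr δ) zeroE zeroE)
  compileE (ite c a b) δ env = compileE c δ env ⨾
    choose (cell δ ≤? zeroE)
      (choose (zeroE ≤? cell δ) (compileE b δ env) (compileE a δ env))
      (compileE a δ env)
  compileE (sum e)     δ env = put (scr δ) zeroE zeroE ⨾
    loop (scr (1 + δ)) (compileE e (2 + δ) ((1 + δ) ∷ env) ⨾
      put (scr δ) zeroE (add (cell δ) (cell (2 + δ))))
  compileE (qry e)     δ env =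
    loop (scr (1 + δ)) (compileE e (2 + δ) ((1 + δ) ∷ env) ⨾
      put (scr δ) (cell (1 + δ)) (cell (2 + δ))) ⨾
    query (scr δ) zeroE (scr δ)

  compile : ∀ {d} → Cmd d → ℕ → Vec ℕ d → Program
  compile (fill x e) δ env =
    -- The right-hand side may read the array being assigned, so all entries are first computed into
    -- a temporary array and then copied.
    matrixLoop (scr (2 + δ)) (compileE e (3 + δ) ((1 + δ) ∷ δ ∷ env)) δ ⨾
    matrixLoop (dat x) (put (scr (3 + δ)) zeroE (get (scr (2 + δ)) (ixE (cell δ) (cell (1 + δ))))) δ
  compile (c ▸ c′)   δ env = compile c δ env ⨾ compile c′ δ env
  compile (for c)    δ env = loop (scr δ) (compile c (1 + δ) (δ ∷ env))

  -- The constant 32 bounds the cost of a single assignment or test: all addresses and right-hand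
  -- sides that are emitted have cost at most 13.
  loopCost : ℕ → ℕ → ℕ
  loopCost n τ = 32 + (suc n * (32 + (τ + 32)) + 32)

  -- Bounds both the running time and the number of bits by which integers grow.
  costE : ∀ {d} → Ex d → ℕ → ℕ
  costE (lit z)     n = 32 + ∣ z ∣
  costE (idx a)     n = 32
  costE (var x a b) n = 32
  costE (a ⊕ b)     n = costE a n + (costE b n + 32)
  costE (a ⊖ b)     n = costE a n + (costE b n + 32)
  costE (a ≼ b)     n = costE a n + (costE b n + 64)
  costE (ite c a b) n = costE c n + (64 + (costE a n + costE b n))
  costE (sum e)     n = 32 + loopCost n (costE e n + 32)
  costE (qry e)     n = loopCost n (costE e n + 32) + 32

  costC : ∀ {d} → Cmd d → ℕ → ℕ
  costC (fill x e) n = loopCost n (loopCost n (costE e n + 32)) + loopCost n (loopCost n 64)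
  costC (c ▸ c′)   n = costC c n + costC c′ n
  costC (for c)    n = loopCost n (costC c n)

  -- Execution rules with time bounds

  module _ (s : Memory) (a : Name) (i v : ℤ) where

    upd-same : (s [ a , i ]≔ v) a i ≡ v
    upd-same rewrite dec-true (a ℕ.≟ a) refl | dec-true (i ℤ.≟ i) refl = refl

    upd-name : ∀ {b j} → b ≢ a → (s [ a , i ]≔ v) b j ≡ s b j
    upd-name {b} b≢a rewrite dec-false (b ℕ.≟ a) b≢a = refl

    upd-index : ∀ {b j} → j ≢ i → (s [ a , i ]≔ v) b j ≡ s b j
    upd-index {b} {j} j≢i rewrite dec-false (j ℤ.≟ i) j≢i with does (b ℕ.≟ a)
    ... | true  = refl
    ... | false = refl

  +suc : ∀ i → + i ℤ.+ 1ℤ ≡ + suc i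
  +suc i = cong +_ (+-comm i 1)

  module Execution {n : ℕ} (f : SetFunction n) (w : ℕ) (n<w : suc n ≤ w) where

    record Exec (P : Program) (s : Memory) (τ : ℕ) (Q : Memory → Set) : Set where
      constructor exec
      field
        {time}  : ℕ
        {final} : Memory
        run     : Run f w P s time final
        bound   : time ≤ τ
        post    : Q final

    weaken : ∀ {P s τ τ′ Q Q′} → τ ≤ τ′ → (∀ s → Q s → Q′ s) → Exec P s τ Q → Exec P s τ′ Q′
    weaken τ≤ imp (exec r b p) = exec r (≤-trans b τ≤) (imp _ p)

    seqX : ∀ {P R s τ υ Q Q′} → Exec P s τ Q → (∀ s → Q s → Exec R s υ Q′) → Exec (P ⨾ R) s (τ + υ) Q′
    seqX (exec r b p) k with k _ p
    ... | exec r′ b′ p′ = exec (r ⨾ r′) (+-mono-≤ b b′) p′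

    putX : ∀ {a i e s Q} → cost i ≤ 13 → cost e ≤ 13 → ∣ eval s e ∣ ≤ w →
           Q (s [ a , eval s i ]≔ eval s e) → Exec (put a i e) s 32 Q
    putX ci ce le q = exec (put le) (≤-trans (s≤s (+-mono-≤ ci ce)) (≤ᵇ⇒≤ 27 32 tt)) q

    module _ (c : Name) (body : Program) (τ : ℕ) (Inv : ℕ → Memory → Set)
      (known : ∀ {i s} → Inv i s → s 0 0ℤ ≡ + n × s c 0ℤ ≡ + i)
      (step  : ∀ {i s} → i ≤ n → Inv i s →
               Exec body s τ (λ s′ → s′ c 0ℤ ≡ + i × Inv (suc i) (s′ [ c , 0ℤ ]≔ (+ suc i)))) where

      private
        guard : Test
        guard = get c zeroE ≤? get 0 zeroE

        rest : Program
        rest = body ⨾ put c zeroE (add (get c zeroE) (lit 1ℤ))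

        stepX : ∀ {i s} → i ≤ n → Inv i s → Exec rest s (τ + 32) (Inv (suc i))
        stepX {i} i≤n inv = seqX (step i≤n inv) λ s (e , q) →
          let eq = trans (cong (ℤ._+ 1ℤ) e) (+suc i) in
          putX (≤ᵇ⇒≤ 1 13 tt) (≤ᵇ⇒≤ 4 13 tt)
            (subst (λ v → ∣ v ∣ ≤ w) (sym eq) (≤-trans (s≤s i≤n) n<w))
            (subst (λ v → Inv (suc i) (s [ c , 0ℤ ]≔ v)) (sym eq) q)

        iterate : ∀ k {i s} → k + i ≡ suc n → Inv i s →
                  Exec (while guard rest) s (k * (32 + (τ + 32)) + 32) (Inv (suc n))
        iterate zero {i} {s} refl inv = exec (while-stop stop) (≤ᵇ⇒≤ 5 32 tt) inv
          where
          stop : ¬ Holds s guard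
          stop h rewrite proj₁ (known inv) | proj₂ (known inv) = 1+n≰n (ℤP.drop‿+≤+ h)
        iterate (suc k) {i} {s} e inv
          with stepX i≤n inv
          where
          i≤n : i ≤ n
          i≤n = ≤-trans (m≤n+m i k) (≤-reflexive (suc-injective e))
        ... | exec r b p with iterate k (trans (+-suc k i) e) p
        ... | exec r′ b′ p′ = exec (while-step go r r′) le p′
          where
          go : Holds s guard
          go rewrite proj₁ (known inv) | proj₂ (known inv) =
            ℤ.+≤+ (≤-trans (m≤n+m i k) (≤-reflexive (suc-injective e)))
          le : _ ≤ (32 + (τ + 32)) + k * (32 + (τ + 32)) + 32
          le = ≤-trans (+-mono-≤ (≤ᵇ⇒≤ 5 32 tt) (+-mono-≤ b b′))
                 (≤-reflexive (trans (sym (+-assoc 32 (τ + 32) _))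
                                     (sym (+-assoc (32 + (τ + 32)) (k * (32 + (τ + 32))) 32))))

      loopX : ∀ {s} → Inv 0 (s [ c , 0ℤ ]≔ 0ℤ) → Exec (loop c body) s (loopCost n τ) (Inv (suc n))
      loopX inv = seqX (putX (≤ᵇ⇒≤ 1 13 tt) (≤ᵇ⇒≤ 1 13 tt) z≤n inv) λ s p →
        iterate (suc n) (+-identityʳ _) p

  -- Growth of integers

  n<2^n : ∀ m → m < 2 ^ m
  n<2^n zero    = s≤s z≤n
  n<2^n (suc m) = begin-strict
    suc m                ≤⟨ n<2^n m ⟩
    2 ^ m                <⟨ m<m+n (2 ^ m) (m^n>0 2 m) ⟩
    2 ^ m + 2 ^ m        ≡⟨ cong (λ z → 2 ^ m + z) (sym (+-identityʳ (2 ^ m))) ⟩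
    2 ^ suc m            ∎
    where open ≤-Reasoning

  opaque
    -- Bounds integers that started below `V` and gained `c` bits. Opaque, so that no power with a
    -- concrete exponent is computed.
    scale : ℕ → ℕ → ℕ
    scale c V = 2 ^ c * V

    scale-def : ∀ c V → scale c V ≡ 2 ^ c * V
    scale-def c V = refl

    scale-mono : ∀ {a b} V → a ≤ b → scale a V ≤ scale b V
    scale-mono V a≤b = *-monoˡ-≤ V (^-monoʳ-≤ 2 a≤b)

    scale-+ : ∀ a b V → scale a (scale b V) ≡ scale (a + b) V
    scale-+ a b V = trans (sym (*-assoc (2 ^ a) (2 ^ b) V)) (cong (_* V) (sym (^-distribˡ-+-* 2 a b)))

    scale-double : ∀ {a b c} V {x y} → a < c → b < c → x ≤ scale a V → y ≤ scale b V → x + y ≤ scale c V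
    scale-double {a} {b} {suc c} V {x} {y} (s≤s a≤c) (s≤s b≤c) p q = begin
      x + y                     ≤⟨ +-mono-≤ (≤-trans p (scale-mono V a≤c)) (≤-trans q (scale-mono V b≤c)) ⟩
      2 ^ c * V + 2 ^ c * V     ≡⟨ *-distribʳ-+ V (2 ^ c) (2 ^ c) ⟨
      (2 ^ c + 2 ^ c) * V       ≡⟨ cong (λ z → (2 ^ c + z) * V) (+-identityʳ (2 ^ c)) ⟨
      2 ^ suc c * V             ∎
      where open ≤-Reasoning

    -- Crude: a factor `m` is charged `m` bits, through m < 2 ^ m. This is affordable because the
    -- only such factor is the number n + 1 of terms of a sum.
    scale-times : ∀ {a c} V m {x} → m + a ≤ c → x ≤ m * scale a V → x ≤ scale c V
    scale-times {a} {c} V m {x} le p = begin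
      x                       ≤⟨ p ⟩
      m * (2 ^ a * V)         ≤⟨ *-monoˡ-≤ _ (<⇒≤ (n<2^n m)) ⟩
      2 ^ m * (2 ^ a * V)     ≡⟨ scale-+ m a V ⟩
      2 ^ (m + a) * V         ≤⟨ scale-mono V le ⟩
      2 ^ c * V               ∎
      where open ≤-Reasoning

    scale-base : ∀ c V {x} → x ≤ V → x ≤ scale c V
    scale-base c V {x} p = ≤-trans p (m≤n*m V (2 ^ c) ⦃ m^n≢0 2 c ⦄)

    scale-lit : ∀ {a c} V → 1 ≤ V → a ≤ c → a ≤ scale c V
    scale-lit {a} {c} V 1≤V a≤c = ≤-trans (<⇒≤ (n<2^n a))
      (≤-trans (^-monoʳ-≤ 2 a≤c) (m≤m*n _ V ⦃ ℕ.>-nonZero 1≤V ⦄))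

  loopCost-≥ : ∀ n τ → suc n + τ ≤ loopCost n τ
  loopCost-≥ n τ = begin
    suc n + τ                               ≡⟨ +-comm (suc n) τ ⟩
    τ + suc n                               ≤⟨ +-mono-≤ (m≤m+n τ (n * τ)) (m≤m*n (suc n) 64) ⟩
    suc n * τ + suc n * 64                  ≡⟨ *-distribˡ-+ (suc n) τ 64 ⟨
    suc n * (τ + 64)                        ≡⟨ cong (suc n *_) (arith τ) ⟩
    suc n * (32 + (τ + 32))                 ≤⟨ ≤-trans (m≤m+n _ 32) (m≤n+m _ 32) ⟩
    loopCost n τ                            ∎
    where
    open ≤-Reasoning
    arith : ∀ τ → τ + 64 ≡ 32 + (τ + 32)
    arith τ = trans (sym (+-assoc τ 32 32)) (+-comm (τ + 32) 32)

  loopCost-mul : ∀ n τ → suc n * τ ≤ loopCost n τ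
  loopCost-mul n τ = begin
    suc n * τ                  ≤⟨ *-monoʳ-≤ (suc n) (≤-trans (m≤m+n τ 32) (m≤n+m _ 32)) ⟩
    suc n * (32 + (τ + 32))    ≤⟨ ≤-trans (m≤m+n _ 32) (m≤n+m _ 32) ⟩
    loopCost n τ               ∎
    where open ≤-Reasoning

  ∑-bound : ∀ m {g} {b} → (∀ v → v < m → ∣ g v ∣ ≤ b) → ∣ ∑ m g ∣ ≤ m * b
  ∑-bound zero    h = z≤n
  ∑-bound (suc m) {g} {b} h = begin
    ∣ ∑ m g ℤ.+ g m ∣      ≤⟨ ℤP.∣i+j∣≤∣i∣+∣j∣ (∑ m g) (g m) ⟩
    ∣ ∑ m g ∣ + ∣ g m ∣    ≤⟨ +-mono-≤ (∑-bound m λ v l → h v (m≤n⇒m≤1+n l)) (h m ≤-refl) ⟩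
    m * b + b              ≡⟨ +-comm (m * b) b ⟩
    suc m * b              ∎
    where open ≤-Reasoning

  Bounded : ℕ → ℕ → St → Set
  Bounded n V σ = ∀ x i j → i ≤ n → j ≤ n → ∣ σ x i j ∣ ≤ V

  module Growth {n : ℕ} (f : SetFunction n) (V : ℕ) (n<V : suc n ≤ V) (f≤V : ∀ X → ∣ f X ∣ ≤ V) where
    open Semantics n f

    ∣bit∣≤1 : ∀ b → ∣ bit b ∣ ≤ 1
    ∣bit∣≤1 false = z≤n
    ∣bit∣≤1 true  = ≤-refl

    atom-bound : ∀ {d} (a : Atom d) {ρ} → (∀ i → lookup ρ i ≤ n) → ⟦ a ⟧ᵃ ρ ≤ n
    atom-bound (ctr i) h = h i
    atom-bound top     h = ≤-refl
    atom-bound org     h = z≤n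

    ∷-bound : ∀ {d v} {ρ : Vec ℕ d} → v ≤ n → (∀ i → lookup ρ i ≤ n) → ∀ i → lookup (v ∷ ρ) i ≤ n
    ∷-bound v≤n h zero    = v≤n
    ∷-bound v≤n h (suc i) = h i

    grow : ∀ {d} (e : Ex d) {ρ σ} → (∀ i → lookup ρ i ≤ n) → Bounded n V σ → ∣ ⟦ e ⟧ ρ σ ∣ ≤ scale (costE e n)
        V
    grow (lit z) h b = scale-lit V (≤-trans (s≤s z≤n) n<V) (m≤n+m ∣ z ∣ 32)
    grow (idx a) h b = scale-base 32 V (≤-trans (atom-bound a h) (≤-trans (n≤1+n n) n<V))
    grow (var x i j) h b = scale-base 32 V (b x _ _ (atom-bound i h) (atom-bound j h))
    grow (a ⊕ c) {ρ} {σ} h b = ≤-trans (ℤP.∣i+j∣≤∣i∣+∣j∣ (⟦ a ⟧ ρ σ) _)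
      (scale-double V (m<m+n _ (≤-trans (s≤s z≤n) (m≤n+m 32 (costE c n))))
                    (≤-trans (m<m+n (costE c n) (s≤s z≤n)) (m≤n+m _ (costE a n)))
                    (grow a h b) (grow c h b))
    grow (a ⊖ c) {ρ} {σ} h b = ≤-trans (ℤP.∣i-j∣≤∣i∣+∣j∣ (⟦ a ⟧ ρ σ) _)
      (scale-double V (m<m+n _ (≤-trans (s≤s z≤n) (m≤n+m 32 (costE c n))))
                    (≤-trans (m<m+n (costE c n) (s≤s z≤n)) (m≤n+m _ (costE a n)))
                    (grow a h b) (grow c h b))
    grow (a ≼ c) {ρ} {σ} h b = scale-base (costE (a ≼ c) n) V
      (≤-trans (∣bit∣≤1 (does (⟦ a ⟧ ρ σ ℤ.≤? ⟦ c ⟧ ρ σ))) (≤-trans (s≤s z≤n) n<V))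
    grow (ite c a a′) {ρ} {σ} h b with nz (⟦ c ⟧ ρ σ)
    ... | true  = ≤-trans (grow a h b)
      (scale-mono V (≤-trans (m≤m+n (costE a n) (costE a′ n)) (≤-trans (m≤n+m _ 64) (m≤n+m _ (costE c n)))))
    ... | false = ≤-trans (grow a′ h b)
      (scale-mono V (≤-trans (m≤n+m (costE a′ n) (costE a n)) (≤-trans (m≤n+m _ 64) (m≤n+m _ (costE c n)))))
    grow (sum e) {ρ} {σ} h b = scale-times {costE e n} V (suc n)
      (≤-trans (+-monoʳ-≤ (suc n) (m≤m+n (costE e n) 32))
        (≤-trans (loopCost-≥ n (costE e n + 32)) (m≤n+m _ 32)))
      (∑-bound (suc n) λ v l → grow e (∷-bound (≤-pred l) h) b)
    grow (qry e) h b = scale-base (costE (qry e) n) V (f≤V _)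

  -- Correctness of the translation

  module Correctness {n : ℕ} (f : SetFunction n) (w : ℕ) (n<w : suc n ≤ w) where
    open Semantics n f
    open Execution f w n<w

    -- A stack discipline: an expression compiled at depth `δ` overwrites temporaries from `δ` on
    -- only, so the counters and partial results below `δ` survive.
    Agree : ℕ → Memory → Memory → Set
    Agree δ s s′ = ∀ a z → (∀ j → δ ≤ j → a ≢ scr j) → s′ a z ≡ s a z

    agree-trans : ∀ {δ s s′ s″} → Agree δ s s′ → Agree δ s′ s″ → Agree δ s s″
    agree-trans p q a z h = trans (q a z h) (p a z h)

    agree-weaken : ∀ {δ ε s s′} → δ ≤ ε → Agree ε s s′ → Agree δ s s′
    agree-weaken δ≤ε p a z h = p a z λ j l → h j (≤-trans δ≤ε l)

    agree-put : ∀ {δ s i v} k → δ ≤ k → Agree δ s (s [ scr k , i ]≔ v)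
    agree-put {δ} {s} {i} {v} k l a z h = upd-name s (scr k) i v (h k l)

    low-zero : ∀ {δ} j → δ ≤ j → 0 ≢ scr j
    low-zero j _ ()

    low-dat : ∀ {δ x} j → δ ≤ j → dat x ≢ scr j
    low-dat {_} {x} j _ = dat≢scr {x} {j}

    low-scr : ∀ {δ k} → k < δ → ∀ j → δ ≤ j → scr k ≢ scr j
    low-scr {δ} {k} k<δ j δ≤j e = 1+n≰n (≤-trans (subst (_< δ) (scr-inj {k} {j} e) k<δ) δ≤j)

    record Rep {d} (δ : ℕ) (env ρ : Vec ℕ d) (σ : St) (s : Memory) : Set where
      constructor rep
      field
        size  : s 0 0ℤ ≡ + n
        ctrs  : ∀ i → s (scr (lookup env i)) 0ℤ ≡ + lookup ρ i
        inner : ∀ i → lookup ρ i ≤ n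
        below : ∀ i → lookup env i < δ
        cells : ∀ x i j → i ≤ n → j ≤ n → s (dat x) (+ (i * suc n + j)) ≡ σ x i j
    open Rep

    rep-agree : ∀ {d δ} {env ρ : Vec ℕ d} {σ s s′} → Agree δ s s′ → Rep δ env ρ σ s → Rep δ env ρ σ s′
    rep-agree p r = rep (trans (p 0 0ℤ low-zero) (size r))
      (λ i → trans (p _ 0ℤ (low-scr (below r i))) (ctrs r i)) (inner r) (below r)
      (λ x i j l l′ → trans (p _ _ (low-dat {x = x})) (cells r x i j l l′))

    rep-weaken : ∀ {d δ ε} {env ρ : Vec ℕ d} {σ s} → δ ≤ ε → Rep δ env ρ σ s → Rep ε env ρ σ s
    rep-weaken l r = rep (size r) (ctrs r) (inner r) (λ i → ≤-trans (below r i) l) (cells r)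

    rep-push : ∀ {d δ ε} {env ρ : Vec ℕ d} {σ s v} → δ < ε → s (scr δ) 0ℤ ≡ + v → v ≤ n →
               Rep ε env ρ σ s → Rep ε (δ ∷ env) (v ∷ ρ) σ s
    rep-push l e v≤n r = rep (size r)
      (λ { zero → e ; (suc i) → ctrs r i }) (λ { zero → v≤n ; (suc i) → inner r i })
      (λ { zero → l ; (suc i) → below r i }) (cells r)

    atom-eval : ∀ {d δ} {env ρ : Vec ℕ d} {σ s} → Rep δ env ρ σ s → ∀ a → eval s (atomE env a) ≡ + ⟦ a ⟧ᵃ ρ
    atom-eval r (ctr i) = ctrs r i
    atom-eval r top     = size r
    atom-eval r org     = refl

    atom-inner : ∀ {d δ} {env ρ : Vec ℕ d} {σ s} → Rep δ env ρ σ s → ∀ a → ⟦ a ⟧ᵃ ρ ≤ n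
    atom-inner r (ctr i) = inner r i
    atom-inner r top     = ≤-refl
    atom-inner r org     = z≤n

    atom-cost : ∀ {d} (env : Vec ℕ d) a → cost (atomE env a) ≤ 2
    atom-cost env (ctr i) = ≤-refl
    atom-cost env top     = ≤-refl
    atom-cost env org     = s≤s z≤n

    ix-eval : ∀ {s a b i j} → s 0 0ℤ ≡ + n → eval s a ≡ + i → eval s b ≡ + j →
              eval s (ixE a b) ≡ + (i * suc n + j)
    ix-eval {s} {i = i} {j} e p q rewrite e | p | q =
      cong (ℤ._+ + j) (trans (cong (+ i ℤ.*_) (+suc n)) (sym (ℤP.pos-* i (suc n))))

    ix-cost : ∀ {a b} → cost a ≤ 2 → cost b ≤ 2 → cost (ixE a b) ≤ 12
    ix-cost {a} {b} p q = ≤-trans (s≤s (+-mono-≤ (s≤s (+-monoˡ-≤ _ p)) q)) (≤ᵇ⇒≤ 10 12 tt)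

    ix-injective : ∀ {i i′ j j′} → j ≤ n → j′ ≤ n → i * suc n + j ≡ i′ * suc n + j′ → i ≡ i′ × j ≡ j′
    ix-injective {zero}  {zero}  p q e = refl , e
    ix-injective {zero}  {suc i′} p q e =
        ⊥-elim (1+n≰n (≤-trans (≤-trans (m≤m+n (suc n) (i′ * suc n)) (m≤m+n _ _))
        (≤-trans (≤-reflexive (sym e)) p)))
    ix-injective {suc i} {zero}  p q e =
        ⊥-elim (1+n≰n (≤-trans (≤-trans (m≤m+n (suc n) (i * suc n)) (m≤m+n _ _)) (≤-trans (≤-reflexive e) q)))
    ix-injective {suc i} {suc i′} {j} {j′} p q e
      with ix-injective {i} {i′} p q (+-cancelˡ-≡ (suc n) _ _
             (trans (sym (+-assoc (suc n) (i * suc n) j)) (trans e (+-assoc (suc n) (i′ * suc n) j′))))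
    ... | refl , e′ = refl , e′

    scr≢ : ∀ {i j} → i ≢ j → scr i ≢ scr j
    scr≢ {i} {j} h e = h (scr-inj {i} {j} e)

    chooseX : ∀ {d e P R s τ Q} → cost d ≤ 13 → cost e ≤ 13 →
              (Holds s (d ≤? e) → Exec P s τ Q) → (¬ Holds s (d ≤? e) → Exec R s τ Q) →
              Exec (choose (d ≤? e) P R) s (32 + τ) Q
    chooseX {d} {e} {s = s} cd ce yes′ no′ with eval s d ℤ.≤? eval s e
    ... | yes h with yes′ h
    ...   | exec r b p = exec (choose-yes h r) (+-mono-≤ (≤-trans (s≤s (+-mono-≤ cd ce)) (≤ᵇ⇒≤ 27 32 tt)) b) p
    chooseX cd ce yes′ no′ | no h with no′ h
    ...   | exec r b p = exec (choose-no h r) (+-mono-≤ (≤-trans (s≤s (+-mono-≤ cd ce)) (≤ᵇ⇒≤ 27 32 tt)) b) p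

    Result : ℕ → Memory → ℤ → Memory → Set
    Result δ s v s′ = s′ (scr δ) 0ℤ ≡ v × Agree δ s s′

    resultX : ∀ {δ e v s} → cost e ≤ 13 → eval s e ≡ v → ∣ v ∣ ≤ w →
              Exec (put (scr δ) zeroE e) s 32 (Result δ s v)
    resultX {δ} {e} {v} {s} ce eq le = putX (≤ᵇ⇒≤ 1 13 tt) ce (subst (λ z → ∣ z ∣ ≤ w) (sym eq) le)
      (trans (upd-same s (scr δ) 0ℤ (eval s e)) eq , agree-put δ ≤-refl)

    nz-true : ∀ {z} → z ≢ 0ℤ → nz z ≡ true
    nz-true {z} h = cong not (dec-false (z ℤ.≟ 0ℤ) h)

    pointwise : ∀ {g : ℕ → ℤ} {s : Memory} {a v} i →
                (∀ k → k < i → s a (+ k) ≡ g k) → v ≡ g i →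
                ∀ k → k < suc i → (s [ a , + i ]≔ v) a (+ k) ≡ g k
    pointwise {s = s} {a} {v} i h e k k<1+i with k ℕ.≟ i
    ... | yes refl = trans (upd-same s a (+ i) v) e
    ... | no k≢i   = trans (upd-index s a (+ i) v λ { refl → k≢i refl }) (h k (≤∧≢⇒< (≤-pred k<1+i) k≢i))

    module Compile (V : ℕ) (n<V : suc n ≤ V) (f≤V : ∀ X → ∣ f X ∣ ≤ V) where
      open Growth f V n<V f≤V

      private
        13≥ : ∀ m → {_ : T (m ℕ.≤ᵇ 13)} → m ≤ 13
        13≥ m {p} = ≤ᵇ⇒≤ m 13 p

      compileX : ∀ {d} (e : Ex d) {δ env ρ σ s} → Rep δ env ρ σ s → Bounded n V σ → scale (costE e n) V ≤ w →
                 Exec (compileE e δ env) s (costE e n) (Result δ s (⟦ e ⟧ ρ σ))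
      compileX (lit z) {ρ = ρ} {σ} r bd fit = weaken (m≤m+n 32 ∣ z ∣) (λ _ p → p)
        (resultX (13≥ 1) refl (≤-trans (grow (lit z) {ρ} {σ} (inner r) bd) fit))
      compileX (idx a) {env = env} {ρ} {σ} r bd fit =
        resultX (≤-trans (atom-cost env a) (13≥ 2)) (atom-eval r a)
            (≤-trans (grow (idx a) {ρ} {σ} (inner r) bd) fit)
      compileX (var x a b) {env = env} {ρ} {σ} {s} r bd fit =
        resultX (s≤s (ix-cost {atomE env a} {atomE env b} (atom-cost env a) (atom-cost env b)))
          (trans (cong (s (dat x)) (ix-eval {s} {atomE env a} {atomE env b} (size r) (atom-eval r a)
              (atom-eval r b)))
            (cells r x _ _ (atom-inner r a) (atom-inner r b)))
          (≤-trans (grow (var x a b) {ρ} {σ} (inner r) bd) fit)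
      compileX (a ⊕ b) {δ} {ρ = ρ} {σ} {s} r bd fit =
        seqX (compileX a r bd (≤-trans (scale-mono V (m≤m+n (costE a n) _)) fit)) λ s₁ (e₁ , g₁) →
        seqX (compileX b (rep-weaken (n≤1+n δ) (rep-agree g₁ r)) bd
                (≤-trans (scale-mono V (≤-trans (m≤m+n (costE b n) 32) (m≤n+m _ (costE a n)))) fit)) λ s₂
                    (e₂ , g₂) →
        weaken ≤-refl (λ _ (e , g) → e , agree-trans g₁ (agree-trans (agree-weaken (n≤1+n δ) g₂) g))
          (resultX (13≥ 5) (cong₂ ℤ._+_ (trans (g₂ _ _ (low-scr ≤-refl)) e₁) e₂)
            (≤-trans (grow (a ⊕ b) {ρ} {σ} (inner r) bd) fit))
      compileX (a ⊖ b) {δ} {ρ = ρ} {σ} {s} r bd fit =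
        seqX (compileX a r bd (≤-trans (scale-mono V (m≤m+n (costE a n) _)) fit)) λ s₁ (e₁ , g₁) →
        seqX (compileX b (rep-weaken (n≤1+n δ) (rep-agree g₁ r)) bd
                (≤-trans (scale-mono V (≤-trans (m≤m+n (costE b n) 32) (m≤n+m _ (costE a n)))) fit)) λ s₂
                    (e₂ , g₂) →
        weaken ≤-refl (λ _ (e , g) → e , agree-trans g₁ (agree-trans (agree-weaken (n≤1+n δ) g₂) g))
          (resultX (13≥ 5) (cong₂ ℤ._-_ (trans (g₂ _ _ (low-scr ≤-refl)) e₁) e₂)
            (≤-trans (grow (a ⊖ b) {ρ} {σ} (inner r) bd) fit))
      compileX (a ≼ b) {δ} {ρ = ρ} {σ} {s} r bd fit =
        seqX (compileX a r bd (≤-trans (scale-mono V (m≤m+n (costE a n) _)) fit)) λ s₁ (e₁ , g₁) →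
        seqX (compileX b (rep-weaken (n≤1+n δ) (rep-agree g₁ r)) bd
                (≤-trans (scale-mono V (≤-trans (m≤m+n (costE b n) 64) (m≤n+m _ (costE a n)))) fit)) λ s₂
                    (e₂ , g₂) →
        let ea  = trans (g₂ _ _ (low-scr ≤-refl)) e₁
            fin = λ s′ (p : Result δ s₂ _ s′) →
                    proj₁ p , agree-trans g₁ (agree-trans (agree-weaken (n≤1+n δ) g₂) (proj₂ p))
            one = ≤-trans (s≤s z≤n) n<w in
        chooseX (13≥ 2) (13≥ 2)
          (λ h → weaken ≤-refl fin (resultX (13≥ 1)
            (sym (cong bit (dec-true (⟦ a ⟧ ρ σ ℤ.≤? ⟦ b ⟧ ρ σ) (subst₂ ℤ._≤_ ea e₂ h))))
            (≤-trans (∣bit∣≤1 (does (⟦ a ⟧ ρ σ ℤ.≤? ⟦ b ⟧ ρ σ))) one)))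
          (λ h → weaken ≤-refl fin (resultX (13≥ 1)
            (sym (cong bit (dec-false (⟦ a ⟧ ρ σ ℤ.≤? ⟦ b ⟧ ρ σ) (λ q →
                h (subst₂ ℤ._≤_ (sym ea) (sym e₂) q)))))
            (≤-trans (∣bit∣≤1 (does (⟦ a ⟧ ρ σ ℤ.≤? ⟦ b ⟧ ρ σ))) one)))
      compileX (ite c a b) {δ} {env} {ρ} {σ} {s} r bd fit =
        seqX (compileX c r bd (≤-trans (scale-mono V (m≤m+n (costE c n) _)) fit)) λ s₁ (e₁ , g₁) →
        let ab  = costE a n + costE b n
            fin : ∀ v → v ≡ ⟦ ite c a b ⟧ ρ σ → ∀ s′ → Result δ s₁ v s′ → Result δ s (⟦ ite c a b ⟧ ρ σ) s′
            fin v eq s′ p = trans (proj₁ p) eq , agree-trans g₁ (proj₂ p)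
            nonzero = λ (h : ⟦ c ⟧ ρ σ ≢ 0ℤ) → cong (λ t → if t then ⟦ a ⟧ ρ σ else ⟦ b ⟧ ρ σ)
                (sym (nz-true h))
            r₁ = rep-agree g₁ r
            fit′ = ≤-trans (scale-mono V (≤-trans (m≤n+m ab 64) (m≤n+m _ (costE c n)))) fit
            runA = compileX a r₁ bd (≤-trans (scale-mono V (m≤m+n (costE a n) (costE b n))) fit′)
            runB = compileX b r₁ bd (≤-trans (scale-mono V (m≤n+m (costE b n) (costE a n))) fit′) in
        chooseX (13≥ 2) (13≥ 1)
          (λ h → chooseX (13≥ 1) (13≥ 2)
            (λ h′ → weaken (m≤n+m (costE b n) (costE a n))
              (fin (⟦ b ⟧ ρ σ) (cong (λ v → if nz v then ⟦ a ⟧ ρ σ else ⟦ b ⟧ ρ σ)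
                (ℤP.≤-antisym (subst (0ℤ ℤ.≤_) e₁ h′) (subst (ℤ._≤ 0ℤ) e₁ h)))) runB)
            (λ h′ → weaken (m≤m+n (costE a n) (costE b n))
              (fin (⟦ a ⟧ ρ σ) (nonzero λ eq → h′ (ℤP.≤-reflexive (sym (trans e₁ eq))))) runA))
          (λ h → weaken (≤-trans (m≤m+n (costE a n) (costE b n)) (m≤n+m ab 32))
            (fin (⟦ a ⟧ ρ σ) (nonzero λ eq → h (ℤP.≤-reflexive (trans e₁ eq)))) runA)
      compileX (sum e) {δ} {env} {ρ} {σ} {s} r bd fit =
        seqX (resultX {δ} (13≥ 1) refl z≤n) λ s₁ (e₁ , g₁) →
        weaken ≤-refl (λ s′ (g , e′ , _) → e′ , g)
          (loopX (scr (1 + δ)) _ (costE e n + 32) Inv known step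
            ( agree-trans g₁ (agree-put (1 + δ) (n≤1+n δ))
            , trans (upd-name s₁ (scr (1 + δ)) 0ℤ 0ℤ (scr≢ {δ} {1 + δ} (<⇒≢ ≤-refl))) e₁
            , upd-same s₁ (scr (1 + δ)) 0ℤ 0ℤ))
        where
        g : ℕ → ℤ
        g v = ⟦ e ⟧ (v ∷ ρ) σ
        Inv : ℕ → Memory → Set
        Inv i s′ = Agree δ s s′ × s′ (scr δ) 0ℤ ≡ ∑ i g × s′ (scr (1 + δ)) 0ℤ ≡ + i
        known : ∀ {i s′} → Inv i s′ → s′ 0 0ℤ ≡ + n × s′ (scr (1 + δ)) 0ℤ ≡ + i
        known (a , _ , c) = trans (a 0 0ℤ low-zero) (size r) , c
        κ = costE e n
        κ≤ : κ ≤ costE (sum e) n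
        κ≤ = ≤-trans (≤-trans (≤-trans (m≤m+n κ 32) (m≤n+m _ (suc n))) (loopCost-≥ n (κ + 32))) (m≤n+m _ 32)
        -- Every partial sum is written to memory, so each one has to fit, not only the total.
        partial : ∀ {i} → i ≤ n → ∣ ∑ (suc i) g ∣ ≤ w
        partial {i} i≤n = ≤-trans (scale-times {κ} V (suc n)
          (≤-trans (+-monoʳ-≤ (suc n) (m≤m+n κ 32)) (≤-trans (loopCost-≥ n (κ + 32)) (m≤n+m _ 32)))
          (≤-trans (∑-bound (suc i) λ v l → grow e (∷-bound (≤-trans (≤-pred l) i≤n) (inner r)) bd)
            (*-monoˡ-≤ _ (s≤s i≤n)))) fit
        step : ∀ {i s′} → i ≤ n → Inv i s′ → Exec _ s′ (κ + 32)
                 (λ s″ → s″ (scr (1 + δ)) 0ℤ ≡ + i × Inv (suc i) (s″ [ scr (1 + δ) , 0ℤ ]≔ (+ suc i)))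
        step {i} {s′} i≤n (ag , acc , c) =
          seqX (compileX e
                  (rep-push {δ = 1 + δ} ≤-refl c i≤n (rep-weaken (≤-trans (n≤1+n δ) (n≤1+n (1 + δ)))
                      (rep-agree ag r)))
                  bd (≤-trans (scale-mono V κ≤) fit)) λ s₁ (e₁ , g₁) →
          weaken ≤-refl (λ s₂ (e₂ , g₂) →
              let c₂ = trans (upd′ s₂ g₂) (trans (g₁ _ _ (low-scr ≤-refl)) c) in
              c₂
            , ( agree-trans ag (agree-trans (agree-weaken (≤-trans (n≤1+n δ) (n≤1+n _)) g₁)
                  (agree-trans (proj₁ g₂) (agree-put (1 + δ) (n≤1+n δ))))
              , trans (upd-name s₂ (scr (1 + δ)) 0ℤ (+ suc i) (scr≢ {δ} {1 + δ} (<⇒≢ ≤-refl))) e₂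
              , upd-same s₂ (scr (1 + δ)) 0ℤ (+ suc i)))
            (putX {a = scr δ} {Q = λ s₂ → s₂ (scr δ) 0ℤ ≡ ∑ (suc i) g × Agree δ s₁ s₂ ×
                         (∀ z → s₂ (scr (1 + δ)) z ≡ s₁ (scr (1 + δ)) z)} (13≥ 1) (13≥ 5)
              (subst (λ z → ∣ z ∣ ≤ w) (sym (value g₁ e₁)) (partial i≤n))
              ( trans (upd-same s₁ (scr δ) 0ℤ _) (value g₁ e₁)
              , agree-put δ ≤-refl , λ z → upd-name s₁ (scr δ) 0ℤ _ (scr≢ {1 + δ} {δ} 1+n≢n)))
          where
          value : ∀ {s₁} → Agree (2 + δ) s′ s₁ → s₁ (scr (2 + δ)) 0ℤ ≡ g i →
                  s₁ (scr δ) 0ℤ ℤ.+ s₁ (scr (2 + δ)) 0ℤ ≡ ∑ (suc i) g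
          value g₁ e₁ = cong₂ ℤ._+_ (trans (g₁ _ _ (low-scr (n≤1+n _))) acc) e₁
          upd′ : ∀ {s₁} s₂ → Agree δ s₁ s₂ × (∀ z → s₂ (scr (1 + δ)) z ≡ s₁ (scr (1 + δ)) z) →
                 s₂ (scr (1 + δ)) 0ℤ ≡ s₁ (scr (1 + δ)) 0ℤ
          upd′ s₂ p = proj₂ p 0ℤ
      compileX (qry e) {δ} {env} {ρ} {σ} {s} r bd fit =
        seqX (loopX (scr (1 + δ)) _ (κ + 32) Inv known step
          ( agree-put (1 + δ) (n≤1+n δ) , (λ _ ()) , upd-same s (scr (1 + δ)) 0ℤ 0ℤ)) λ s₁ (ag , acc , _) →
        let eq = cong f (tabulate-cong {n = n} λ k → cong nz (acc (toℕ k) (m≤n⇒m≤1+n (toℕ<n k))))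
            le = ≤-trans (f≤V (readSet n s₁ (scr δ))) (≤-trans (scale-base (costE (qry e) n) V ≤-refl) fit) in
        exec (query le) (≤ᵇ⇒≤ 2 32 tt)
          (trans (upd-same s₁ (scr δ) 0ℤ _) eq , agree-trans ag (agree-put δ ≤-refl))
        where
        g : ℕ → ℤ
        g v = ⟦ e ⟧ (v ∷ ρ) σ
        Inv : ℕ → Memory → Set
        Inv i s′ = Agree δ s s′ × (∀ v → v < i → s′ (scr δ) (+ v) ≡ g v) × s′ (scr (1 + δ)) 0ℤ ≡ + i
        known : ∀ {i s′} → Inv i s′ → s′ 0 0ℤ ≡ + n × s′ (scr (1 + δ)) 0ℤ ≡ + i
        known (a , _ , c) = trans (a 0 0ℤ low-zero) (size r) , c
        κ = costE e n
        κ≤ : κ ≤ costE (qry e) n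
        κ≤ = ≤-trans (≤-trans (≤-trans (m≤m+n κ 32) (m≤n+m _ (suc n))) (loopCost-≥ n (κ + 32))) (m≤m+n _ 32)
        step : ∀ {i s′} → i ≤ n → Inv i s′ → Exec _ s′ (κ + 32)
                 (λ s″ → s″ (scr (1 + δ)) 0ℤ ≡ + i × Inv (suc i) (s″ [ scr (1 + δ) , 0ℤ ]≔ (+ suc i)))
        step {i} {s′} i≤n (ag , acc , c) =
          seqX (compileX e
                  (rep-push {δ = 1 + δ} ≤-refl c i≤n (rep-weaken (≤-trans (n≤1+n δ) (n≤1+n (1 + δ)))
                      (rep-agree ag r)))
                  bd (≤-trans (scale-mono V κ≤) fit)) λ s₁ (e₁ , g₁) →
          let c₁ = trans (g₁ _ _ (low-scr ≤-refl)) c in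
          putX {a = scr δ} (13≥ 2) (13≥ 2)
            (subst (λ z → ∣ z ∣ ≤ w) (sym e₁)
              (≤-trans (grow e (∷-bound i≤n (inner r)) bd) (≤-trans (scale-mono V κ≤) fit)))
            (subst (λ z → let s₂ = s₁ [ scr δ , z ]≔ s₁ (scr (2 + δ)) 0ℤ in
                     s₂ (scr (1 + δ)) 0ℤ ≡ + i × Inv (suc i) (s₂ [ scr (1 + δ) , 0ℤ ]≔ (+ suc i)))
              (sym c₁)
              ( trans (upd-name s₁ (scr δ) (+ i) _ (scr≢ {1 + δ} {δ} 1+n≢n)) c₁
              , agree-trans ag (agree-trans (agree-weaken (≤-trans (n≤1+n δ) (n≤1+n _)) g₁)
                  (agree-trans (agree-put δ ≤-refl) (agree-put (1 + δ) (n≤1+n δ))))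
              , (λ v l → trans (upd-name (s₁ [ scr δ , + i ]≔ s₁ (scr (2 + δ)) 0ℤ) (scr (1 + δ)) 0ℤ (+ suc i)
                  (scr≢ {δ} {1 + δ} (<⇒≢ ≤-refl)))
                  (pointwise {g} {s₁} {scr δ} i (λ v l → trans (g₁ _ _ (low-scr (n≤1+n _))) (acc v l)) e₁ v
                      l))
              , upd-same (s₁ [ scr δ , + i ]≔ s₁ (scr (2 + δ)) 0ℤ) (scr (1 + δ)) 0ℤ (+ suc i)))

      -- `K` collects what the body needs of the memory. It is abstract because the double loop is
      -- used twice: to fill the temporary, where the data must be unchanged, and to copy it, where
      -- the temporary must stay intact.
      matrixX : ∀ {a P δ s₀ κ} (K : Memory → Set) (g : ℕ → ℕ → ℤ) →
        (∀ {s} → K s → s 0 0ℤ ≡ + n) →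
        a ≢ scr δ → a ≢ scr (1 + δ) →
        (∀ {s i v} → K s → K (s [ a , i ]≔ v)) →
        (∀ {s i v} → K s → K (s [ scr δ , i ]≔ v)) →
        (∀ {s i v} → K s → K (s [ scr (1 + δ) , i ]≔ v)) →
        (∀ i j → i ≤ n → j ≤ n → ∣ g i j ∣ ≤ w) →
        (∀ {s i j} → i ≤ n → j ≤ n → K s → s (scr δ) 0ℤ ≡ + i → s (scr (1 + δ)) 0ℤ ≡ + j →
          Exec P s κ λ s′ → K s′ × s′ (scr δ) 0ℤ ≡ + i × s′ (scr (1 + δ)) 0ℤ ≡ + j ×
            s′ (scr (3 + δ)) 0ℤ ≡ g i j × (∀ z → s′ a z ≡ s a z)) →
        K s₀ →
        Exec (matrixLoop a P δ) s₀ (loopCost n (loopCost n (κ + 32)))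
          (λ s → K s × ∀ i j → i ≤ n → j ≤ n → s a (+ (i * suc n + j)) ≡ g i j)
      matrixX {a} {P} {δ} {s₀} {κ} K g K-size a≢δ a≢1+δ K-a K-δ K-1+δ bound run k₀ =
        weaken ≤-refl (λ s (k , done , _) → k , λ i j i≤n j≤n → done i j (s≤s i≤n) j≤n)
          (loopX (scr δ) _ _ Outer (λ (k , _ , c) → K-size k , c) outer
            (K-δ k₀ , (λ _ _ ()) , upd-same s₀ (scr δ) 0ℤ 0ℤ))
        where
        Rows : ℕ → Memory → Set
        Rows i s = ∀ i′ j → i′ < i → j ≤ n → s a (+ (i′ * suc n + j)) ≡ g i′ j
        Outer : ℕ → Memory → Set
        Outer i s = K s × Rows i s × s (scr δ) 0ℤ ≡ + i
        Inner : ℕ → ℕ → Memory → Set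
        Inner i j s = K s × Rows i s × s (scr δ) 0ℤ ≡ + i ×
          (∀ j′ → j′ < j → s a (+ (i * suc n + j′)) ≡ g i j′) × s (scr (1 + δ)) 0ℤ ≡ + j
        inner-step : ∀ {i} → i ≤ n → ∀ {j s} → j ≤ n → Inner i j s → Exec _ s (κ + 32)
          (λ s′ → s′ (scr (1 + δ)) 0ℤ ≡ + j × Inner i (suc j) (s′ [ scr (1 + δ) , 0ℤ ]≔ (+ suc j)))
        inner-step {i} i≤n {j} {s} j≤n (k , rows , c , row , c′) =
          seqX (run i≤n j≤n k c c′) λ s₁ (k₁ , c₁ , c₁′ , e₁ , same) →
          let ix = ix-eval {s₁} {cell δ} {cell (1 + δ)} (K-size k₁) c₁ c₁′
              at = + (i * suc n + j)
              v  = s₁ (scr (3 + δ)) 0ℤ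
              s₂ = s₁ [ a , at ]≔ v
              frame = λ {z} → upd-name s₂ (scr (1 + δ)) 0ℤ (+ suc j) {a} {z} a≢1+δ
              δ≢1+δ = scr≢ {δ} {1 + δ} (<⇒≢ ≤-refl) in
          putX (ix-cost {cell δ} {cell (1 + δ)} ≤-refl ≤-refl ■ 13≥ 12) (13≥ 2)
            (subst (λ z → ∣ z ∣ ≤ w) (sym e₁) (bound i j i≤n j≤n))
            (subst (λ z → let s₂ = s₁ [ a , z ]≔ v in
                s₂ (scr (1 + δ)) 0ℤ ≡ + j × Inner i (suc j) (s₂ [ scr (1 + δ) , 0ℤ ]≔ (+ suc j)))
              (sym ix)
              ( trans (upd-name s₁ a at v (≢-sym a≢1+δ)) c₁′
              , K-1+δ (K-a k₁)
              , (λ i′ j′ l l′ → trans frame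
                  (trans (upd-index s₁ a at v (λ e → <⇒≢ l (proj₁ (ix-injective l′ j≤n (ℤP.+-injective e)))))
                    (trans (same _) (rows i′ j′ l l′))))
              , trans (upd-name s₂ (scr (1 + δ)) 0ℤ (+ suc j) δ≢1+δ) (trans (upd-name s₁ a at v (≢-sym a≢δ))
                  c₁)
              , (λ j′ l → trans frame (new s₁ at v refl j′ l e₁ (λ j′ l → trans (same _) (row j′ l)) i≤n j≤n))
              , upd-same s₂ (scr (1 + δ)) 0ℤ (+ suc j)))
          where
          _■_ : ∀ {x y z} → x ≤ y → y ≤ z → x ≤ z
          _■_ = ≤-trans
          new : ∀ s₁ at v → at ≡ + (i * suc n + j) → ∀ j′ → j′ < suc j → v ≡ g i j →
                (∀ j′ → j′ < j → s₁ a (+ (i * suc n + j′)) ≡ g i j′) → i ≤ n → j ≤ n →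
                (s₁ [ a , at ]≔ v) a (+ (i * suc n + j′)) ≡ g i j′
          new s₁ at v refl j′ l e old _ j≤n with j′ ℕ.≟ j
          ... | yes refl = trans (upd-same s₁ a at v) e
          ... | no j′≢j  = trans
            (upd-index s₁ a at v (λ q → j′≢j (+-cancelˡ-≡ (i * suc n) j′ j (ℤP.+-injective q))))
            (old j′ (≤∧≢⇒< (≤-pred l) j′≢j))
        outer : ∀ {i s} → i ≤ n → Outer i s → Exec _ s (loopCost n (κ + 32))
          (λ s′ → s′ (scr δ) 0ℤ ≡ + i × Outer (suc i) (s′ [ scr δ , 0ℤ ]≔ (+ suc i)))
        outer {i} {s} i≤n (k , rows , c) =
          weaken ≤-refl (λ s′ (k′ , rows′ , c′ , row′ , _) →
              c′ , K-δ k′ , (λ i′ j l l′ → trans (upd-name s′ (scr δ) 0ℤ _ a≢δ)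
                  (extend s′ rows′ row′ i′ j l l′))
            , upd-same s′ (scr δ) 0ℤ (+ suc i))
          (loopX (scr (1 + δ)) _ _ (Inner i) (λ (k , _ , _ , _ , c) → K-size k , c) (inner-step i≤n)
            ( K-1+δ k , (λ i′ j l l′ → trans (upd-name s (scr (1 + δ)) 0ℤ 0ℤ a≢1+δ) (rows i′ j l l′))
            , trans (upd-name s (scr (1 + δ)) 0ℤ 0ℤ (scr≢ {δ} {1 + δ} (<⇒≢ ≤-refl))) c
            , (λ _ ()) , upd-same s (scr (1 + δ)) 0ℤ 0ℤ))
          where
          extend : ∀ s′ → Rows i s′ → (∀ j → j < suc n → s′ a (+ (i * suc n + j)) ≡ g i j) → Rows (suc i) s′
          extend s′ rows′ row′ i′ j l l′ with i′ ℕ.≟ i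
          ... | yes refl = row′ j (s≤s l′)
          ... | no i′≢i  = rows′ i′ j (≤∧≢⇒< (≤-pred l) i′≢i) l′

  fill-cost : ∀ {d} x (e : Ex (suc (suc d))) n → costE e n ≤ costC (fill {d} x e) n
  fill-cost x e n = ≤-trans (≤-trans (≤-trans (≤-trans (m≤m+n (costE e n) 32) (m≤n+m _ (suc n)))
    (loopCost-≥ n _)) (≤-trans (m≤n+m _ (suc n)) (loopCost-≥ n _))) (m≤m+n _ (loopCost n (loopCost n 64)))

  update-bounded : ∀ {n V σ x g} → Bounded n V σ → (∀ i j → i ≤ n → j ≤ n → ∣ g i j ∣ ≤ V) →
                   Bounded n V (σ ⟪ x ⟫≔ g)
  update-bounded {x = x} b h y i j i≤n j≤n with does (y ℕ.≟ x)
  ... | true  = h i j i≤n j≤n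
  ... | false = b y i j i≤n j≤n

  bounded-weaken : ∀ {n V V′} σ → V ≤ V′ → Bounded n V σ → Bounded n V′ σ
  bounded-weaken σ l b x i j p q = ≤-trans (b x i j p q) l

  module CommandGrowth {n : ℕ} (f : SetFunction n) where
    open Semantics n f

    -- Like time, bit growth adds up along sequential composition and is multiplied by n + 1 in a
    -- loop; hence one cost function can bound both.
    growC : ∀ {d} (c : Cmd d) {V ρ σ} → suc n ≤ V → (∀ X → ∣ f X ∣ ≤ V) → (∀ i → lookup ρ i ≤ n) →
            Bounded n V σ → Bounded n (scale (costC c n) V) (⟪ c ⟫ ρ σ)
    growC (fill x e) {V} {σ = σ} n<V f≤V h b =
      update-bounded {σ = σ} (bounded-weaken σ (scale-base _ V ≤-refl) b) λ i j i≤n j≤n →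
        ≤-trans (grow e (∷-bound j≤n (∷-bound i≤n h)) b) (scale-mono V (fill-cost x e n))
      where open Growth f V n<V f≤V
    growC (c ▸ c′) {V} {ρ} {σ} n<V f≤V h b =
      subst (λ U → Bounded n U (⟪ c ▸ c′ ⟫ ρ σ))
        (trans (scale-+ (costC c′ n) (costC c n) V) (cong (λ t → scale t V)
            (+-comm (costC c′ n) (costC c n))))
        (growC c′ (≤-trans n<V (scale-base _ V ≤-refl)) (λ X → ≤-trans (f≤V X) (scale-base _ V ≤-refl)) h
          (growC c n<V f≤V h b))
    growC (for c) {V} {ρ} {σ} n<V f≤V h b =
      bounded-weaken (⟪ for c ⟫ ρ σ) (scale-mono V (loopCost-mul n (costC c n)))
        (subst (Bounded n _) (sym (repeat-iter n (λ i → ⟪ c ⟫ (i ∷ ρ)) σ)) (growFor (suc n) ≤-refl))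
      where
      open Growth f V n<V f≤V using (∷-bound)
      growFor : ∀ m → m ≤ suc n → Bounded n (scale (m * costC c n) V) (iter (λ i → ⟪ c ⟫ (i ∷ ρ)) m σ)
      growFor zero    l = bounded-weaken σ (scale-base 0 V ≤-refl) b
      growFor (suc m) l = subst (λ U → Bounded n U (iter (λ i → ⟪ c ⟫ (i ∷ ρ)) (suc m) σ))
        (scale-+ (costC c n) (m * costC c n) V)
        (growC c (≤-trans n<V (scale-base _ V ≤-refl)) (λ X → ≤-trans (f≤V X) (scale-base _ V ≤-refl))
          (∷-bound (≤-pred l) h) (growFor m (≤-trans (n≤1+n m) l)))

  module CommandCorrectness {n : ℕ} (f : SetFunction n) (w : ℕ) (n<w : suc n ≤ w) where
    open Semantics n f
    open Execution f w n<w
    open Correctness f w n<w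
    open CommandGrowth f
    open Rep

    update-other : ∀ {σ x y g i j} → y ≢ x → (σ ⟪ x ⟫≔ g) y i j ≡ σ y i j
    update-other {x = x} {y} h rewrite dec-false (y ℕ.≟ x) h = refl

    update-here : ∀ {σ x g i j} → (σ ⟪ x ⟫≔ g) x i j ≡ g i j
    update-here {x = x} rewrite dec-true (x ℕ.≟ x) refl = refl

    runC : ∀ {d} (c : Cmd d) {V δ env ρ σ s} → suc n ≤ V → (∀ X → ∣ f X ∣ ≤ V) →
           Rep δ env ρ σ s → Bounded n V σ → scale (costC c n) V ≤ w →
           Exec (compile c δ env) s (costC c n) (Rep δ env ρ (⟪ c ⟫ ρ σ))
    runC (fill x e) {V} {δ} {env} {ρ} {σ} {s} n<V f≤V r b fit =
      seqX (matrixX {κ = costE e n} (Agree δ s) g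
              (λ k → trans (k 0 0ℤ low-zero) (size r))
              (scr≢ {2 + δ} {δ} (λ e → <⇒≢ (n≤1+n (suc δ)) (sym e))) (scr≢ {2 + δ} {1 + δ} 1+n≢n)
              (λ k → agree-trans k (agree-put (2 + δ) (≤-trans (n≤1+n δ) (n≤1+n _))))
              (λ k → agree-trans k (agree-put δ ≤-refl))
              (λ k → agree-trans k (agree-put (1 + δ) (n≤1+n δ)))
              bound evaluate (λ _ _ _ → refl)) λ s₁ (ag , temp) →
      weaken ≤-refl (finish s₁ ag)
        (matrixX {κ = 32} (Copy s₁) g (λ (k , _) → trans (k 0 0ℤ (λ ()) low-zero) (size₁ s₁ ag))
          (dat≢scr {x} {δ}) (dat≢scr {x} {1 + δ})
          (λ {t} {i} {v} (k , m) → (λ a z a≢ h → trans (upd-name t (dat x) i v a≢) (k a z a≢ h))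
                    , λ i′ j′ p q → trans (upd-name t (dat x) i v (≢-sym (dat≢scr {x} {2 + δ})))
                        (m i′ j′ p q))
          (λ {t} {i} {v} → copy-scr s₁ δ ≤-refl (λ e → <⇒≢ (n≤1+n (suc δ)) (sym e)) t i v)
          (λ {t} {i} {v} → copy-scr s₁ (1 + δ) (n≤1+n δ) 1+n≢n t i v)
          bound (move s₁ ag)
          ((λ _ _ _ _ → refl) , temp))
      where
      open Compile V n<V f≤V
      open Growth f V n<V f≤V
      g : ℕ → ℕ → ℤ
      g i j = ⟦ e ⟧ (j ∷ i ∷ ρ) σ
      bound : ∀ i j → i ≤ n → j ≤ n → ∣ g i j ∣ ≤ w
      bound i j i≤n j≤n = ≤-trans (grow e (∷-bound j≤n (∷-bound i≤n (inner r))) b)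
        (≤-trans (scale-mono V (fill-cost x e n)) fit)
      δ<3+δ : δ < 3 + δ
      δ<3+δ = s≤s (≤-trans (n≤1+n δ) (n≤1+n _))
      evaluate : ∀ {t i j} → i ≤ n → j ≤ n → Agree δ s t → t (scr δ) 0ℤ ≡ + i → t (scr (1 + δ)) 0ℤ ≡ + j →
        Exec (compileE e (3 + δ) ((1 + δ) ∷ δ ∷ env)) t (costE e n) λ t′ → Agree δ s t′ × t′ (scr δ) 0ℤ ≡
            + i ×
          t′ (scr (1 + δ)) 0ℤ ≡ + j × t′ (scr (3 + δ)) 0ℤ ≡ g i j × (∀ z → t′ (scr (2 + δ)) z ≡
              t (scr (2 + δ)) z)
      evaluate i≤n j≤n ag ci cj =
        weaken ≤-refl (λ t′ (e′ , g′) →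
            agree-trans ag (agree-weaken (<⇒≤ δ<3+δ) g′) , trans (g′ _ _ (low-scr δ<3+δ)) ci
          , trans (g′ _ _ (low-scr (n≤1+n _))) cj , e′ , λ z → g′ _ z (low-scr ≤-refl))
        (compileX e (rep-push (n≤1+n _) cj j≤n (rep-push δ<3+δ ci i≤n
          (rep-weaken (<⇒≤ δ<3+δ) (rep-agree ag r)))) b (≤-trans (scale-mono V (fill-cost x e n)) fit))
      size₁ : ∀ s₁ → Agree δ s s₁ → s₁ 0 0ℤ ≡ + n
      size₁ s₁ ag = trans (ag 0 0ℤ low-zero) (size r)
      Copy : Memory → Memory → Set
      Copy s₁ t = (∀ a z → a ≢ dat x → (∀ j → δ ≤ j → a ≢ scr j) → t a z ≡ s₁ a z)
                × (∀ i j → i ≤ n → j ≤ n → t (scr (2 + δ)) (+ (i * suc n + j)) ≡ g i j)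
      copy-scr : ∀ s₁ k → δ ≤ k → 2 + δ ≢ k → ∀ t i v → Copy s₁ t → Copy s₁ (t [ scr k , i ]≔ v)
      copy-scr s₁ k l ne t i v (p , m) =
        (λ a z a≢ h → trans (upd-name t (scr k) i v (h k l)) (p a z a≢ h))
        , λ i′ j′ p′ q′ → trans (upd-name t (scr k) i v (scr≢ {2 + δ} {k} ne)) (m i′ j′ p′ q′)
      move : ∀ s₁ → Agree δ s s₁ → ∀ {t i j} → i ≤ n → j ≤ n → Copy s₁ t →
        t (scr δ) 0ℤ ≡ + i → t (scr (1 + δ)) 0ℤ ≡ + j →
        Exec (put (scr (3 + δ)) zeroE (get (scr (2 + δ)) (ixE (cell δ) (cell (1 + δ))))) t 32 λ t′ →
          Copy s₁ t′ × t′ (scr δ) 0ℤ ≡ + i × t′ (scr (1 + δ)) 0ℤ ≡ + j ×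
          t′ (scr (3 + δ)) 0ℤ ≡ g i j × (∀ z → t′ (dat x) z ≡ t (dat x) z)
      move s₁ ag {t} {i} {j} i≤n j≤n (p , m) ci cj =
        weaken ≤-refl (λ t′ (e′ , same) →
            ((λ a z a≢ h → trans (same a z (h (3 + δ) (<⇒≤ δ<3+δ))) (p a z a≢ h))
            , λ i′ j′ p′ q′ → trans (same _ _ (scr≢ {2 + δ} {3 + δ} (<⇒≢ ≤-refl))) (m i′ j′ p′ q′))
          , trans (same _ _ (scr≢ {δ} {3 + δ} (<⇒≢ δ<3+δ))) ci
          , trans (same _ _ (scr≢ {1 + δ} {3 + δ} (<⇒≢ (n≤1+n _)))) cj
          , e′ , λ z → same _ z (dat≢scr {x} {3 + δ}))
        (putX {Q = λ t′ → t′ (scr (3 + δ)) 0ℤ ≡ g i j × (∀ a z → a ≢ scr (3 + δ) → t′ a z ≡ t a z)}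
          (≤ᵇ⇒≤ 1 13 tt) (s≤s (ix-cost {cell δ} {cell (1 + δ)} ≤-refl ≤-refl))
          (subst (λ z → ∣ z ∣ ≤ w) (sym eq) (bound i j i≤n j≤n))
          (trans (upd-same t (scr (3 + δ)) 0ℤ _) eq , λ a z a≢ → upd-name t (scr (3 + δ)) 0ℤ _ a≢))
        where
        eq : t (scr (2 + δ)) (eval t (ixE (cell δ) (cell (1 + δ)))) ≡ g i j
        eq = trans (cong (t (scr (2 + δ))) (ix-eval {t} {cell δ} {cell (1 + δ)}
               (trans (p 0 0ℤ (λ ()) low-zero) (size₁ s₁ ag)) ci cj)) (m i j i≤n j≤n)
      finish : ∀ s₁ → Agree δ s s₁ → ∀ t →
               Copy s₁ t × (∀ i j → i ≤ n → j ≤ n → t (dat x) (+ (i * suc n + j)) ≡ g i j) →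
               Rep δ env ρ (σ ⟪ x ⟫≔ g) t
      finish s₁ ag t ((p , _) , done) = rep
        (trans (p 0 0ℤ (λ ()) low-zero) (size₁ s₁ ag))
        (λ i → trans (p _ 0ℤ (≢-sym (dat≢scr {x} {lookup env i})) (low-scr (below r i)))
            (ctrs (rep-agree ag r) i))
        (inner r) (below r) cells′
        where
        cells′ : ∀ y i j → i ≤ n → j ≤ n → t (dat y) (+ (i * suc n + j)) ≡ (σ ⟪ x ⟫≔ g) y i j
        cells′ y i j i≤n j≤n with y ℕ.≟ x
        ... | yes refl = trans (done i j i≤n j≤n) (sym (update-here {σ} {x} {g}))
        ... | no y≢x   = trans (p _ _ (λ e → y≢x (dat-inj {y} {x} e)) (low-dat {δ} {y}))
          (trans (cells (rep-agree ag r) y i j i≤n j≤n) (sym (update-other {σ} {x} {y} {g} y≢x)))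
    runC (c ▸ c′) {V} {δ} {env} {ρ} {σ} {s} n<V f≤V r b fit =
      seqX (runC c n<V f≤V r b (≤-trans (scale-mono V (m≤m+n (costC c n) (costC c′ n))) fit)) λ s₁ r₁ →
      runC c′ (≤-trans n<V (scale-base _ V ≤-refl)) (λ X → ≤-trans (f≤V X) (scale-base _ V ≤-refl)) r₁
        (growC c n<V f≤V (inner r) b)
        (≤-trans (≤-reflexive (trans (scale-+ (costC c′ n) (costC c n) V)
          (cong (λ t → scale t V) (+-comm (costC c′ n) (costC c n))))) fit)
    runC (for c) {V} {δ} {env} {ρ} {σ} {s} n<V f≤V r b fit =
      weaken ≤-refl (λ t p → subst (λ τ → Rep δ env ρ τ t) (sym (repeat-iter n (λ i → ⟪ c ⟫ (i ∷ ρ)) σ))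
          (proj₁ p)) (loopX (scr δ) _ _ Inv (λ (r , c) → size r , c) step
        (rep-agree (agree-put δ ≤-refl) r , upd-same s (scr δ) 0ℤ 0ℤ))
      where
      open Growth f V n<V f≤V using (∷-bound)
      τ = λ m → iter (λ i → ⟪ c ⟫ (i ∷ ρ)) m σ
      Inv : ℕ → Memory → Set
      Inv i t = Rep δ env ρ (τ i) t × t (scr δ) 0ℤ ≡ + i
      κ = costC c n
      growFor : ∀ m → m ≤ suc n → Bounded n (scale (m * κ) V) (τ m)
      growFor zero    l = bounded-weaken σ (scale-base 0 V ≤-refl) b
      growFor (suc m) l = subst (λ U → Bounded n U (τ (suc m))) (scale-+ κ (m * κ) V)
        (growC c (≤-trans n<V (scale-base _ V ≤-refl)) (λ X → ≤-trans (f≤V X) (scale-base _ V ≤-refl))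
          (∷-bound (≤-pred l) (inner r)) (growFor m (≤-trans (n≤1+n m) l)))
      step : ∀ {i t} → i ≤ n → Inv i t → Exec (compile c (1 + δ) (δ ∷ env)) t κ
               (λ t′ → t′ (scr δ) 0ℤ ≡ + i × Inv (suc i) (t′ [ scr δ , 0ℤ ]≔ (+ suc i)))
      step {i} {t} i≤n (r′ , ci) =
        weaken ≤-refl (λ t′ r″ → ctrs r″ zero
          , rep-agree (agree-put δ ≤-refl)
              (rep (size r″) (λ k → ctrs r″ (suc k)) (inner r′) (below r′) (cells r″))
          , upd-same t′ (scr δ) 0ℤ (+ suc i))
        (runC c (≤-trans n<V (scale-base _ V ≤-refl)) (λ X → ≤-trans (f≤V X) (scale-base _ V ≤-refl))
          (rep-push ≤-refl ci i≤n (rep-weaken (n≤1+n δ) r′)) (growFor i (m≤n⇒m≤1+n i≤n))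
          (≤-trans (≤-reflexive (scale-+ κ (i * κ) V))
            (≤-trans (scale-mono V (≤-trans (*-monoˡ-≤ κ (s≤s i≤n)) (loopCost-mul n κ))) fit)))

  -- Polynomial bounds

  _≼poly : (ℕ → ℕ) → Set
  g ≼poly = ∃[ c ] ∃[ d ] ∀ n → g n ≤ c * suc n ^ d

  poly-const : ∀ c → (λ _ → c) ≼poly
  poly-const c = c , 0 , λ n → ≤-reflexive (sym (*-identityʳ c))

  poly-+ : ∀ {g h} → g ≼poly → h ≼poly → (λ n → g n + h n) ≼poly
  poly-+ {g} {h} (c , d , p) (c′ , d′ , p′) = c + c′ , d + d′ , λ n → begin
    g n + h n                                          ≤⟨ +-mono-≤ (p n) (p′ n) ⟩
    c * suc n ^ d + c′ * suc n ^ d′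
        ≤⟨ +-mono-≤ (*-monoʳ-≤ c (^-monoʳ-≤ (suc n) (m≤m+n d d′)))
                                                                 (*-monoʳ-≤ c′ (^-monoʳ-≤ (suc n) (m≤n+m d′
                                                                     d))) ⟩
    c * suc n ^ (d + d′) + c′ * suc n ^ (d + d′)       ≡⟨ *-distribʳ-+ (suc n ^ (d + d′)) c c′ ⟨
    (c + c′) * suc n ^ (d + d′)                        ∎
    where open ≤-Reasoning

  poly-suc : suc ≼poly
  poly-suc = 1 , 1 , λ n → ≤-reflexive (sym (trans (+-identityʳ _) (*-identityʳ (suc n))))

  poly-* : ∀ {g h} → g ≼poly → h ≼poly → (λ n → g n * h n) ≼poly
  poly-* {g} {h} (c , d , p) (c′ , d′ , p′) = c * c′ , d + d′ , λ n → begin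
    g n * h n                                  ≤⟨ *-mono-≤ (p n) (p′ n) ⟩
    c * suc n ^ d * (c′ * suc n ^ d′)          ≡⟨ [m*n]*[o*p]≡[m*o]*[n*p] c (suc n ^ d) c′ (suc n ^ d′) ⟩
    c * c′ * (suc n ^ d * suc n ^ d′)          ≡⟨ cong (c * c′ *_) (^-distribˡ-+-* (suc n) d d′) ⟨
    c * c′ * suc n ^ (d + d′)                  ∎
    where open ≤-Reasoning

  poly-loop : ∀ {g} → g ≼poly → (λ n → loopCost n (g n)) ≼poly
  poly-loop p = poly-+ (poly-const 32)
    (poly-+ (poly-* poly-suc (poly-+ (poly-const 32) (poly-+ p (poly-const 32)))) (poly-const 32))

  poly-E : ∀ {d} (e : Ex d) → costE e ≼poly
  poly-E (lit z)     = poly-const _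
  poly-E (idx a)     = poly-const _
  poly-E (var x a b) = poly-const _
  poly-E (a ⊕ b)     = poly-+ (poly-E a) (poly-+ (poly-E b) (poly-const 32))
  poly-E (a ⊖ b)     = poly-+ (poly-E a) (poly-+ (poly-E b) (poly-const 32))
  poly-E (a ≼ b)     = poly-+ (poly-E a) (poly-+ (poly-E b) (poly-const 64))
  poly-E (ite c a b) = poly-+ (poly-E c) (poly-+ (poly-const 64) (poly-+ (poly-E a) (poly-E b)))
  poly-E (sum e)     = poly-+ (poly-const 32) (poly-loop (poly-+ (poly-E e) (poly-const 32)))
  poly-E (qry e)     = poly-+ (poly-loop (poly-+ (poly-E e) (poly-const 32))) (poly-const 32)

  poly-C : ∀ {d} (c : Cmd d) → costC c ≼poly
  poly-C (fill x e) = poly-+ (poly-loop (poly-loop (poly-+ (poly-E e) (poly-const 32))))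
      (poly-loop (poly-loop (poly-const 64)))
  poly-C (c ▸ c′)   = poly-+ (poly-C c) (poly-C c′)
  poly-C (for c)    = poly-loop (poly-C c)

  -- Powers of n + 1 do not decrease when the exponent is raised, which makes the class closed under
  -- sums. They are at most 2 ^ d * n ^ d for n ≥ 1, and the additive constant takes care of n = 0.
  poly⇒bounded : ∀ {g} → g ≼poly → PolynomiallyBounded g
  poly⇒bounded {g} (c , d , p) = c * 2 ^ d , d , λ n → ≤-trans (p n) (step n)
    where
    open ≤-Reasoning
    step : ∀ n → c * suc n ^ d ≤ c * 2 ^ d * n ^ d + c * 2 ^ d
    step zero    = begin
      c * 1 ^ d                       ≤⟨ *-monoʳ-≤ c (^-monoˡ-≤ d (s≤s z≤n)) ⟩
      c * 2 ^ d                       ≤⟨ m≤n+m _ _ ⟩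
      c * 2 ^ d * 0 ^ d + c * 2 ^ d   ∎
    step (suc n) = begin
      c * suc (suc n) ^ d
          ≤⟨ *-monoʳ-≤ c (^-monoˡ-≤ d (s≤s (≤-trans (m≤n+m (suc n) n)
          (+-monoʳ-≤ n (≤-reflexive (sym (+-identityʳ (suc n)))))))) ⟩
      c * (2 * suc n) ^ d                     ≡⟨ cong (c *_) (*-distribʳ-^ d 2 (suc n)) ⟩
      c * (2 ^ d * suc n ^ d)                 ≡⟨ *-assoc c (2 ^ d) (suc n ^ d) ⟨
      c * 2 ^ d * suc n ^ d                   ≤⟨ m≤m+n _ _ ⟩
      c * 2 ^ d * suc n ^ d + c * 2 ^ d       ∎
      where
      *-distribʳ-^ : ∀ d a b → (a * b) ^ d ≡ a ^ d * b ^ d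
      *-distribʳ-^ zero    a b = refl
      *-distribʳ-^ (suc d) a b = trans (cong (a * b *_) (*-distribʳ-^ d a b))
          ([m*n]*[o*p]≡[m*o]*[n*p] a b (a ^ d) (b ^ d))

  -- Commands as polynomial time programs

  blank : St
  blank _ _ _ = 0ℤ

  rowSet : ∀ n → St → ℕ → Subset n
  rowSet n σ x = tabulate λ i → nz (σ x 0 (toℕ i))

  base≤pow : ∀ n M → suc n + M ≤ (2 + M) ^ suc n
  base≤pow zero    M = ≤-trans (n≤1+n _) (≤-reflexive (sym (*-identityʳ (2 + M))))
  base≤pow (suc n) M = begin
    suc (suc n + M)                               ≤⟨ s≤s (base≤pow n M) ⟩
    1 + X                                         ≤⟨ +-mono-≤ (≤-trans (s≤s z≤n) (base≤pow n M))
        (m≤m+n X (M * X)) ⟩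
    X + (X + M * X)                               ∎
    where
    open ≤-Reasoning
    X = (2 + M) ^ suc n

  -- Each gained bit costs at most one factor 2 + M, and n + 1 further factors cover the initial
  -- bound n + 1 + M. This meets the word length allowed by the machine model.
  scale≤pow : ∀ n M c → scale c (suc n + M) ≤ (2 + M) ^ (suc n + c)
  scale≤pow n M c = begin
    scale c (suc n + M)                ≡⟨ scale-def c _ ⟩
    2 ^ c * (suc n + M)                ≤⟨ *-mono-≤ (^-monoˡ-≤ c (s≤s (s≤s (z≤n {M})))) (base≤pow n M) ⟩
    (2 + M) ^ c * (2 + M) ^ suc n      ≡⟨ ^-distribˡ-+-* (2 + M) c (suc n) ⟨
    (2 + M) ^ (c + suc n)              ≡⟨ cong ((2 + M) ^_) (+-comm c (suc n)) ⟩
    (2 + M) ^ (suc n + c)              ∎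
    where open ≤-Reasoning

  realise : ∀ {Admissible : ∀ {n} → SetFunction n → Set} {Correct : ∀ {n} → SetFunction n → Subset n → Set}
            (c : Cmd 0) →
            (∀ n (f : SetFunction n) → Admissible f → Correct f (rowSet n (Semantics.⟪_⟫ n f c [] blank) 0)) →
            PolynomialTime Admissible Correct
  realise {Admissible} {Correct} c correct =
    compile c 0 [] , p , poly⇒bounded (poly-+ poly-suc (poly-C c)) , λ n f adm M f≤M → main n f adm M f≤M
    where
    p : ℕ → ℕ
    p n = suc n + costC c n
    main : ∀ n (f : SetFunction n) → Admissible f → ∀ M → (∀ X → ∣ f X ∣ ≤ M) →
           ∃[ t ] ∃[ s ] Run f ((2 + M) ^ p n) (compile c 0 []) (initial n) t s × t ≤ p n × Correct f
               (output n s)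
    main n f adm M f≤M = result
      where
      V w : ℕ
      V = suc n + M
      w = (2 + M) ^ p n
      fits : scale (costC c n) V ≤ w
      fits = scale≤pow n M (costC c n)
      n<V : suc n ≤ V
      n<V = m≤m+n (suc n) M
      n<w : suc n ≤ w
      n<w = ≤-trans n<V (≤-trans (scale-base (costC c n) V ≤-refl) fits)
      open Semantics n f
      open Execution f w n<w
      open Correctness f w n<w
      open CommandCorrectness f w n<w
      executed : Exec (compile c 0 []) (initial n) (costC c n) (Rep 0 [] [] (⟪ c ⟫ [] blank))
      executed = runC c n<V (λ X → ≤-trans (f≤M X) (m≤n+m M (suc n)))
        (rep refl (λ ()) (λ ()) (λ ()) λ _ _ _ _ _ → refl) (λ _ _ _ _ _ → z≤n) fits
      open Exec executed
      result : ∃[ t ] ∃[ s ] Run f w (compile c 0 []) (initial n) t s × t ≤ p n × Correct f (output n s)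
      result = time , final , run , ≤-trans bound (m≤n+m _ (suc n)) ,
        -- Array 0 of the language is stored under `dat 0`, which is 1, the output array of the
        -- machine; its row 0 starts at index 0.
        subst (Correct f)
          (tabulate-cong {n = n} λ i → cong nz (sym (Rep.cells post 0 0 (toℕ i) z≤n (<⇒≤ (toℕ<n i)))))
          (correct n f adm)

module Minimisation where

  open import Defs using (SetFunction; Submodular; SortedValues; HasDistinctValues)
  open import Data.Bool using (Bool; T; true; false; _∧_; _∨_; not; if_then_else_)
  open import Data.Bool.Properties using (∨-zeroʳ; ∨-identityʳ; ∧-zeroʳ; ∧-identityʳ; ∨-comm)
  open import Data.Empty using (⊥-elim)
  open import Data.Fin as Fin using (Fin; toℕ; fromℕ<)
  open import Data.Fin.Properties using (toℕ<n; toℕ-fromℕ<; fromℕ<-toℕ; toℕ-injective; injective⇒≤)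
  open import Data.Fin.Subset using (Subset)
  open import Data.Fin.Subset.Properties using (anySubset?)
  open import Data.Integer using (ℤ; +_; 0ℤ; 1ℤ; _+_; _-_; -_; _*_; _≤_; _<_; _⊔_; _⊓_)
  import Data.Integer as ℤ
  import Data.Integer.Properties as ℤP
  open import Data.Integer.Tactic.RingSolver using (solve-∀)
  open import Data.List using (List; []; _∷_; _++_; length)
  import Data.List as List
  open import Data.List.Membership.Propositional using (_∈_)
  open import Data.List.Membership.Propositional.Properties using (∈-map⁺; ∈-map⁻; ∈-++⁺ˡ; ∈-++⁺ʳ)
  open import Data.List.Relation.Unary.All as All using (All; []; _∷_)
  open import Data.List.Relation.Unary.AllPairs using (AllPairs; []; _∷_)
  open import Data.List.Relation.Unary.Any as Any using (here; there)
  open import Data.Nat as ℕ using (ℕ; zero; suc; z≤n; s≤s)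
  import Data.Nat.Properties as ℕP
  open import Data.Product using (∃-syntax; _×_; _,_; proj₁; proj₂)
  open import Data.Sum using (_⊎_; inj₁; inj₂; [_,_]′)
  open import Data.Unit using (tt)
  open import Data.Vec using (Vec; []; _∷_; lookup; tabulate; zipWith)
  open import Data.Vec.Properties using (tabulate-cong; lookup∘tabulate; tabulate∘lookup)
  open import Relation.Binary.Definitions using (tri<; tri≈; tri>)
  open import Relation.Binary.PropositionalEquality
  open import Relation.Nullary using (¬_; yes; no; does; _×-dec_; _→-dec_)
  open import Relation.Nullary.Decidable using (dec-true; dec-false)
  open Compilation

  -- Linear arithmetic: each inequality is turned into a nonnegative difference,
  -- and the differences are combined by a ring identity.
  infixl 6 _⊹_
  infixl 7 _✶_

  Δ : ∀ {a b} → a ≤ b → 0ℤ ≤ b - a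
  Δ = ℤP.i≤j⇒0≤j-i

  _⊹_ : ∀ {a b} → 0ℤ ≤ a → 0ℤ ≤ b → 0ℤ ≤ a + b
  p ⊹ q = ℤP.+-mono-≤ p q

  _✶_ : ∀ {a b} → 0ℤ ≤ a → 0ℤ ≤ b → 0ℤ ≤ a * b
  _✶_ {+ a} {+ b} (ℤ.+≤+ _) (ℤ.+≤+ _) = subst (0ℤ ≤_) (ℤP.pos-* a b) (ℤ.+≤+ z≤n)

  square≥0 : ∀ a → 0ℤ ≤ a * a
  square≥0 (+ a)       = subst (0ℤ ≤_) (ℤP.pos-* a a) (ℤ.+≤+ z≤n)
  square≥0 (ℤ.-[1+ a ]) = ℤ.+≤+ z≤n

  by : ∀ {a b d} → 0ℤ ≤ d → d ≡ b - a → a ≤ b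
  by p e = ℤP.0≤i-j⇒j≤i (subst (0ℤ ≤_) e p)

  0≤+ : ∀ {m} → 0ℤ ≤ + m
  0≤+ = ℤ.+≤+ z≤n

  ≤-or-≥ : ∀ a b → a ≤ b ⊎ b ≤ a
  ≤-or-≥ = ℤP.≤-total

  -- Finite sums and counting

  ∑-cong : ∀ m {g h} → (∀ v → v ℕ.< m → g v ≡ h v) → ∑ m g ≡ ∑ m h
  ∑-cong zero    e = refl
  ∑-cong (suc m) e = cong₂ _+_ (∑-cong m λ v l → e v (ℕP.m≤n⇒m≤1+n l)) (e m ℕP.≤-refl)

  ∑-mono : ∀ m {g h} → (∀ v → v ℕ.< m → g v ≤ h v) → ∑ m g ≤ ∑ m h
  ∑-mono zero    e = ℤP.≤-refl
  ∑-mono (suc m) e = ℤP.+-mono-≤ (∑-mono m λ v l → e v (ℕP.m≤n⇒m≤1+n l)) (e m ℕP.≤-refl)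

  ∑-nonneg : ∀ m {g} → (∀ v → v ℕ.< m → 0ℤ ≤ g v) → 0ℤ ≤ ∑ m g
  ∑-nonneg zero    h = ℤP.≤-refl
  ∑-nonneg (suc m) h = ∑-nonneg m (λ v l → h v (ℕP.m≤n⇒m≤1+n l)) ⊹ h m ℕP.≤-refl

  ∑-+ : ∀ m g h → ∑ m (λ v → g v + h v) ≡ ∑ m g + ∑ m h
  ∑-+ zero    g h = refl
  ∑-+ (suc m) g h = trans (cong (_+ (g m + h m)) (∑-+ m g h)) (swap (∑ m g) (∑ m h) (g m) (h m))
    where
    swap : ∀ a b c d → a + b + (c + d) ≡ a + c + (b + d)
    swap = solve-∀

  ∑-const : ∀ m c → ∑ m (λ _ → c) ≡ + m * c
  ∑-const zero    c = sym (ℤP.*-zeroˡ c)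
  ∑-const (suc m) c = trans (cong (_+ c) (∑-const m c)) (trans (step (+ m) c) (cong (_* c) (ℤP.pos-+ 1 m)))
    where
    step : ∀ m c → m * c + c ≡ (1ℤ + m) * c
    step = solve-∀

  ∑-* : ∀ m c g → ∑ m (λ v → c * g v) ≡ c * ∑ m g
  ∑-* zero    c g = sym (ℤP.*-zeroʳ c)
  ∑-* (suc m) c g = trans (cong (_+ c * g m) (∑-* m c g)) (sym (ℤP.*-distribˡ-+ c (∑ m g) (g m)))

  ∑-zero : ∀ m {g} → (∀ v → v ℕ.< m → g v ≡ 0ℤ) → ∑ m g ≡ 0ℤ
  ∑-zero m h = trans (∑-cong m h) (trans (∑-const m 0ℤ) (ℤP.*-zeroʳ (+ m)))

  ∑-update : ∀ m v {g h} → v ℕ.< m → (∀ j → j ≢ v → h j ≡ g j) → ∑ m h ≡ ∑ m g + (h v - g v)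
  ∑-update (suc m) v {g} {h} l e with v ℕ.≟ m
  ... | yes refl = trans (cong (_+ h m) (∑-cong m λ j j<m → e j (ℕP.<⇒≢ j<m))) (step (∑ m g) (g m) (h m))
    where
    step : ∀ s a b → s + b ≡ s + a + (b - a)
    step = solve-∀
  ... | no v≢m   = trans (cong₂ _+_ (∑-update m v (ℕP.≤∧≢⇒< (ℕP.≤-pred l) v≢m) e) (e m (≢-sym v≢m)))
                         (step (∑ m g) (h v - g v) (g m))
    where
    step : ∀ s d a → s + d + a ≡ s + a + d
    step = solve-∀

  ∑-term : ∀ m v {g} → v ℕ.< m → (∀ j → j ℕ.< m → 0ℤ ≤ g j) → g v ≤ ∑ m g
  ∑-term (suc m) v {g} l h with v ℕ.≟ m
  ... | yes refl = by (∑-nonneg m λ j l → h j (ℕP.m≤n⇒m≤1+n l)) (step (∑ m g) (g m))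
    where
    step : ∀ s a → s ≡ s + a - a
    step = solve-∀
  ... | no v≢m   = by (Δ (∑-term m v (ℕP.≤∧≢⇒< (ℕP.≤-pred l) v≢m) λ j l → h j (ℕP.m≤n⇒m≤1+n l)) ⊹
      h m ℕP.≤-refl)
                      (step (∑ m g) (g v) (g m))
    where
    step : ∀ s a b → s - a + b ≡ s + b - a
    step = solve-∀

  count : ℕ → (ℕ → Bool) → ℤ
  count m X = ∑ m (λ j → bit (X j))

  0≤bit : ∀ b → 0ℤ ≤ bit b
  0≤bit false = 0≤+
  0≤bit true  = 0≤+

  bit≤1 : ∀ b → bit b ≤ 1ℤ
  bit≤1 false = 0≤+
  bit≤1 true  = ℤP.≤-refl

  count-nonneg : ∀ m X → 0ℤ ≤ count m X
  count-nonneg m X = ∑-nonneg m λ j _ → 0≤bit (X j)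

  count≤ : ∀ m X → count m X ≤ + m
  count≤ m X = ℤP.≤-trans (∑-mono m λ j _ → bit≤1 (X j))
    (ℤP.≤-reflexive (trans (∑-const m 1ℤ) (ℤP.*-identityʳ (+ m))))

  -- The clipped quadratic potential

  -- wt s is the point of [0,K] nearest to - s, and ψ s is the maximum of - 2ws - w² over w ∈ [0,K];
  -- as a potential it grows by at most - 2 (wt s) y + y² when y is added to s.
  module Clip (K : ℤ) (0≤K : 0ℤ ≤ K) where

    wt : ℤ → ℤ
    wt s = 0ℤ ⊔ (K ⊓ - s)

    0≤wt : ∀ s → 0ℤ ≤ wt s
    0≤wt s = ℤP.i≤i⊔j 0ℤ _

    wt≤K : ∀ s → wt s ≤ K
    wt≤K s = ℤP.⊔-lub 0≤K (ℤP.i⊓j≤i K (- s))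

    wt-antitone : ∀ {s t} → s ≤ t → wt t ≤ wt s
    wt-antitone h = ℤP.⊔-monoʳ-≤ 0ℤ (ℤP.⊓-monoʳ-≤ K (ℤP.neg-mono-≤ h))

    -- The variational inequality of the projection of - s onto [0,K]. At either end of the interval
    -- the two factors have the same sign; in the interior the second one is zero.
    projection : ∀ s x → 0ℤ ≤ x → x ≤ K → 0ℤ ≤ (x - wt s) * (wt s + s)
    projection s x 0≤x x≤K with ≤-or-≥ 0ℤ s
    ... | inj₁ 0≤s = subst (λ t → 0ℤ ≤ (x - t) * (t + s)) (sym eq)
                       (subst₂ (λ a b → 0ℤ ≤ a * b) (sym (ℤP.+-identityʳ x)) (sym (ℤP.+-identityˡ s))
                           (0≤x ✶ 0≤s))
      where
      eq : wt s ≡ 0ℤ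
      eq = ℤP.i≥j⇒i⊔j≡i (ℤP.≤-trans (ℤP.i⊓j≤j K (- s)) (ℤP.neg-mono-≤ 0≤s))
    ... | inj₂ s≤0 with ≤-or-≥ K (- s)
    ...   | inj₁ K≤-s = subst (λ t → 0ℤ ≤ (x - t) * (t + s)) (sym eq)
                          (subst (0ℤ ≤_) (alg K x s) (Δ x≤K ✶ Δ K≤-s))
      where
      eq : wt s ≡ K
      eq = trans (cong (0ℤ ⊔_) (ℤP.i≤j⇒i⊓j≡i K≤-s)) (ℤP.i≤j⇒i⊔j≡j 0≤K)
      alg : ∀ K x s → (K - x) * (- s - K) ≡ (x - K) * (K + s)
      alg = solve-∀
    ...   | inj₂ -s≤K = subst (λ t → 0ℤ ≤ (x - t) * (t + s)) (sym eq)
                          (ℤP.≤-reflexive (sym (alg x s)))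
      where
      eq : wt s ≡ - s
      eq = trans (cong (0ℤ ⊔_) (ℤP.i≥j⇒i⊓j≡j -s≤K)) (ℤP.i≤j⇒i⊔j≡j (ℤP.neg-mono-≤ s≤0))
      alg : ∀ x s → (x - - s) * (- s + s) ≡ 0ℤ
      alg = solve-∀

    ψ : ℤ → ℤ
    ψ s = - (+ 2 * wt s * s) - wt s * wt s

    ψ-≥ : ∀ s x → 0ℤ ≤ x → x ≤ K → - (+ 2 * x * s) - x * x ≤ ψ s
    ψ-≥ s x 0≤x x≤K = by (projection s x 0≤x x≤K ⊹ projection s x 0≤x x≤K ⊹ square≥0 (x - wt s))
        (alg (wt s) s x)
      where
      alg : ∀ w s x → (x - w) * (w + s) + (x - w) * (w + s) + (x - w) * (x - w) ≡
            - (+ 2 * w * s) - w * w - (- (+ 2 * x * s) - x * x)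
      alg = solve-∀

    -- `ψ` is convex with slope - 2 (wt s), and a projection is 1-Lipschitz, so the error beyond the
    -- linear term is at most y². The certificate is the projection inequality at s, tested with the
    -- weight at s + y.
    ψ-step : ∀ s y → ψ (s + y) ≤ ψ s - + 2 * wt s * y + y * y
    ψ-step s y = by (projection s w′ (0≤wt _) (wt≤K _) ⊹ projection s w′ (0≤wt _) (wt≤K _) ⊹
        square≥0 (w′ - wt s + y))
                    (alg (wt s) w′ s y)
      where
      w′ = wt (s + y)
      alg : ∀ w w′ s y → (w′ - w) * (w + s) + (w′ - w) * (w + s) + (w′ - w + y) * (w′ - w + y) ≡
            - (+ 2 * w * s) - w * w - + 2 * w * y + y * y - (- (+ 2 * w′ * (s + y)) - w′ * w′)
      alg = solve-∀

    -- The maximum is tested at K for negative s and at 0 otherwise. Summed over the nodes, this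
    -- turns a bound on the potential into one on the negative part of S, the dual objective.
    ψ-neg : ∀ s → - (+ 2 * K * (s ⊓ 0ℤ)) - K * K ≤ ψ s
    ψ-neg s with ≤-or-≥ s 0ℤ
    ... | inj₁ s≤0 rewrite ℤP.i≤j⇒i⊓j≡i s≤0 = ψ-≥ s K 0≤K ℤP.≤-refl
    ... | inj₂ 0≤s rewrite ℤP.i≥j⇒i⊓j≡j 0≤s =
      ℤP.≤-trans (by (square≥0 K) (alg K s)) (ψ-≥ s 0ℤ ℤP.≤-refl 0≤K)
      where
      alg : ∀ K s → K * K ≡ - (+ 2 * 0ℤ * s) - 0ℤ * 0ℤ - (- (+ 2 * K * 0ℤ) - K * K)
      alg = solve-∀

    ψ-zero : ψ 0ℤ ≤ 0ℤ
    ψ-zero = subst (_≤ 0ℤ) (alg (wt 0ℤ)) (ℤP.neg-mono-≤ (square≥0 (wt 0ℤ)))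
      where
      alg : ∀ w → - (w * w) ≡ - (+ 2 * w * 0ℤ) - w * w
      alg = solve-∀

  -- Sets of nodes

  NodeSet : Set
  NodeSet = ℕ → Bool

  infix 4 _∋_ _∌_ _⊆_ _≗′_
  infixl 7 _∩_ _∖_
  infixl 6 _∪_

  _∋_ _∌_ : NodeSet → ℕ → Set
  X ∋ j = X j ≡ true
  X ∌ j = X j ≡ false

  _⊆_ _≗′_ : NodeSet → NodeSet → Set
  X ⊆ Y = ∀ j → X ∋ j → Y ∋ j
  X ≗′ Y = ∀ j → X j ≡ Y j

  _∪_ _∩_ _∖_ : NodeSet → NodeSet → NodeSet
  (X ∪ Y) j = X j ∨ Y j
  (X ∩ Y) j = X j ∧ Y j
  (X ∖ Y) j = X j ∧ not (Y j)

  single : ℕ → NodeSet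
  single v j = does (j ℕ.≟ v)

  absurd : ∀ {A : Set} {b} → b ≡ true → b ≡ false → A
  absurd refl ()

  ∌-from : ∀ {b} → ¬ b ≡ true → b ≡ false
  ∌-from {false} h = refl
  ∌-from {true}  h = ⊥-elim (h refl)

  ∨-elim : ∀ {a b} → a ∨ b ≡ true → a ≡ true ⊎ b ≡ true
  ∨-elim {true}  e = inj₁ refl
  ∨-elim {false} e = inj₂ e

  ∨-left : ∀ {a b} → a ≡ true → a ∨ b ≡ true
  ∨-left refl = refl

  ∨-right : ∀ {a b} → b ≡ true → a ∨ b ≡ true
  ∨-right {a} refl = ∨-zeroʳ a

  ∨-false : ∀ {a b} → a ∨ b ≡ false → a ≡ false × b ≡ false
  ∨-false {false} e = refl , e

  ∧-elim : ∀ {a b} → a ∧ b ≡ true → a ≡ true × b ≡ true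
  ∧-elim {true} e = refl , e

  ∧-intro : ∀ {a b} → a ≡ true → b ≡ true → a ∧ b ≡ true
  ∧-intro refl refl = refl

  not-elim : ∀ {a} → not a ≡ true → a ≡ false
  not-elim {false} e = refl

  ⇔-≡ : ∀ {a b} → (a ≡ true → b ≡ true) → (b ≡ true → a ≡ true) → a ≡ b
  ⇔-≡ {true}  {b}     f g = sym (f refl)
  ⇔-≡ {false} {false} f g = refl
  ⇔-≡ {false} {true}  f g = g refl

  single-self : ∀ v → single v ∋ v
  single-self v = dec-true (v ℕ.≟ v) refl

  single-eq : ∀ {v j} → single v ∋ j → j ≡ v
  single-eq {v} {j} e = ℕP.≡ᵇ⇒≡ j v (subst T (sym e) tt)

  ∖-elim : ∀ {X Y j} → (X ∖ Y) ∋ j → X ∋ j × Y ∌ j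
  ∖-elim e with ∧-elim e
  ... | p , q = p , not-elim q

  ∖-intro : ∀ {X Y j} → X ∋ j → Y ∌ j → (X ∖ Y) ∋ j
  ∖-intro p q = ∧-intro p (cong not q)

  count-mono : ∀ m {X Y} → X ⊆ Y → count m X ≤ count m Y
  count-mono m {X} {Y} h = ∑-mono m λ j _ → bit-mono (h j)
    where
    bit-mono : ∀ {a b} → (a ≡ true → b ≡ true) → bit a ≤ bit b
    bit-mono {false} {b} h = 0≤bit b
    bit-mono {true}  {b} h rewrite h refl = ℤP.≤-refl

  count-cong : ∀ m {X Y} → X ≗′ Y → count m X ≡ count m Y
  count-cong m e = ∑-cong m λ j _ → cong bit (e j)

  count-strict : ∀ m {X Y v} → v ℕ.< m → X ⊆ Y → X ∌ v → Y ∋ v → 1ℤ + count m X ≤ count m Y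
  count-strict m {X} {Y} {v} v<m X⊆Y X∌v Y∋v = begin
    1ℤ + count m X                                      ≡⟨ ℤP.+-comm 1ℤ (count m X) ⟩
    count m X + (1ℤ - 0ℤ)                               ≡⟨ cong₂ (λ a b → count m X + (bit a - bit b))
        (∨-right {X v} (single-self v)) X∌v ⟨
    count m X + (bit ((X ∪ single v) v) - bit (X v))    ≡⟨ ∑-update m v v<m other ⟨
    count m (X ∪ single v)                              ≤⟨ count-mono m sub ⟩
    count m Y                                           ∎
    where
    open ℤP.≤-Reasoning
    other : ∀ j → j ≢ v → bit ((X ∪ single v) j) ≡ bit (X j)
    other j j≢v rewrite dec-false (j ℕ.≟ v) j≢v = cong bit (∨-identityʳ (X j))
    sub : (X ∪ single v) ⊆ Y
    sub j e with ∨-elim {X j} e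
    ... | inj₁ p = X⊆Y j p
    ... | inj₂ q = subst (Y ∋_) (sym (single-eq q)) Y∋v

  ⊆-or-witness : ∀ m X Y → (∀ j → j ℕ.< m → Y ∋ j → X ∋ j) ⊎ (∃[ j ] j ℕ.< m × Y ∋ j × X ∌ j)
  ⊆-or-witness zero    X Y = inj₁ λ _ ()
  ⊆-or-witness (suc m) X Y with ⊆-or-witness m X Y
  ... | inj₂ (j , l , p , q) = inj₂ (j , ℕP.m≤n⇒m≤1+n l , p , q)
  ... | inj₁ h with Y m in ym | X m in xm
  ...   | true  | false = inj₂ (m , ℕP.≤-refl , ym , xm)
  ...   | false | _     = inj₁ λ j l p → h j (ℕP.≤∧≢⇒< (ℕP.≤-pred l) λ { refl → absurd p ym }) p
  ...   | true  | true  = inj₁ λ j l p → extend j l p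
    where
    extend : ∀ j → j ℕ.< suc m → Y ∋ j → X ∋ j
    extend j l p with j ℕ.≟ m
    ... | yes refl = xm
    ... | no j≢m   = h j (ℕP.≤∧≢⇒< (ℕP.≤-pred l) j≢m) p

  module Values (n : ℕ) (f : SetFunction n) where

    -- Node sets are predicates on all of ℕ, so that a node can be adjoined without a change of
    -- type; `F` sees the indices below `n` only.
    F : NodeSet → ℤ
    F X = f (tabulate λ i → X (toℕ i))

    F-cong : ∀ {X Y} → (∀ j → j ℕ.< n → X j ≡ Y j) → F X ≡ F Y
    F-cong e = cong f (tabulate-cong λ i → e (toℕ i) (toℕ<n i))

  zipWith-tabulate : ∀ {A : Set} {m} (op : A → A → A) (g h : Fin m → A) →
                     zipWith op (tabulate g) (tabulate h) ≡ tabulate (λ i → op (g i) (h i))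
  zipWith-tabulate {m = zero}  op g h = refl
  zipWith-tabulate {m = suc m} op g h =
    cong (op (g Fin.zero) (h Fin.zero) ∷_) (zipWith-tabulate op (λ i → g (Fin.suc i)) (λ i → h (Fin.suc i)))

  module Submodularity (n : ℕ) (f : SetFunction n) (sub : Submodular f) where
    open Values n f public

    F-sub : ∀ X Y → F (X ∪ Y) + F (X ∩ Y) ≤ F X + F Y
    F-sub X Y = subst₂ (λ A B → f A + f B ≤ F X + F Y)
      (zipWith-tabulate _∨_ _ _) (zipWith-tabulate _∧_ _ _)
      (sub (tabulate λ i → X (toℕ i)) (tabulate λ i → Y (toℕ i)))

  -- Preorders and closed sets

  Relation : Set
  Relation = ℕ → NodeSet

  record Preorder (r : Relation) : Set where
    field
      reflexive  : ∀ v → r v ∋ v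
      transitive : ∀ {v j k} → r v ∋ j → r j ∋ k → r v ∋ k

  -- The node n is adjoined to the ground set; r v ∋ n records that no minimiser contains v.
  record Closed (n : ℕ) (r : Relation) (Z : NodeSet) : Set where
    constructor closed
    field
      up   : ∀ {v j} → Z ∋ v → r v ∋ j → Z ∋ j
      proper : Z ∌ n

  open Closed public

  module _ {n : ℕ} {r : Relation} where

    closed-∪ : ∀ {X Y} → Closed n r X → Closed n r Y → Closed n r (X ∪ Y)
    closed-∪ {X} {Y} cX cY = closed
      (λ {v} {j} e h → case (∨-elim {X v} e) h) (cong₂ _∨_ (proper cX) (proper cY))
      where
      case : ∀ {v j} → X ∋ v ⊎ Y ∋ v → r v ∋ j → (X ∪ Y) ∋ j
      case (inj₁ p) h = ∨-left (up cX p h)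
      case {_} {j} (inj₂ q) h = ∨-right {X j} (up cY q h)

    closed-∩ : ∀ {X Y} → Closed n r X → Closed n r Y → Closed n r (X ∩ Y)
    closed-∩ {X} {Y} cX cY = closed
      (λ e h → ∧-intro (up cX (proj₁ (∧-elim e)) h) (up cY (proj₂ (∧-elim e)) h))
      (cong₂ _∧_ (proper cX) (proper cY))

    closed-row : ∀ {v} → Preorder r → r v ∌ n → Closed n r (r v)
    closed-row pre dead = closed (Preorder.transitive pre) dead

    alive : ∀ {Z v} → Closed n r Z → Z ∋ v → r v ∌ n
    alive cZ e = ∌-from λ d → absurd (up cZ e d) (proper cZ)

  -- One greedy base

  -- A greedy base of C ↦ F C + β |C ∖ mk|, where C is the closure of the marked nodes mk: the penalty β
  -- extends F from closed sets to a submodular function of arbitrary sets, all of whose marginals are at most B.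
  module GreedyStep {n : ℕ} (f : SetFunction n) (sub : Submodular f)
    (r : Relation) (pre : Preorder r) (u : ℕ) (u-alive : r u ∌ n)
    (fcl β : ℤ) (0≤β : 0ℤ ≤ β)
    (marginal : ∀ {C D} → Closed n r C → Closed n r D → C ∋ u → C ⊆ D →
                Values.F n f C ≤ Values.F n f D + β × Values.F n f D ≤ Values.F n f C + β)
    (K : ℤ) (0≤K : 0ℤ ≤ K) (S₀ : ℕ → ℤ)
    where

    open Submodularity n f sub public
    open Clip K 0≤K public
    open Preorder pre

    N : ℕ
    N = suc n

    #_ : NodeSet → ℤ
    # X = count N X

    -- Dead nodes, and nodes forced by `u`, are marked from the start: the base has entry 0 there.
    mk₀ : NodeSet
    mk₀ j = r j n ∨ r u j

    -- Bounds the entries of a base: a step changes `F` by at most β, while the penalty gains at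
    -- most Nβ and loses at most β.
    B : ℤ
    B = + 2 * + N * β

    restrict : NodeSet → (ℕ → ℤ) → ℕ → ℤ
    restrict Z S j = if Z j then S j else 0ℤ

    h : NodeSet → NodeSet → ℤ
    h C mk = F C + β * # (C ∖ mk)

    Φ : (ℕ → ℤ) → ℤ
    Φ S = ∑ N (λ j → ψ (S j))

    -- The state in the middle of a base. `sound` is the inequality defining the base polytope, for
    -- the part of Z reached so far. `mk⊆C` speaks of alive nodes because dead ones are marked
    -- although no closed set contains them.
    record Inv (S : ℕ → ℤ) (mk C : NodeSet) (H b : ℤ) : Set where
      field
        C-closed : Closed n r C
        C∋u      : C ∋ u
        H-def    : H ≡ h C mk
        b≤F      : b ≤ F C
        mk₀⊆mk   : mk₀ ⊆ mk
        mk⊆C     : ∀ j → mk ∋ j → r j ∌ n → C ∋ j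
        fixed    : ∀ j → mk₀ ∋ j → S j ≡ S₀ j
        sound    : ∀ Z → Closed n r Z → Z ∋ u →
                   ∑ N (restrict Z S) ≤ ∑ N (restrict Z S₀) + (h (Z ∩ C) mk - fcl)
        ω        : ℤ
        0≤ω      : 0ℤ ≤ ω
        ω≤K      : ω ≤ K
        wt≤ω     : ∀ j → j ℕ.< N → mk ∌ j → wt (S j) ≤ ω
        -- ω bounds the weights of the unmarked nodes: summation by parts along the chain of sets C,
        -- all of whose values are at least b.
        potential : Φ S + + 2 * ((K - ω) * (b - fcl) + ω * (H - fcl)) ≤ Φ S₀ + B * B * # mk

    b≤H : ∀ {S mk C H b} → Inv S mk C H b → b ≤ H
    b≤H {mk = mk} {C} i = subst (_ ≤_) (sym (Inv.H-def i))
      (ℤP.≤-trans (Inv.b≤F i) (by (0≤β ✶ count-nonneg N (C ∖ mk)) (alg (F C) (β * # (C ∖ mk)))))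
      where
      alg : ∀ a b → b ≡ a + b - a
      alg = solve-∀

    h-cong : ∀ {C C′ mk mk′} → C′ ≗′ C → mk′ ≗′ mk → h C′ mk′ ≡ h C mk
    h-cong e e′ = cong₂ (λ a b → a + β * b) (F-cong λ j _ → e j)
      (count-cong N λ j → cong₂ (λ a b → a ∧ not b) (e j) (e′ j))

    inv-cong : ∀ {S S′ mk mk′ C C′ H H′ b b′} → Inv S mk C H b →
      S′ ≗ S → mk′ ≗′ mk → C′ ≗′ C → H′ ≡ h C′ mk′ → b′ ≤ b → Inv S′ mk′ C′ H′ b′
    inv-cong {S} {S′} {mk} {mk′} {C} {C′} {H} {H′} {b} {b′} i eS em eC eH b′≤b = record
      { C-closed = closed (λ {v} {j} p q → trans (eC j) (up C-closed (trans (sym (eC v)) p) q)) (trans (eC n) (proper C-closed))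
      ; C∋u = trans (eC u) C∋u
      ; H-def = eH
      ; b≤F = ℤP.≤-trans b′≤b (ℤP.≤-trans b≤F (ℤP.≤-reflexive (sym (F-cong λ j _ → eC j))))
      ; mk₀⊆mk = λ j p → trans (em j) (mk₀⊆mk j p)
      ; mk⊆C = λ j p q → trans (eC j) (mk⊆C j (trans (sym (em j)) p) q)
      ; fixed = λ j p → trans (eS j) (fixed j p)
      ; sound = λ Z cZ zu → subst₂ (λ a c → a ≤ ∑ N (restrict Z S₀) + (c - fcl))
          (∑-cong N λ j _ → cong (λ s → if Z j then s else 0ℤ) (sym (eS j)))
          (sym (h-cong (λ j → cong (Z j ∧_) (eC j)) em)) (sound Z cZ zu)
      ; ω = ω ; 0≤ω = 0≤ω ; ω≤K = ω≤K
      ; wt≤ω = λ j l p → subst (λ s → wt s ≤ ω) (sym (eS j)) (wt≤ω j l (trans (sym (em j)) p))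
      ; potential = subst₂ (λ a c → a + + 2 * ((K - ω) * (b′ - fcl) + ω * (H′ - fcl)) ≤ Φ S₀ + B * B * c)
          (∑-cong N λ j _ → cong ψ (sym (eS j))) (count-cong N λ j → sym (em j))
          (by (Δ potential ⊹ (Δ ω≤K ✶ Δ b′≤b ⊹ Δ ω≤K ✶ Δ b′≤b))
            (trans (alg (Φ S) (Φ S₀ + B * B * # mk) K ω b b′ H fcl)
              (cong (λ t → Φ S₀ + B * B * # mk - (Φ S + + 2 * ((K - ω) * (b′ - fcl) + ω * (t - fcl))))
                (trans H-def (trans (sym (h-cong eC em)) (sym eH))))))
      }
      where
      open Inv i
      alg : ∀ P Q K ω b b′ H c → Q - (P + + 2 * ((K - ω) * (b - c) + ω * (H - c))) +
            ((K - ω) * (b - b′) + (K - ω) * (b - b′)) ≡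
            Q - (P + + 2 * ((K - ω) * (b′ - c) + ω * (H - c)))
      alg = solve-∀

    module _ {S mk C H b} (i : Inv S mk C H b) {v} (v<N : v ℕ.< N) (unmarked : mk ∌ v)
      (least : ∀ j → j ℕ.< N → mk ∌ j → S v ≤ S j)
      {S′ : ℕ → ℤ} {b′ : ℤ} (b′≤b : b′ ≤ b) (b′≤F : b′ ≤ F (C ∪ r v))
      (S′v : S′ v ≡ S v + (h (C ∪ r v) (mk ∪ single v) - H))
      (S′j : ∀ j → j ≢ v → S′ j ≡ S j) where

      open Inv i

      private
        C′ mk′ : NodeSet
        C′  = C ∪ r v
        mk′ = mk ∪ single v

        H′ y w : ℤ
        H′ = h C′ mk′
        y  = H′ - H
        w  = wt (S v)

        mk₀∌v : mk₀ ∌ v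
        mk₀∌v = ∌-from λ p → absurd (mk₀⊆mk v p) unmarked

        v-alive : r v ∌ n
        v-alive = proj₁ (∨-false mk₀∌v)

        C⊆C′ : C ⊆ C′
        C⊆C′ j = ∨-left

        C′-closed : Closed n r C′
        C′-closed = closed-∪ C-closed (closed-row pre v-alive)

        single-≢ : ∀ {j} → j ≢ v → single v ∌ j
        single-≢ {j} = dec-false (j ℕ.≟ v)

        single-count : # (single v) ≡ 1ℤ
        single-count = trans (∑-update N v {λ _ → 0ℤ} v<N λ j j≢v → cong bit (single-≢ j≢v))
          (cong₂ (λ a b → a + (bit b - 0ℤ)) (∑-zero N λ _ _ → refl) (single-self v))

        mk′-count : # mk′ ≡ # mk + 1ℤ
        mk′-count = trans (∑-update N v v<N λ j j≢v → cong bit (trans (cong (mk j ∨_) (single-≢ j≢v))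
            (∨-identityʳ (mk j))))
          (cong₂ (λ a b → # mk + (bit a - bit b)) (∨-right {mk v} (single-self v)) unmarked)

        -- Only `v` is newly marked, so at most one node leaves the penalised set.
        lost : # (C ∖ mk) ≤ # (C′ ∖ mk′) + 1ℤ
        lost = subst (# (C ∖ mk) ≤_)
          (trans (∑-+ N (λ j → bit ((C′ ∖ mk′) j)) (λ j → bit (single v j))) (cong (λ a → # (C′ ∖ mk′) + a)
              single-count))
          (∑-mono N λ j _ → pt (C j) (r v j) (mk j) (single v j))
          where
          pt : ∀ c q m s → bit (c ∧ not m) ≤ bit ((c ∨ q) ∧ not (m ∨ s)) + bit s
          pt false q m s     = 0≤bit (q ∧ not (m ∨ s)) ⊹ 0≤bit s
          pt true  q true s  = 0≤bit (not (true ∨ s)) ⊹ 0≤bit s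
          pt true  q false false = ℤP.≤-refl
          pt true  q false true  = ℤP.≤-refl

        H≡ : y ≡ F C′ - F C + β * (# (C′ ∖ mk′) - # (C ∖ mk))
        H≡ = trans (cong (λ t → H′ - t) H-def) (alg (F C′) (F C) β (# (C′ ∖ mk′)) (# (C ∖ mk)))
          where
          alg : ∀ a b β p q → a + β * p - (b + β * q) ≡ a - b + β * (p - q)
          alg = solve-∀

        marg = marginal C-closed C′-closed C∋u C⊆C′

        y≤B : y ≤ B
        y≤B = subst (_≤ B) (sym H≡)
          (by (Δ (proj₂ marg) ⊹ 0≤β ✶ Δ (count≤ N (C′ ∖ mk′)) ⊹ 0≤β ✶ Δ (count-nonneg N (C ∖ mk)) ⊹
              0≤β ✶ 0≤+ {n})
            (alg (F C′) (F C) β (# (C′ ∖ mk′)) (# (C ∖ mk)) (+ n)))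
          where
          alg : ∀ a b β p q n → b + β - a + β * (1ℤ + n - p) + β * (q - 0ℤ) + β * n ≡
                + 2 * (1ℤ + n) * β - (a - b + β * (p - q))
          alg = solve-∀

        -B≤y : - B ≤ y
        -B≤y = subst (- B ≤_) (sym H≡)
          (by (Δ (proj₁ marg) ⊹ 0≤β ✶ Δ lost ⊹ 0≤+ {2} ✶ 0≤β ✶ 0≤+ {n})
            (alg (F C′) (F C) β (# (C′ ∖ mk′)) (# (C ∖ mk)) (+ n)))
          where
          alg : ∀ a b β p q n → a + β - b + β * (p + 1ℤ - q) + + 2 * β * n ≡
                a - b + β * (p - q) - - (+ 2 * (1ℤ + n) * β)
          alg = solve-∀

        -- Diminishing returns. For `F` this is submodularity of Z ∩ C′ and C, whose union is C′
        -- because the row of `v` lies in Z. The penalty is modular here: outside Z neither the set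
        -- nor the marks change.
        gain : ∀ Z → Closed n r Z → Z ∋ v → y ≤ h (Z ∩ C′) mk′ - h (Z ∩ C) mk
        gain Z cZ Z∋v = subst (λ t → H′ - t ≤ h (Z ∩ C′) mk′ - h (Z ∩ C) mk) (sym H-def)
          (by (Δ submod ⊹ 0≤β ✶ Δ (ℤP.≤-reflexive counts))
            (alg (F C′) (F (Z ∩ C)) (F (Z ∩ C′)) (F C) β
              (# (C′ ∖ mk′)) (# ((Z ∩ C) ∖ mk)) (# ((Z ∩ C′) ∖ mk′)) (# (C ∖ mk))))
          where
          rv⊆Z : r v ⊆ Z
          rv⊆Z j = up cZ Z∋v
          union : ((Z ∩ C′) ∪ C) ≗′ C′
          union j = ⇔-≡ to (from′)
            where
            to : ((Z ∩ C′) ∪ C) ∋ j → C′ ∋ j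
            to e with ∨-elim {Z j ∧ C′ j} e
            ... | inj₁ p = proj₂ (∧-elim {Z j} p)
            ... | inj₂ q = C⊆C′ j q
            from′ : C′ ∋ j → ((Z ∩ C′) ∪ C) ∋ j
            from′ e with ∨-elim {C j} e
            ... | inj₁ p = ∨-right {Z j ∧ C′ j} p
            ... | inj₂ q = ∨-left (∧-intro (rv⊆Z j q) e)
          inter : ((Z ∩ C′) ∩ C) ≗′ (Z ∩ C)
          inter j = absorb (Z j) (C j) (r v j)
            where
            absorb : ∀ z c q → (z ∧ (c ∨ q)) ∧ c ≡ z ∧ c
            absorb false c     q = refl
            absorb true  true  q = refl
            absorb true  false q = ∧-zeroʳ q
          submod : F C′ + F (Z ∩ C) ≤ F (Z ∩ C′) + F C
          submod = subst₂ (λ a b → a + b ≤ F (Z ∩ C′) + F C) (F-cong λ j _ → union j) (F-cong λ j _ → inter j)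
            (F-sub (Z ∩ C′) C)
          counts : # (C′ ∖ mk′) + # ((Z ∩ C) ∖ mk) ≡ # ((Z ∩ C′) ∖ mk′) + # (C ∖ mk)
          counts = trans (sym (∑-+ N _ _)) (trans (∑-cong N λ j _ → pt j) (∑-+ N _ _))
            where
            pt : ∀ j → bit ((C′ ∖ mk′) j) + bit (((Z ∩ C) ∖ mk) j) ≡ bit (((Z ∩ C′) ∖ mk′) j) + bit
                ((C ∖ mk) j)
            pt j with Z j in zj
            ... | true  = refl
            ... | false rewrite ∌-from (λ p → absurd (rv⊆Z j p) zj)
                              | single-≢ {j} (λ { refl → absurd Z∋v zj })
                              | ∨-identityʳ (C j) | ∨-identityʳ (mk j) = ℤP.+-comm (bit (C j ∧ not (mk j))) 0ℤ
          alg : ∀ c′ zc zc′ c β p q p′ q′ → zc′ + c - (c′ + zc) + β * (p′ + q′ - (p + q)) ≡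
                zc′ + β * p′ - (zc + β * q) - (c′ + β * p - (c + β * q′))
          alg = solve-∀

        -- This is what the penalty is for. Closing up under `v` may add elements of Z although `v`
        -- is not in Z, and `F` may then drop by β. But an element so added is unmarked, as marked
        -- alive nodes are already in C, so the penalty rises by at least β.
        idle : ∀ Z → Closed n r Z → Z ∋ u → Z ∌ v → h (Z ∩ C) mk ≤ h (Z ∩ C′) mk′
        idle Z cZ Z∋u Z∌v with ⊆-or-witness N (Z ∩ C) (Z ∩ C′)
        ... | inj₁ sub⊆ = ℤP.≤-reflexive (cong₂ (λ a b → a + β * b)
                (F-cong λ j l → same j (ℕP.m≤n⇒m≤1+n l))
                (∑-cong N λ j l → cong bit (trans (unmark j) (cong (_∧ not (mk′ j)) (same j l)))))
          where
          grow : ∀ j → (Z ∩ C) ∋ j → (Z ∩ C′) ∋ j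
          grow j e = ∧-intro (proj₁ (∧-elim e)) (C⊆C′ j (proj₂ (∧-elim {Z j} e)))
          same : ∀ j → j ℕ.< N → (Z ∩ C) j ≡ (Z ∩ C′) j
          same j l = ⇔-≡ (grow j) (sub⊆ j l)
          unmark : ∀ j → ((Z ∩ C) ∖ mk) j ≡ ((Z ∩ C) ∖ mk′) j
          unmark j with Z j in zj
          ... | false = refl
          ... | true rewrite single-≢ {j} (λ { refl → absurd zj Z∌v }) | ∨-identityʳ (mk j) = refl
        ... | inj₂ (j , j<N , Z∩C′∋j , Z∩C∌j) = by
                (Δ (proj₁ (marginal (closed-∩ cZ C-closed) (closed-∩ cZ C′-closed) (∧-intro Z∋u C∋u) grow))
                  ⊹ 0≤β ✶ Δ (count-strict N {(Z ∩ C) ∖ mk} {(Z ∩ C′) ∖ mk′} j<N sub′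
                      (cong (_∧ not (mk j)) Z∩C∌j) new))
                (alg (F (Z ∩ C)) (F (Z ∩ C′)) β (# ((Z ∩ C) ∖ mk)) (# ((Z ∩ C′) ∖ mk′)))
          where
          alg : ∀ a b β p q → b + β - a + β * (q - (1ℤ + p)) ≡ b + β * q - (a + β * p)
          alg = solve-∀
          Z∋j = proj₁ (∧-elim {Z j} Z∩C′∋j)
          grow : (Z ∩ C) ⊆ (Z ∩ C′)
          grow j e = ∧-intro (proj₁ (∧-elim e)) (C⊆C′ j (proj₂ (∧-elim {Z j} e)))
          distinct : ∀ {j} → Z ∋ j → j ≢ v
          distinct e refl = absurd e Z∌v
          new : ((Z ∩ C′) ∖ mk′) ∋ j
          new = ∖-intro {Z ∩ C′} {mk′} Z∩C′∋j (cong₂ _∨_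
            (∌-from λ m → absurd (∧-intro Z∋j (mk⊆C j m (alive cZ Z∋j))) Z∩C∌j) (single-≢ (distinct Z∋j)))
          sub′ : ((Z ∩ C) ∖ mk) ⊆ ((Z ∩ C′) ∖ mk′)
          sub′ k e = let p , q = ∖-elim {Z ∩ C} {mk} e in
            ∖-intro {Z ∩ C′} {mk′} (grow k p) (cong₂ _∨_ q (single-≢ (distinct (proj₁ (∧-elim {Z k} p)))))

        restrict-step : ∀ Z → Z ∋ v → ∑ N (restrict Z S′) ≡ ∑ N (restrict Z S) + y
        restrict-step Z Z∋v = trans (∑-update N v v<N λ j j≢v → cong (λ s → if Z j then s else 0ℤ)
            (S′j j j≢v))
          (cong (λ t → ∑ N (restrict Z S) + t)
              (trans (cong (λ t → (if t then S′ v else 0ℤ) - (if t then S v else 0ℤ)) Z∋v)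
            (trans (cong (λ t → t - S v) S′v) (alg (S v) y))))
          where
          alg : ∀ s y → s + y - s ≡ y
          alg = solve-∀

        restrict-idle : ∀ Z → Z ∌ v → ∑ N (restrict Z S′) ≡ ∑ N (restrict Z S)
        restrict-idle Z Z∌v = ∑-cong N λ j _ → pt j
          where
          pt : ∀ j → restrict Z S′ j ≡ restrict Z S j
          pt j with Z j in zj
          ... | false = refl
          ... | true  = S′j j λ { refl → absurd zj Z∌v }

        sound′ : ∀ Z → Closed n r Z → Z ∋ u → ∑ N (restrict Z S′) ≤ ∑ N (restrict Z S₀) +
            (h (Z ∩ C′) mk′ - fcl)
        sound′ Z cZ Z∋u with Z v in zv
        ... | true  = by (Δ (sound Z cZ Z∋u) ⊹ Δ (gain Z cZ zv))
          (trans (alg (∑ N (restrict Z S)) (∑ N (restrict Z S₀)) (h (Z ∩ C) mk) (h (Z ∩ C′) mk′) fcl y)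
            (cong (λ t → ∑ N (restrict Z S₀) + (h (Z ∩ C′) mk′ - fcl) - t) (sym (restrict-step Z zv))))
          where
          alg : ∀ a b p q c y → b + (p - c) - a + (q - p - y) ≡ b + (q - c) - (a + y)
          alg = solve-∀
        ... | false = by (Δ (sound Z cZ Z∋u) ⊹ Δ (idle Z cZ Z∋u zv))
          (trans (alg (∑ N (restrict Z S)) (∑ N (restrict Z S₀)) (h (Z ∩ C) mk) (h (Z ∩ C′) mk′) fcl)
            (cong (λ t → ∑ N (restrict Z S₀) + (h (Z ∩ C′) mk′ - fcl) - t) (sym (restrict-idle Z zv))))
          where
          alg : ∀ a b p q c → b + (p - c) - a + (q - p) ≡ b + (q - c) - a
          alg = solve-∀

        -- One step of summation by parts: lowering the weight from ω to w moves the multiplier ω -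
        -- w from H to b, which weakens the bound since b ≤ H. The y² of `ψ-step` is at most B².
        potential′ : Φ S′ + + 2 * ((K - w) * (b′ - fcl) + w * (H′ - fcl)) ≤ Φ S₀ + B * B * # mk′
        potential′ = by
          (Δ potential ⊹ Δ (ψ-step (S v) y) ⊹ Δ y≤B ✶ Δ -B≤y
            ⊹ 0≤+ {2} ✶ (Δ (wt≤K (S v)) ✶ Δ b′≤b) ⊹ 0≤+ {2} ✶ (Δ (wt≤ω v v<N unmarked) ✶ Δ (b≤H i)))
          (trans (alg (Φ S) (Φ S₀) K ω w b b′ fcl H H′ B (# mk) (ψ (S v)) (ψ (S v + y)))
            (sym (cong₂ (λ p c → Φ S₀ + B * B * c - (p + + 2 * ((K - w) * (b′ - fcl) + w * (H′ - fcl)))) Φ′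
                mk′-count)))
          where
          Φ′ : Φ S′ ≡ Φ S + (ψ (S v + y) - ψ (S v))
          Φ′ = trans (∑-update N v v<N λ j j≢v → cong ψ (S′j j j≢v)) (cong (λ t → Φ S + (ψ t - ψ (S v))) S′v)
          alg : ∀ P P₀ K ω w b b′ c H H′ B m p p′ →
            P₀ + B * B * m - (P + + 2 * ((K - ω) * (b - c) + ω * (H - c)))
            + (p - + 2 * w * (H′ - H) + (H′ - H) * (H′ - H) - p′)
            + (B - (H′ - H)) * ((H′ - H) - - B)
            + + 2 * ((K - w) * (b - b′)) + + 2 * ((ω - w) * (H - b))
            ≡ P₀ + B * B * (m + 1ℤ) - (P + (p′ - p) + + 2 * ((K - w) * (b′ - c) + w * (H′ - c)))
          alg = solve-∀

      inv-step : Inv S′ mk′ C′ H′ b′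
      inv-step = record
        { C-closed = C′-closed
        ; C∋u = C⊆C′ u C∋u
        ; H-def = refl
        ; b≤F = b′≤F
        ; mk₀⊆mk = λ j p → ∨-left (mk₀⊆mk j p)
        ; mk⊆C = contained
        ; fixed = λ j p → trans (S′j j λ { refl → absurd p mk₀∌v }) (fixed j p)
        ; sound = sound′
        ; ω = w ; 0≤ω = 0≤wt (S v) ; ω≤K = wt≤K (S v)
        ; wt≤ω = λ j l p → let m , s = ∨-false p in
            subst (λ t → wt t ≤ w) (sym (S′j j λ { refl → absurd (single-self v) s })) (wt-antitone (least j l m))
        ; potential = potential′
        }
        where
        contained : ∀ j → mk′ ∋ j → r j ∌ n → C′ ∋ j
        contained j e a with ∨-elim {mk j} e
        ... | inj₁ p = C⊆C′ j (mk⊆C j p a)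
        ... | inj₂ q = ∨-right {C j} (subst (λ t → r v ∋ t) (sym (single-eq q)) (reflexive v))

    inv-start : ∀ {b} → fcl ≡ F (r u) → b ≤ fcl → Inv S₀ mk₀ (r u) fcl b
    inv-start {b} ef b≤ = record
      { C-closed = row
      ; C∋u = reflexive u
      ; H-def = trans ef (start (r u) (λ _ p → p))
      ; b≤F = subst (b ≤_) ef b≤
      ; mk₀⊆mk = λ _ p → p
      ; mk⊆C = λ j p a → [ (λ d → absurd d a) , (λ q → q) ]′ (∨-elim {r j n} p)
      ; fixed = λ _ _ → refl
      ; sound = λ Z cZ Z∋u → ℤP.≤-reflexive (sym (trans (cong (λ t → ∑ N (restrict Z S₀) + (t - fcl))
          (sym (trans (trans ef (F-cong λ j _ → sym (inside Z cZ Z∋u j))) (start (Z ∩ r u) λ j p →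
              proj₂ (∧-elim {Z j} p)))))
          (alg (∑ N (restrict Z S₀)) fcl)))
      ; ω = K ; 0≤ω = 0≤K ; ω≤K = ℤP.≤-refl
      ; wt≤ω = λ j _ _ → wt≤K (S₀ j)
      ; potential = by (square≥0 B ✶ count-nonneg N mk₀) (alg′ (Φ S₀) K b fcl (B * B * # mk₀))
      }
      where
      row : Closed n r (r u)
      row = closed-row pre u-alive
      alg : ∀ a c → a + (c - c) ≡ a
      alg = solve-∀
      alg′ : ∀ P K b c m → m ≡ P + m - (P + + 2 * ((K - K) * (b - c) + K * (c - c)))
      alg′ = solve-∀
      inside : ∀ Z → Closed n r Z → Z ∋ u → (Z ∩ r u) ≗′ r u
      inside Z cZ Z∋u j = ⇔-≡ (λ p → proj₂ (∧-elim {Z j} p)) (λ p → ∧-intro (up cZ Z∋u p) p)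
      start : ∀ X → X ⊆ r u → F X ≡ h X mk₀
      start X X⊆ = sym (trans (cong (λ t → F X + β * t) (∑-zero N λ j _ → cong bit (∌-from λ e →
        let p , q = ∖-elim {X} {mk₀} e in absurd (X⊆ j p) (proj₂ (∨-false {r j n} q)))))
        (alg″ (F X) β))
        where
        alg″ : ∀ x β → x + β * 0ℤ ≡ x
        alg″ = solve-∀

    module _ {S mk C H b} (i : Inv S mk C H b) (all-marked : ∀ j → j ℕ.< N → mk ∋ j) where
      open Inv i

      -- With all nodes marked the penalty vanishes and C contains every alive node, so the finished
      -- base obeys the inequality for `F` itself.
      round-sound : ∀ Z → Closed n r Z → Z ∋ u → ∑ N (restrict Z S) ≤ ∑ N (restrict Z S₀) + (F Z - fcl)
      round-sound Z cZ Z∋u = subst (λ t → ∑ N (restrict Z S) ≤ ∑ N (restrict Z S₀) + (t - fcl))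
        (trans (cong₂ (λ a c → a + β * c) (F-cong λ j l → whole j (ℕP.m≤n⇒m≤1+n l))
            (∑-zero N λ j l → cong bit (trans (cong (λ t → (Z ∩ C) j ∧ not t) (all-marked j l)) (∧-zeroʳ _))))
          (alg (F Z) β)) (sound Z cZ Z∋u)
        where
        alg : ∀ x β → x + β * 0ℤ ≡ x
        alg = solve-∀
        whole : ∀ j → j ℕ.< N → (Z ∩ C) j ≡ Z j
        whole j l = ⇔-≡ (λ p → proj₁ (∧-elim p)) λ p → ∧-intro p (mk⊆C j (all-marked j l) (alive cZ p))

      round-potential : Φ S + + 2 * K * (b - fcl) ≤ Φ S₀ + B * B * + N
      round-potential = by
        (Δ potential ⊹ 0≤+ {2} ✶ (0≤ω ✶ Δ (b≤H i)) ⊹ square≥0 B ✶ Δ (count≤ N mk))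
        (alg (Φ S) (Φ S₀) K ω b H fcl (B * B) (# mk) (+ N))
        where
        alg : ∀ P P₀ K ω b H c B² m N →
          P₀ + B² * m - (P + + 2 * ((K - ω) * (b - c) + ω * (H - c))) + + 2 * (ω * (H - b)) + B² * (N - m)
          ≡ P₀ + B² * N - (P + + 2 * K * (b - c))
        alg = solve-∀

  -- Written exactly as the program expression `pos′` evaluates, so that the two agree by
  -- definition.
  pos : ℤ → ℤ
  pos x = if nz (bit (does (0ℤ ℤ.≤? x))) then x else 0ℤ

  0≤pos : ∀ x → 0ℤ ≤ pos x
  0≤pos x with 0ℤ ℤ.≤? x
  ... | yes p = p
  ... | no _  = ℤP.≤-refl

  ≤pos : ∀ x → x ≤ pos x
  ≤pos x with 0ℤ ℤ.≤? x
  ... | yes _ = ℤP.≤-refl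
  ... | no h  = ℤP.<⇒≤ (ℤP.≰⇒> h)

  if-true : ∀ {A : Set} {b} {x y : A} → b ≡ true → (if b then x else y) ≡ x
  if-true refl = refl

  if-false : ∀ {A : Set} {b} {x y : A} → b ≡ false → (if b then x else y) ≡ y
  if-false refl = refl

  minimiser : ∀ m (P : NodeSet) (g : ℕ → ℤ) → (∀ j → j ℕ.< m → P ∌ j) ⊎
              (∃[ v ] v ℕ.< m × P ∋ v × (∀ j → j ℕ.< m → P ∋ j → g v ≤ g j))
  minimiser zero    P g = inj₁ λ _ ()
  minimiser (suc m) P g with minimiser m P g | P m in pm
  ... | inj₁ none | false = inj₁ λ j l → extend j l
    where
    extend : ∀ j → j ℕ.< suc m → P ∌ j
    extend j l with j ℕ.≟ m
    ... | yes refl = pm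
    ... | no j≢m   = none j (ℕP.≤∧≢⇒< (ℕP.≤-pred l) j≢m)
  ... | inj₁ none | true  = inj₂ (m , ℕP.≤-refl , pm , λ j l p → extend j l p)
    where
    extend : ∀ j → j ℕ.< suc m → P ∋ j → g m ≤ g j
    extend j l p with j ℕ.≟ m
    ... | yes refl = ℤP.≤-refl
    ... | no j≢m   = absurd p (none j (ℕP.≤∧≢⇒< (ℕP.≤-pred l) j≢m))
  ... | inj₂ (v , v<m , pv , least) | false = inj₂ (v , ℕP.m≤n⇒m≤1+n v<m , pv , λ j l p → extend j l p)
    where
    extend : ∀ j → j ℕ.< suc m → P ∋ j → g v ≤ g j
    extend j l p with j ℕ.≟ m
    ... | yes refl = absurd p pm
    ... | no j≢m   = least j (ℕP.≤∧≢⇒< (ℕP.≤-pred l) j≢m) p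
  ... | inj₂ (v , v<m , pv , least) | true with ≤-or-≥ (g v) (g m)
  ...   | inj₁ v≤m = inj₂ (v , ℕP.m≤n⇒m≤1+n v<m , pv , λ j l p → extend j l p)
    where
    extend : ∀ j → j ℕ.< suc m → P ∋ j → g v ≤ g j
    extend j l p with j ℕ.≟ m
    ... | yes refl = v≤m
    ... | no j≢m   = least j (ℕP.≤∧≢⇒< (ℕP.≤-pred l) j≢m) p
  ...   | inj₂ m≤v = inj₂ (m , ℕP.≤-refl , pm , λ j l p → extend j l p)
    where
    extend : ∀ j → j ℕ.< suc m → P ∋ j → g m ≤ g j
    extend j l p with j ℕ.≟ m
    ... | yes refl = ℤP.≤-refl
    ... | no j≢m   = ℤP.≤-trans m≤v (least j (ℕP.≤∧≢⇒< (ℕP.≤-pred l) j≢m) p)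

  -- Marginals and the scale

  module Marginals {n : ℕ} (f : SetFunction n) (sub : Submodular f) (r : Relation) (pre : Preorder r) where
    open Submodularity n f sub
    open Preorder pre

    N : ℕ
    N = suc n

    strict : ℕ → NodeSet
    strict v j = r v j ∧ not (r j v)

    -- By submodularity this bounds the increase from adding the row of `v` to any closed set that
    -- contains `strict v` and misses `v`.
    rise : ℕ → ℤ
    rise v = pos (F (r v) - F (strict v))

    weight : NodeSet → ℕ → ℤ
    weight X v = if X v then rise v else 0ℤ

    0≤weight : ∀ X v → 0ℤ ≤ weight X v
    0≤weight X v with X v
    ... | true  = 0≤pos (F (r v) - F (strict v))
    ... | false = ℤP.≤-refl

    weight-mono : ∀ {X Y} v → (X ∋ v → Y ∋ v) → weight X v ≤ weight Y v
    weight-mono {X} {Y} v h with X v in xv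
    ... | false = 0≤weight Y v
    ... | true rewrite h refl = ℤP.≤-refl

    Full : NodeSet
    Full j = not (r j n)

    full-closed : Closed n r Full
    full-closed = closed
      (λ {v} {j} p q → cong not (∌-from λ d → absurd (transitive q d) (not-elim p)))
      (cong not (reflexive n))

    ⊆-full : ∀ {Z} → Closed n r Z → Z ⊆ Full
    ⊆-full cZ j p = cong not (alive cZ p)

    -- A node of D outside C with the smallest row is added first: every element of its strict row
    -- has a smaller row and therefore lies in C already. So `r v` meets C exactly in `strict v`,
    -- and submodularity bounds the increase by `rise v`. The number `k` is fuel.
    chain : ∀ k {C D} → Closed n r C → Closed n r D → C ⊆ D → count N (D ∖ C) ≤ + k →
            F D ≤ F C + ∑ N (weight (D ∖ C))
    chain k {C} {D} cC cD C⊆D size with minimiser N (D ∖ C) (λ v → count N (r v))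
    ... | inj₁ none = subst (_≤ F C + ∑ N (weight (D ∖ C)))
        (F-cong λ j l → ⇔-≡ (C⊆D j) λ p → ∈C j l p)
        (by (∑-nonneg N λ j _ → 0≤weight (D ∖ C) j) (alg (F C) (∑ N (weight (D ∖ C)))))
      where
      alg : ∀ a b → b ≡ a + b - a
      alg = solve-∀
      ∈C : ∀ j → j ℕ.< n → D ∋ j → C ∋ j
      ∈C j l p with C j in cj
      ... | true  = refl
      ... | false = absurd (∖-intro {D} {C} p cj) (none j (ℕP.m≤n⇒m≤1+n l))
    ... | inj₂ (v , v<N , v∈ , least) = next k size
      where
      D∋v = proj₁ (∖-elim {D} {C} v∈)
      C∌v = proj₂ (∖-elim {D} {C} v∈)
      rv = closed-row {r = r} pre (alive cD D∋v)
      C₁ = C ∪ r v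
      C₁⊆D : C₁ ⊆ D
      C₁⊆D j p = [ C⊆D j , up cD D∋v ]′ (∨-elim {C j} p)
      meet : ∀ j → j ℕ.< n → (r v ∩ C) j ≡ strict v j
      meet j l = ⇔-≡
        (λ p → let a , c = ∧-elim {r v j} p in ∧-intro a (cong not (∌-from λ b → absurd (up cC c b) C∌v)))
        (λ p → let a , b = ∧-elim {r v j} p in ∧-intro a (back a (not-elim b)))
        where
        back : r v ∋ j → r j ∌ v → C ∋ j
        back a b with C j in cj
        ... | true  = refl
        ... | false = ⊥-elim (ℤP.<-irrefl refl (ℤP.<-≤-trans (ℤP.suc[i]≤j⇒i<j
                (count-strict N v<N (λ k → transitive a) b (reflexive v)))
                (least j (ℕP.m≤n⇒m≤1+n l) (∖-intro {D} {C} (up cD D∋v a) cj))))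
      first : F C₁ ≤ F C + rise v
      first = by (Δ (F-sub (r v) C) ⊹ Δ (≤pos (F (r v) - F (strict v))))
        (trans (cong₂ (λ p q → F (r v) + F C - (p + q) + (rise v - (F (r v) - F (strict v))))
          (F-cong λ j _ → ∨-comm (r v j) (C j)) (F-cong meet)) (alg (F (r v)) (F C) (F C₁) (F (strict v))
              (rise v)))
        where
        alg : ∀ a c c₁ s x → a + c - (c₁ + s) + (x - (a - s)) ≡ c + x - c₁
        alg = solve-∀
      without : ℕ → ℤ
      without j = if single v j then 0ℤ else weight (D ∖ C) j
      split : ∑ N without ≡ ∑ N (weight (D ∖ C)) + (0ℤ - rise v)
      split = trans (∑-update N v v<N λ j j≢v → if-false (dec-false (j ℕ.≟ v) j≢v))
        (cong₂ (λ a b → ∑ N (weight (D ∖ C)) + (a - b)) (if-true (single-self v)) (if-true v∈))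
      less : ∑ N (weight (D ∖ C₁)) ≤ ∑ N without
      less = ∑-mono N λ j _ → pt j
        where
        pt : ∀ j → weight (D ∖ C₁) j ≤ without j
        pt j with j ℕ.≟ v
        ... | yes refl = subst₂ _≤_ (sym (if-false (cong (λ t → D v ∧ not t) (∨-right {C v} (reflexive v)) ■
            ∧-zeroʳ (D v))))
                           (sym (if-true (single-self v))) ℤP.≤-refl
          where _■_ = trans
        ... | no j≢v   = subst (weight (D ∖ C₁) j ≤_) (sym (if-false (dec-false (j ℕ.≟ v) j≢v)))
                           (weight-mono {D ∖ C₁} {D ∖ C} j λ p → let a , b = ∖-elim {D} {C₁} p in
                             ∖-intro {D} {C} a (proj₁ (∨-false {C j} b)))
      drop : 1ℤ + count N (D ∖ C₁) ≤ count N (D ∖ C)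
      drop = count-strict N v<N
        (λ j p → let a , b = ∖-elim {D} {C₁} p in ∖-intro {D} {C} a (proj₁ (∨-false {C j} b)))
        (trans (cong (λ t → D v ∧ not t) (∨-right {C v} (reflexive v))) (∧-zeroʳ (D v))) v∈
      next : ∀ k → count N (D ∖ C) ≤ + k → F D ≤ F C + ∑ N (weight (D ∖ C))
      next zero    size = ⊥-elim (1≰0 (ℤP.≤-trans (by (count-nonneg N (D ∖ C₁)) (alg (count N (D ∖ C₁))))
          (ℤP.≤-trans drop size)))
        where
        1≰0 : ¬ 1ℤ ≤ 0ℤ
        1≰0 (ℤ.+≤+ ())
        alg : ∀ c → c ≡ 1ℤ + c - 1ℤ
        alg = solve-∀
      next (suc k) size = by (Δ (chain k (closed-∪ cC rv) cD C₁⊆D smaller) ⊹ Δ first ⊹ Δ less)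
        (trans (cong (λ t → F C₁ + ∑ N (weight (D ∖ C₁)) - F D + (F C + rise v - F C₁) +
            (t - ∑ N (weight (D ∖ C₁)))) split)
          (alg (F C) (F C₁) (F D) (∑ N (weight (D ∖ C))) (∑ N (weight (D ∖ C₁))) (rise v)))
        where
        smaller : count N (D ∖ C₁) ≤ + k
        smaller = by (Δ drop ⊹ Δ size) (alg′ (count N (D ∖ C₁)) (count N (D ∖ C)) (+ k))
          where
          alg′ : ∀ a b k → b - (1ℤ + a) + (1ℤ + k - b) ≡ k - a
          alg′ = solve-∀
        alg : ∀ c c₁ d w w₁ x → c₁ + w₁ - d + (c + x - c₁) + (w + (0ℤ - x) - w₁) ≡ c + w - d
        alg = solve-∀

    module _ (u : ℕ) where

      active : NodeSet
      active j = not (r j n ∨ r u j)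

      -- A rise between closed sets containing `u` is at most E by `chain`. A fall from C to D is
      -- bounded by a detour: C is at most E above `r u`, and D at most E below `Full`. The summand
      -- 1 keeps β positive and is what remains of it at the end.
      E β : ℤ
      E = ∑ N (weight active)
      β = 1ℤ + (E + E) + pos (F (r u) - F Full)

      0≤E : 0ℤ ≤ E
      0≤E = ∑-nonneg N λ j _ → 0≤weight active j

      1≤β : 1ℤ ≤ β
      1≤β = by (0≤E ⊹ 0≤E ⊹ 0≤pos (F (r u) - F Full)) (alg E (pos (F (r u) - F Full)))
        where
        alg : ∀ e p → e + e + p ≡ 1ℤ + (e + e) + p - 1ℤ
        alg = solve-∀

      opaque
        0≤β : 0ℤ ≤ β
        0≤β = ℤP.≤-trans 0≤+ 1≤β

      chain-E : ∀ {C D} → Closed n r C → Closed n r D → C ∋ u → C ⊆ D → F D ≤ F C + E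
      chain-E {C} {D} cC cD C∋u C⊆D = ℤP.≤-trans (chain N cC cD C⊆D (count≤ N (D ∖ C)))
        (ℤP.+-monoʳ-≤ (F C) (∑-mono N λ j _ → weight-mono {D ∖ C} {active} j λ p →
          let a , b = ∖-elim {D} {C} p in
          cong not (cong₂ _∨_ (alive cD a) (∌-from λ q → absurd (up cC C∋u q) b))))

      opaque
        marginal : r u ∌ n → ∀ {C D} → Closed n r C → Closed n r D → C ∋ u → C ⊆ D → F C ≤ F D + β ×
            F D ≤ F C + β
        marginal u-alive {C} {D} cC cD C∋u C⊆D =
            by (Δ (chain-E row cC (reflexive u) λ j → up cC C∋u)
                ⊹ Δ (chain-E cD full-closed (C⊆D u C∋u) (⊆-full cD)) ⊹ Δ (≤pos (F (r u) - F Full)) ⊹ 0≤+ {1})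
              (alg (F C) (F D) (F (r u)) (F Full) E (pos (F (r u) - F Full)))
          , by (Δ (chain-E cC cD C∋u C⊆D) ⊹ 0≤E ⊹ 0≤pos (F (r u) - F Full) ⊹ 0≤+ {1})
              (alg′ (F C) (F D) E (pos (F (r u) - F Full)))
          where
          row : Closed n r (r u)
          row = closed-row {r = r} pre u-alive
          alg : ∀ c d x y e p → x + e - c + (d + e - y) + (p - (x - y)) + 1ℤ ≡ d + (1ℤ + (e + e) + p) - c
          alg = solve-∀
          alg′ : ∀ c d e p → c + e - d + e + p + 1ℤ ≡ c + (1ℤ + (e + e) + p) - d
          alg′ = solve-∀

  1≤* : ∀ {a b} → 1ℤ ≤ a → 1ℤ ≤ b → 1ℤ ≤ a * b
  1≤* {a} {b} p q = by (Δ p ✶ Δ q ⊹ Δ p ⊹ Δ q) (alg a b)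
    where
    alg : ∀ a b → (a - 1ℤ) * (b - 1ℤ) + (a - 1ℤ) + (b - 1ℤ) ≡ a * b - 1ℤ
    alg = solve-∀

  cancel : ∀ {c a b} → 1ℤ ≤ c → c * a ≤ c * b → a ≤ b
  cancel {+ suc c} (ℤ.+≤+ _) h = ℤP.*-cancelˡ-≤-pos _ _ (+ suc c) h
  cancel {+ zero} (ℤ.+≤+ ()) h

  1≰0 : ¬ 1ℤ ≤ 0ℤ
  1≰0 (ℤ.+≤+ ())

  ≤-or-1+≤ : ∀ a b → a ≤ b ⊎ b + 1ℤ ≤ a
  ≤-or-1+≤ a b with a ℤP.≤? b
  ... | yes p = inj₁ p
  ... | no h  = inj₂ (subst (_≤ a) (ℤP.+-comm 1ℤ b) (ℤP.i<j⇒suc[i]≤j (ℤP.≰⇒> h)))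

  -- The duality gap of a sum of greedy bases

  module Run {n : ℕ} (f : SetFunction n) (sub : Submodular f) (r : Relation) (pre : Preorder r)
    (u : ℕ) (u-alive : r u ∌ n) (m : ℤ) (1≤m : 1ℤ ≤ m) (b₀ : ℤ) where

    open Marginals f sub r pre using (N; β; 0≤β; 1≤β; marginal)
    open Submodularity n f sub
    open Preorder pre

    fcl : ℤ
    fcl = F (r u)

    -- K = mB balances the two errors over m² bases: N B² for each base, and N K² once from the
    -- clipping.
    β′ B K : ℤ
    β′ = β u
    B = + 2 * + N * β′
    K = m * B

    1≤N : 1ℤ ≤ + N
    1≤N = ℤ.+≤+ (s≤s z≤n)

    1≤B : 1ℤ ≤ B
    1≤B = 1≤* (1≤* {+ 2} (ℤ.+≤+ (s≤s z≤n)) 1≤N) (1≤β u)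

    opaque
      0≤K : 0ℤ ≤ K
      0≤K = ℤP.≤-trans 0≤+ (1≤* 1≤m 1≤B)

    module Step = GreedyStep f sub r pre u u-alive fcl β′ (0≤β u) (marginal u u-alive) K 0≤K
    open Clip K 0≤K

    restrict : NodeSet → (ℕ → ℤ) → ℕ → ℤ
    restrict Z S j = if Z j then S j else 0ℤ

    mk₀ : NodeSet
    mk₀ j = r j n ∨ r u j

    Φ : (ℕ → ℤ) → ℤ
    Φ S = ∑ N (λ j → ψ (S j))

    negative : (ℕ → ℤ) → ℤ
    negative S = ∑ N (λ j → S j ⊓ 0ℤ)

    -- `G` adds up the differences of the best value and `fcl`, which is what the potential
    -- inequalities of the single bases control. As best values only decrease, it lies between t
    -- times the final and t times the initial difference.
    record RunInv (t : ℕ) (S : ℕ → ℤ) (G b : ℤ) : Set where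
      field
        sound     : ∀ Z → Closed n r Z → Z ∋ u → ∑ N (restrict Z S) ≤ + t * (F Z - fcl)
        zeros     : ∀ j → mk₀ ∋ j → S j ≡ 0ℤ
        G≥        : + t * (b - fcl) ≤ G
        G≤        : G ≤ + t * (b₀ - fcl)
        b≤b₀      : b ≤ b₀
        b≤fcl     : b ≤ fcl
        potential : Φ S + + 2 * K * G ≤ + t * (B * B * + N)

    run-start : ∀ {S b} → (∀ j → S j ≡ 0ℤ) → b ≤ b₀ → b ≤ fcl → RunInv 0 S 0ℤ b
    run-start {S} S≡0 b≤b₀ b≤fcl = record
      { sound = λ Z _ _ → ℤP.≤-reflexive (∑-zero N λ j _ → vanish Z j)
      ; zeros = λ j _ → S≡0 j
      ; G≥ = ℤP.≤-refl
      ; G≤ = ℤP.≤-refl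
      ; b≤b₀ = b≤b₀
      ; b≤fcl = b≤fcl
      ; potential = subst (_≤ 0ℤ) (trans (sym (ℤP.+-identityʳ (Φ S))) (cong (λ t → Φ S + t)
          (sym (ℤP.*-zeroʳ (+ 2 * K)))))
          (subst (Φ S ≤_) (∑-zero N λ _ _ → refl) (∑-mono N λ j _ → subst (λ s → ψ s ≤ 0ℤ) (sym (S≡0 j))
              ψ-zero))
      }
      where
      vanish : ∀ Z j → restrict Z S j ≡ 0ℤ
      vanish Z j with Z j
      ... | true  = S≡0 j
      ... | false = refl

    run-step : ∀ {t S G b S′ mk C H b′} → RunInv t S G b → b′ ≤ b →
               Step.Inv S S′ mk C H b′ → (∀ j → j ℕ.< N → mk ∋ j) → RunInv (suc t) S′ (G + (b′ - fcl)) b′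
    run-step {t} {S} {G} {b} {S′} {b′ = b′} i b′≤b g all = record
      { sound = λ Z cZ Z∋u → by (Δ (sound Z cZ Z∋u) ⊹ Δ (Step.round-sound S g all Z cZ Z∋u))
          (alg₁ (∑ N (restrict Z S)) (∑ N (restrict Z S′)) (+ t) (F Z) fcl)
      ; zeros = λ j p → trans (Step.Inv.fixed g j p) (zeros j p)
      ; G≥ = by (Δ G≥ ⊹ 0≤+ {t} ✶ Δ b′≤b) (alg₂ G (+ t) b b′ fcl)
      ; G≤ = by (Δ G≤ ⊹ Δ (ℤP.≤-trans b′≤b b≤b₀)) (alg₃ G (+ t) b₀ b′ fcl)
      ; b≤b₀ = ℤP.≤-trans b′≤b b≤b₀
      ; b≤fcl = ℤP.≤-trans b′≤b b≤fcl
      ; potential = by (Δ potential ⊹ Δ (Step.round-potential S g all))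
          (alg₄ (Φ S) (Φ S′) K G b′ fcl (+ t) (B * B * + N))
      }
      where
      open RunInv i
      alg₁ : ∀ a a′ t z c → t * (z - c) - a + (a + (z - c) - a′) ≡ (1ℤ + t) * (z - c) - a′
      alg₁ = solve-∀
      alg₂ : ∀ G t b b′ c → G - t * (b - c) + t * (b - b′) ≡ G + (b′ - c) - (1ℤ + t) * (b′ - c)
      alg₂ = solve-∀
      alg₃ : ∀ G t b₀ b′ c → t * (b₀ - c) - G + (b₀ - b′) ≡ (1ℤ + t) * (b₀ - c) - (G + (b′ - c))
      alg₃ = solve-∀
      alg₄ : ∀ P P′ K G b′ c t X → t * X - (P + + 2 * K * G) + (P + X - (P′ + + 2 * K * (b′ - c))) ≡
             (1ℤ + t) * X - (P′ + + 2 * K * (G + (b′ - c)))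
      alg₄ = solve-∀

    negative≤ : ∀ Z S → negative S ≤ ∑ N (restrict Z S)
    negative≤ Z S = ∑-mono N λ j _ → pt j
      where
      pt : ∀ j → S j ⊓ 0ℤ ≤ restrict Z S j
      pt j with Z j
      ... | true  = ℤP.i⊓j≤i (S j) 0ℤ
      ... | false = ℤP.i⊓j≤j (S j) 0ℤ

    negative-without : ∀ Z S w → w ℕ.< N → Z ∌ w → S w ≤ 0ℤ → negative S - S w ≤ ∑ N (restrict Z S)
    negative-without Z S w w<N Z∌w Sw≤0 = subst (_≤ ∑ N (restrict Z S)) split (∑-mono N λ j _ → pt j)
      where
      g : ℕ → ℤ
      g j = if single w j then 0ℤ else S j ⊓ 0ℤ
      pt : ∀ j → g j ≤ restrict Z S j
      pt j with j ℕ.≟ w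
      ... | yes refl = subst₂ _≤_ (sym (if-true (single-self w))) (sym (if-false Z∌w)) ℤP.≤-refl
      ... | no j≢w with Z j
      ...   | true  = subst (_≤ S j) (sym (if-false (dec-false (j ℕ.≟ w) j≢w))) (ℤP.i⊓j≤i (S j) 0ℤ)
      ...   | false = subst (_≤ 0ℤ) (sym (if-false (dec-false (j ℕ.≟ w) j≢w))) (ℤP.i⊓j≤j (S j) 0ℤ)
      split : ∑ N g ≡ negative S - S w
      split = trans (∑-update N w w<N λ j j≢w → if-false (dec-false (j ℕ.≟ w) j≢w))
        (trans (cong₂ (λ a b → negative S + (a - b)) (if-true (single-self w)) (ℤP.i≤j⇒i⊓j≡i Sw≤0))
          (cong (λ t → negative S + t) (ℤP.+-identityˡ (- S w))))

    -- The negative part of S without w is at most S(Z), because Z misses w, and S(Z) is at most t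
    -- (F Z - fcl) ≤ G. Conversely, a w violating the conclusion lies in every such Z, in particular
    -- in every minimiser containing `u`.
    arc-sound : ∀ {t S G b} → RunInv t S G b → ∀ {Z} → Closed n r Z → Z ∋ u → F Z ≤ b →
                ∀ w → w ℕ.< N → Z ∌ w → S w ≤ 0ℤ → negative S - S w ≤ G
    arc-sound {t} {S} i {Z} cZ Z∋u FZ≤b w w<N Z∌w Sw≤0 =
      ℤP.≤-trans (negative-without Z S w w<N Z∌w Sw≤0) (ℤP.≤-trans (sound Z cZ Z∋u)
        (ℤP.≤-trans (ℤP.*-monoˡ-≤-nonNeg (+ t) (ℤP.+-monoˡ-≤ (- fcl) FZ≤b)) G≥))
      where open RunInv i

    -- The potential is at most m² B² N - 2KG by summation over the bases, and at least - 2K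
    -- (negative S) - N K² by `ψ-neg`; then division by 2K.
    gap : ∀ {T S G b} → + T ≡ m * m → RunInv T S G b → G - negative S ≤ + N * (m * B)
    gap {T} {S} {G} eT i = cancel (1≤* {+ 2} {K} (ℤ.+≤+ (s≤s z≤n)) (1≤* 1≤m 1≤B))
      (by (Δ (subst (λ t → Φ S + + 2 * K * G ≤ t * (B * B * + N)) eT (RunInv.potential i)) ⊹ Δ lower)
        (alg (Φ S) m B G (negative S) (+ N)))
      where
      alg : ∀ P m B G W N → m * m * (B * B * N) - (P + + 2 * (m * B) * G) +
            (P - (- (+ 2 * (m * B)) * W + N * (- (m * B * (m * B))))) ≡
            + 2 * (m * B) * (N * (m * B)) - + 2 * (m * B) * (G - W)
      alg = solve-∀
      lower : - (+ 2 * K) * negative S + + N * (- (K * K)) ≤ Φ S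
      lower = subst (_≤ Φ S)
        (trans (∑-+ N _ _) (cong₂ _+_ (∑-* N (- (+ 2 * K)) _) (∑-const N (- (K * K)))))
        (∑-mono N λ j _ → subst (_≤ ψ (S j)) (cong (λ t → t + - (K * K)) (alg′ K (S j ⊓ 0ℤ))) (ψ-neg (S j)))
        where
        alg′ : ∀ K s → - (+ 2 * K * s) ≡ - (+ 2 * K) * s
        alg′ = solve-∀

    Q : ℤ
    Q = + N * (+ N * (m * B))

    module _ {T S G b} (eT : + T ≡ m * m) (i : RunInv T S G b)
      (no-arc : ∀ w → w ℕ.< N → r u ∌ w → S w ≤ 0ℤ → negative S - S w ≤ G) where

      open RunInv i

      private
        marked-zero : ∀ j → r u ∋ j → S j ≡ 0ℤ
        marked-zero j p = zeros j (∨-right {r j n} p)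

        -- The adjoined node n is marked and lies outside `r u`, so S n = 0, and the absence of a
        -- pair from `u` to n is exactly this inequality.
        NS≤G : negative S ≤ G
        NS≤G = subst (_≤ G) (trans (cong (λ t → negative S - t) Sn≡0) (ℤP.+-identityʳ (negative S)))
          (no-arc n ℕP.≤-refl u-alive (ℤP.≤-reflexive Sn≡0))
          where
          Sn≡0 : S n ≡ 0ℤ
          Sn≡0 = zeros n (∨-left (reflexive n))

        each : ∀ j → j ℕ.< N → negative S - G ≤ S j ⊓ 0ℤ
        each j j<N with ≤-or-≥ (S j) 0ℤ
        ... | inj₂ 0≤s = subst (negative S - G ≤_) (sym (ℤP.i≥j⇒i⊓j≡j 0≤s)) (ℤP.i≤j⇒i-j≤0 NS≤G)
        ... | inj₁ s≤0 with r u j in ruj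
        ...   | true  = subst (negative S - G ≤_) (sym (trans (ℤP.i≤j⇒i⊓j≡i s≤0) (marked-zero j ruj)))
            (ℤP.i≤j⇒i-j≤0 NS≤G)
        ...   | false = subst (negative S - G ≤_) (sym (ℤP.i≤j⇒i⊓j≡i s≤0))
                          (by (Δ (no-arc j j<N ruj s≤0)) (alg (negative S) G (S j)))
          where
          alg : ∀ a g s → g - (a - s) ≡ s - (a - g)
          alg = solve-∀

        -- Without a new pair no entry of S falls below minus the duality gap, and there are N
        -- entries.
        -Q≤negative : - Q ≤ negative S
        -Q≤negative = ℤP.≤-trans (by (0≤+ {N} ✶ Δ (gap eT i)) (alg (negative S) G (+ N) (m * B)))
          (subst (_≤ negative S) (∑-const N (negative S - G)) (∑-mono N each))
          where
          alg : ∀ a g N x → N * (N * x - (g - a)) ≡ N * (a - g) - - (N * (N * x))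
          alg = solve-∀

      near-best : m * m * (fcl - b₀) ≤ Q
      near-best = by (Δ -Q≤negative ⊹ Δ NS≤G ⊹ Δ (subst (λ t → G ≤ t * (b₀ - fcl)) eT G≤))
        (alg (negative S) G Q (m * m) fcl b₀)
        where
        alg : ∀ a g q T c b → a - - q + (g - a) + (T * (b - c) - g) ≡ q - T * (c - b)
        alg = solve-∀

      near-minimal : ∀ C → Closed n r C → C ∋ u → m * m * (fcl - F C) ≤ Q
      near-minimal C cC C∋u = by (Δ -Q≤negative ⊹
          Δ (negative≤ C S) ⊹ Δ (subst (λ t → ∑ N (restrict C S) ≤ t * (F C - fcl)) eT (sound C cC C∋u)))
        (alg (negative S) (∑ N (restrict C S)) Q (m * m) fcl (F C))
        where
        alg : ∀ a g q T c b → a - - q + (g - a) + (T * (b - c) - g) ≡ q - T * (c - b)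
        alg = solve-∀

  pos-scaled : ∀ {T x q} → 0ℤ ≤ q → T * x ≤ q → T * pos x ≤ q
  pos-scaled {T} {x} {q} 0≤q h with 0ℤ ℤ.≤? x
  ... | yes _ = h
  ... | no _  = subst (_≤ q) (sym (ℤP.*-zeroʳ T)) 0≤q

  -- A round without new pairs

  module Stable {n : ℕ} (f : SetFunction n) (sub : Submodular f) (r : Relation) (pre : Preorder r)
    (m : ℤ) (1≤m : 1ℤ ≤ m) (b₀ : ℤ) where

    open Marginals f sub r pre
    open Submodularity n f sub
    open Preorder pre

    Q : ∀ u → r u ∌ n → ℤ
    Q u a = Run.Q f sub r pre u a m 1≤m b₀

    record Certified (u : ℕ) : Set where
      field
        u-alive      : r u ∌ n
        tested       : b₀ ≤ F (r u)
        near-best    : m * m * (F (r u) - b₀) ≤ Q u u-alive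
        near-minimal : ∀ C → Closed n r C → C ∋ u → m * m * (F (r u) - F C) ≤ Q u u-alive

    module _ (A : NodeSet) (A⊆ : ∀ v → A ⊆ r v) (large : + 40 * (+ N * + N * + N * + N) ≤ m)
      (b₀≤A : b₀ ≤ F A) (cert : ∀ u → u ℕ.< N → r u ∌ n → Certified u) where

      private
        emptyish : ∀ C → A ⊆ C → (∀ j → j ℕ.< N → C ∌ j) → b₀ ≤ F C
        emptyish C A⊆C none = subst (b₀ ≤_) (F-cong λ j l →
          let c = none j (ℕP.m≤n⇒m≤1+n l) in trans (∌-from λ a → absurd (A⊆C j a) c) (sym c)) b₀≤A

        1≤T : 1ℤ ≤ m * m
        1≤T = 1≤* 1≤m 1≤m

        0≤T : 0ℤ ≤ m * m
        0≤T = ℤP.≤-trans 0≤+ 1≤T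

      -- Without new arcs the vertex of largest scale β forces β = 1; then all errors are
      -- smaller than one and integrality finishes the argument.
      module _ (v : ℕ) (v<N : v ℕ.< N) (v-alive : r v ∌ n)
        (largest : ∀ u → u ℕ.< N → r u ∌ n → β u ≤ β v) where

        private
          βv Qv N′ : ℤ
          βv = β v
          Qv = Q v v-alive
          N′ = + N

          Q≤ : ∀ u → u ℕ.< N → (a : r u ∌ n) → Q u a ≤ Qv
          Q≤ u l a = by (0≤+ {N} ✶ (0≤+ {N} ✶ (ℤP.≤-trans 0≤+ 1≤m ✶ (0≤+ {2} ✶ 0≤+ {N} ✶ Δ (largest u l a)))))
            (alg N′ m (β u) βv)
            where
            alg : ∀ N m x y → N * (N * (m * (+ 2 * N * (y - x)))) ≡
                  N * (N * (m * (+ 2 * N * y))) - N * (N * (m * (+ 2 * N * x)))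
            alg = solve-∀

          0≤Qv : 0ℤ ≤ Qv
          0≤Qv = 0≤+ {N} ✶ (0≤+ {N} ✶ (ℤP.≤-trans 0≤+ 1≤m ✶ (0≤+ {2} ✶ 0≤+ {N} ✶ 0≤β v)))

          -- A nonempty closed set contains an alive node whose row was tested and is nearly minimal
          -- among the closed sets containing that node. An empty one has the value of A.
          low : ∀ C → Closed n r C → A ⊆ C → m * m * (b₀ - F C) ≤ Qv
          low C cC A⊆C with ⊆-or-witness N (λ _ → false) C
          ... | inj₁ none = ℤP.≤-trans
                  (by (0≤T ✶ Δ (emptyish C A⊆C λ j l → ∌-from λ p → absurd (none j l p) refl))
                      (alg (m * m) (F C) b₀)) 0≤Qv
            where
            alg : ∀ T c b → T * (c - b) ≡ 0ℤ - T * (b - c)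
            alg = solve-∀
          ... | inj₂ (u , l , C∋u , _) =
                  by (Δ (near-minimal C cC C∋u) ⊹ 0≤T ✶ Δ tested ⊹ Δ (Q≤ u l u-alive))
                    (alg (m * m) (F C) b₀ (F (r u)) (Q u u-alive) Qv)
            where
            open Certified (cert u l (alive cC C∋u))
            alg : ∀ T c b x q p → q - T * (x - c) + T * (x - b) + (p - q) ≡ p - T * (b - c)
            alg = solve-∀

          -- The row of x is near `b₀` by its certificate, and `strict x` is not far below by `low`.
          -- The latter applies because `strict x` still contains A: an element of A equivalent to x
          -- would put x into `r v`.
          rise≤ : ∀ x → x ℕ.< N → r x ∌ n → r v ∌ x → m * m * rise x ≤ + 2 * Qv
          rise≤ x l x-alive fresh = pos-scaled {m * m} {F (r x) - F (strict x)} (0≤+ {2} ✶ 0≤Qv)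
            (by (Δ near-best ⊹ Δ (Q≤ x l u-alive) ⊹ Δ (low (strict x) strict-closed A⊆strict))
              (alg (m * m) (F (r x)) (F (strict x)) b₀ (Q x u-alive) Qv))
            where
            open Certified (cert x l x-alive)
            alg : ∀ T a s b q p → q - T * (a - b) + (p - q) + (p - T * (b - s)) ≡ + 2 * p - T * (a - s)
            alg = solve-∀
            strict-closed : Closed n r (strict x)
            strict-closed = closed
              (λ {i} {j} p h → let a , b = ∧-elim {r x i} p in
                ∧-intro (transitive a h) (cong not (∌-from λ q → absurd (transitive h q) (not-elim b))))
              (cong (_∧ not (r n x)) x-alive)
            A⊆strict : A ⊆ strict x
            A⊆strict j p = ∧-intro (A⊆ x j p) (cong not (∌-from λ q → absurd (transitive (A⊆ v j p) q) fresh))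

          E≤ : m * m * E v ≤ + N * (+ 2 * Qv)
          E≤ = subst₂ _≤_ (∑-* N (m * m) (weight (active v))) (∑-const N (+ 2 * Qv)) (∑-mono N each)
            where
            each : ∀ j → j ℕ.< N → m * m * weight (active v) j ≤ + 2 * Qv
            each j l with r j n in dead | r v j in seen
            ... | true  | _     = subst (_≤ + 2 * Qv) (sym (ℤP.*-zeroʳ (m * m))) (0≤+ {2} ✶ 0≤Qv)
            ... | false | true  = subst (_≤ + 2 * Qv) (sym (ℤP.*-zeroʳ (m * m))) (0≤+ {2} ✶ 0≤Qv)
            ... | false | false = rise≤ j l dead seen

          drop≤ : m * m * pos (F (r v) - F Full) ≤ Qv
          drop≤ = pos-scaled {m * m} 0≤Qv (Certified.near-minimal (cert v v<N v-alive) Full full-closed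
              (cong not v-alive))

          -- β - 1 is 2E plus the drop to `Full`, so m² (β - 1) is at most (4N + 1) Q. As Q = 2N³mβ
          -- has only one factor m, another one remains on the left.
          scale≤ : m * (βv - 1ℤ) ≤ (+ 4 * N′ + 1ℤ) * (+ 2 * (N′ * N′ * N′) * βv)
          scale≤ = cancel 1≤m (by (0≤+ {2} ✶ Δ E≤ ⊹ Δ drop≤)
            (alg m N′ (E v) (pos (F (r v) - F Full)) βv))
            where
            alg : ∀ m N e p b →
              + 2 * (N * (+ 2 * (N * (N * (m * (+ 2 * N * b))))) - m * m * e) + (N * (N * (m * (+ 2 * N * b)))
                  - m * m * p)
              ≡ m * ((+ 4 * N + 1ℤ) * (+ 2 * (N * N * N) * b)) - m * (m * (1ℤ + (e + e) + p - 1ℤ))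
            alg = solve-∀

          N⁴ : ℤ
          N⁴ = N′ * N′ * N′ * N′

          1≤N′ : 1ℤ ≤ N′
          1≤N′ = ℤ.+≤+ (s≤s z≤n)

          1≤N⁴ : 1ℤ ≤ N⁴
          1≤N⁴ = 1≤* {N′ * N′ * N′} (1≤* {N′ * N′} (1≤* {N′} 1≤N′ 1≤N′) 1≤N′) 1≤N′

          0≤N³ : 0ℤ ≤ N′ * N′ * N′
          0≤N³ = 0≤+ {N} ✶ 0≤+ {N} ✶ 0≤+ {N}

          -- For β ≥ 2 the right-hand side of `scale≤` is at most 10 N⁴ β ≤ 20 N⁴ (β - 1), half of
          -- what m ≥ 40 N⁴ gives on the left.
          β≤1 : βv ≤ 1ℤ
          β≤1 with ≤-or-1+≤ βv 1ℤ
          ... | inj₁ p   = p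
          ... | inj₂ 2≤β = ⊥-elim (1≰0 (ℤP.≤-trans (1≤* {N⁴} {βv - 1ℤ} 1≤N⁴ (by (Δ 2≤β) (alg₁ βv)))
              (cancel {+ 20} {N⁴ * (βv - 1ℤ)} {0ℤ} (ℤ.+≤+ (s≤s z≤n)) (by
                (Δ scale≤ ⊹ Δ large ✶ Δ (1≤β v) ⊹ 0≤+ {10} ✶ (0≤N³ ✶ 0≤+ {N}) ✶ Δ 2≤β
                  ⊹ 0≤+ {2} ✶ 0≤N³ ✶ 0≤β v ✶ Δ 1≤N′)
                (alg₂ m N′ βv)))))
            where
            alg₁ : ∀ b → b - (1ℤ + 1ℤ) ≡ b - 1ℤ - 1ℤ
            alg₁ = solve-∀
            alg₂ : ∀ m N b → (+ 4 * N + 1ℤ) * (+ 2 * (N * N * N) * b) - m * (b - 1ℤ)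
              + (m - + 40 * (N * N * N * N)) * (b - 1ℤ) + + 10 * (N * N * N * N) * (b - (1ℤ + 1ℤ))
              + + 2 * (N * N * N) * b * (N - 1ℤ) ≡ + 20 * 0ℤ - + 20 * (N * N * N * N * (b - 1ℤ))
            alg₂ = solve-∀

        stable′ : ∀ C → Closed n r C → A ⊆ C → b₀ ≤ F C
        stable′ C cC A⊆C with ≤-or-1+≤ b₀ (F C)
        ... | inj₁ p = p
        ... | inj₂ q = ⊥-elim (1≰0 (ℤP.≤-trans 1≤N⁴
            (cancel {+ 38} {N⁴} {0ℤ} (ℤ.+≤+ (s≤s z≤n)) (by
              (Δ m≤ ⊹ Δ large ⊹ 0≤+ {2} ✶ 0≤N³ ✶ Δ 1≤N′) (alg₂ m N′)))))
          where
          m≤ : m ≤ + 2 * (N′ * N′ * N′)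
          m≤ = cancel 1≤m (by (Δ (low C cC A⊆C) ⊹ 0≤T ✶ Δ q ⊹ 0≤+ {2} ✶ 0≤N³ ✶ (ℤP.≤-trans 0≤+ 1≤m) ✶ Δ β≤1)
            (alg₁ m N′ b₀ (F C) βv))
            where
            alg₁ : ∀ m N b c x → N * (N * (m * (+ 2 * N * x))) - m * m * (b - c) + m * m * (b - (c + 1ℤ))
              + + 2 * (N * N * N) * m * (1ℤ - x) ≡ m * (+ 2 * (N * N * N)) - m * m
            alg₁ = solve-∀
          alg₂ : ∀ m N → + 2 * (N * N * N) - m + (m - + 40 * (N * N * N * N)) + + 2 * (N * N * N) * (N - 1ℤ) ≡
                 + 38 * 0ℤ - + 38 * (N * N * N * N)
          alg₂ = solve-∀

      stable : ∀ C → Closed n r C → A ⊆ C → b₀ ≤ F C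
      stable C cC A⊆C with minimiser N Full (λ v → - β v)
      ... | inj₁ none = emptyish C A⊆C λ j l → ∌-from λ p → absurd (⊆-full cC j p) (none j l)
      ... | inj₂ (v , l , v∈ , least) = stable′ v l (not-elim v∈)
        (λ u l a → ℤP.neg-cancel-≤ (least u l (cong not a))) C cC A⊆C

  -- The program

  -- OUT, CUR: the best set above the threshold TH and its value; HAVE, HTH: whether these exist.
  -- REL: the relation r; CA, CB: multiplicities of required and forbidden elements; INA: the required set.
  -- SUM: the sum of the greedy bases so far; GAIN: the sum of BEST - FCL over them; NEG: the negative part of SUM.
  -- For the node u of a run: BASE, FCL: its closure and value; RISE, BETA: the scale; MK₀: nodes that are not free.
  -- Within a greedy base: POS: the order; MK, SET: the marked nodes and their closure; HT: the penalised value of SET.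
  pattern OUT  = 0
  pattern CUR  = 1
  pattern HAVE = 2
  pattern TH   = 3
  pattern HTH  = 4
  pattern REL  = 5
  pattern CA   = 6
  pattern CB   = 7
  pattern BEST = 8
  pattern SUM  = 9
  pattern GAIN = 10
  pattern BETA = 11
  pattern FCL  = 12
  pattern MK₀  = 13
  pattern MK   = 14
  pattern SET  = 15
  pattern BASE = 16
  pattern HT   = 17
  pattern HT′  = 18
  pattern VAL  = 19
  pattern POS  = 20
  pattern NEG  = 21
  pattern TAKE = 22
  pattern RISE = 23
  pattern INA  = 24
  pattern OK   = 25

  infixr 7 _∧′_
  infixr 6 _∨′_

  _∧′_ _∨′_ : ∀ {d} → Ex d → Ex d → Ex d
  a ∧′ b = ite a b (lit 0ℤ)
  a ∨′ b = ite a (lit 1ℤ) b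

  not′ pos′ : ∀ {d} → Ex d → Ex d
  not′ a = ite a (lit 0ℤ) (lit 1ℤ)
  pos′ a = ite (lit 0ℤ ≼ a) a (lit 0ℤ)

  eq′ : ∀ {d} → Atom d → Atom d → Ex d
  eq′ a b = (idx a ≼ idx b) ∧′ (idx b ≼ idx a)

  el : ∀ {d} → ℕ → Atom d → Ex d
  el x a = var x org a

  sc : ∀ {d} → ℕ → Ex d
  sc x = var x org org

  $0 : ∀ {d} → Atom (suc d)
  $0 = ctr Fin.zero
  $1 : ∀ {d} → Atom (suc (suc d))
  $1 = ctr (Fin.suc Fin.zero)
  $2 : ∀ {d} → Atom (suc (suc (suc d)))
  $2 = ctr (Fin.suc (Fin.suc Fin.zero))
  $3 : ∀ {d} → Atom (suc (suc (suc (suc d))))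
  $3 = ctr (Fin.suc (Fin.suc (Fin.suc Fin.zero)))

  -- Values not above the threshold are refused, so each pass moves on to the next distinct value.
  -- `BEST` ignores the threshold: the search needs the true minimum of the interval.
  test : ∀ {d} → Cmd d
  test = fill VAL (qry (el SET $0))
       ▸ fill BEST (ite (sc VAL ≼ sc BEST) (sc VAL) (sc BEST))
       ▸ fill TAKE ((not′ (sc HTH) ∨′ not′ (sc VAL ≼ sc TH)) ∧′ (not′ (sc HAVE) ∨′ not′ (sc CUR ≼ sc VAL)))
       ▸ fill OUT (ite (sc TAKE) (el SET $0) (el OUT $0))
       ▸ fill CUR (ite (sc TAKE) (sc VAL) (sc CUR))
       ▸ fill HAVE (ite (sc TAKE) (lit 1ℤ) (sc HAVE))

  -- $2 is the node handled in this step, $3 the position in the order of SUM that is due.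
  mark push step : ∀ {d} → Cmd (suc (suc d))
  mark = fill OK (not′ (el MK $2) ∧′ (el POS $2 ≼ idx $3))
       ▸ fill SET (el SET $0 ∨′ sc OK ∧′ var REL $2 $0)
       ▸ fill MK (el MK $0 ∨′ sc OK ∧′ eq′ $0 $2)
  push = fill HT′ (sc VAL ⊕ sum (ite (el SET $0 ∧′ not′ (el MK $0)) (sc BETA) (lit 0ℤ)))
       ▸ fill SUM (el SUM $0 ⊕ ite (eq′ $0 $2) (sc HT′ ⊖ sc HT) (lit 0ℤ))
       ▸ fill HT (sc HT′)
  step = mark ▸ test ▸ push

  -- Sorting without moving data: `POS` counts the strictly smaller entries of `SUM`, the outer loop
  -- runs through these ranks, and the inner one scans for nodes of the current rank. Ties share a
  -- rank.
  prepare credit greedy : ∀ {d} → Cmd d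
  prepare = fill POS (sum (ite (el SUM $1 ≼ el SUM $0) (lit 0ℤ) (lit 1ℤ)))
          ▸ fill MK (el MK₀ $0)
          ▸ fill SET (el BASE $0)
          ▸ fill HT (sc FCL)
  credit = fill GAIN (sc GAIN ⊕ (sc BEST ⊖ sc FCL))
  greedy = prepare ▸ for (for step) ▸ credit

  rep : ℕ → (∀ {d} → Cmd d) → ∀ {d} → Cmd d
  rep zero    c = c
  rep (suc k) c = for (rep k c)

  -- With N = n + 1 nodes, N ^ exponent exceeds 40 N⁴ as soon as n ≥ 1.
  opaque
    exponent : ℕ
    exponent = 10

    exponent-def : exponent ≡ 10
    exponent-def = refl

  -- There is no conditional command, so a run is executed for a dead `u` as well; it is then
  -- pointed at the required set, which keeps all tested sets inside the interval.
  choice select : ∀ {d} → Cmd (suc d)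
  choice = fill BASE (ite (var REL $2 top) (el INA $0) (var REL $2 $0))
         ▸ fill SET (el BASE $0)
  select = choice ▸ test

  setup arcs run : ∀ {d} → Cmd (suc d)
  setup = fill FCL (sc VAL)
        -- For a dead `u` everything is marked, so the greedy loops leave the set alone.
        ▸ fill MK₀ (var REL $2 top ∨′ var REL $0 top ∨′ var REL $2 $0)
        ▸ fill RISE (sum (ite (el MK₀ $0) (lit 0ℤ)
            (pos′ (qry (var REL $1 $0) ⊖ qry (var REL $1 $0 ∧′ not′ (var REL $0 $1))))))
        ▸ fill BETA (lit 1ℤ ⊕ (sc RISE ⊕ sc RISE) ⊕ pos′ (sc FCL ⊖ qry (not′ (var REL $0 top))))
        ▸ fill SUM (lit 0ℤ)
        ▸ fill GAIN (lit 0ℤ)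
  arcs = fill NEG (sum (ite (el SUM $0 ≼ lit 0ℤ) (el SUM $0) (lit 0ℤ)))
       -- A new pair from `u` to w is composed with the old relation on both sides, which restores
       -- transitivity at once.
       ▸ fill REL (var REL $1 $0 ∨′ var REL $1 $2 ∧′ sum (ite
           (((el SUM $0 ≼ lit 0ℤ) ∧′ not′ (sc NEG ⊖ el SUM $0 ≼ sc GAIN)) ∧′ var REL $0 $1) (lit 1ℤ)
               (lit 0ℤ)))
  run = select ▸ setup ▸ rep (exponent ℕ.+ exponent) greedy ▸ arcs

  -- The first loop of `round` brings `BEST` below the value of every alive row, before `BEST` is
  -- frozen as the common reference of all runs of the round.
  frontier initialise round solve : ∀ {d} → Cmd d
  frontier   = fill INA (el CA $0 ∧′ not′ (idx top ≼ idx $0))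
             ▸ fill REL (eq′ $1 $0 ∨′ el INA $0 ∨′ eq′ $0 top ∧′ el CB $1)
             ▸ fill SET (el INA $0)
             ▸ fill BEST (qry (el INA $0))
  initialise = frontier ▸ test
  round = for select ▸ for run
  solve = initialise ▸ for (for round)

  -- Counters: the elements required in and out of the set; the value n requires nothing.
  bump unbump : ∀ {d} → Cmd (suc (suc d))
  bump   = fill CA (el CA $0 ⊕ eq′ $0 $3) ▸ fill CB (el CB $0 ⊕ eq′ $0 $2)
  unbump = fill CA (el CA $0 ⊖ eq′ $0 $3) ▸ fill CB (el CB $0 ⊖ eq′ $0 $2)

  -- Here `k` enters the degree of the polynomial: 2k nested loops try all choices of k pairs.
  nest : ℕ → ∀ {d} → Cmd d
  nest zero    = solve
  nest (suc k) = for (for (bump ▸ nest k ▸ unbump))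

  pass : ℕ → Cmd 0
  pass k = fill HAVE (lit 0ℤ) ▸ nest k ▸ fill TH (sc CUR) ▸ fill HTH (lit 1ℤ)

  passes : ℕ → ℕ → Cmd 0
  passes k zero    = pass k
  passes k (suc j) = passes k j ▸ pass k

  -- What the basic commands compute

  nz-bit : ∀ b → nz (bit b) ≡ b
  nz-bit false = refl
  nz-bit true  = refl

  nz-∧ : ∀ a b → nz (if nz a then b else 0ℤ) ≡ nz a ∧ nz b
  nz-∧ a b with nz a
  ... | true  = refl
  ... | false = refl

  nz-∨ : ∀ a b → nz (if nz a then 1ℤ else b) ≡ nz a ∨ nz b
  nz-∨ a b with nz a
  ... | true  = refl
  ... | false = refl

  nz-not : ∀ a → nz (if nz a then 0ℤ else 1ℤ) ≡ not (nz a)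
  nz-not a with nz a
  ... | true  = refl
  ... | false = refl

  leq : ℤ → ℤ → Bool
  leq a b = does (a ℤ.≤? b)

  leq-true : ∀ {a b} → leq a b ≡ true → a ≤ b
  leq-true {a} {b} e with a ℤ.≤? b
  ... | yes p = p

  leq-false : ∀ {a b} → leq a b ≡ false → b < a
  leq-false {a} {b} e with a ℤ.≤? b
  ... | no h = ℤP.≰⇒> h

  ≤-leq : ∀ {a b} → a ≤ b → leq a b ≡ true
  ≤-leq {a} {b} = dec-true (a ℤ.≤? b)

  eq-single : ∀ j v → nz (if nz (bit (leq (+ j) (+ v))) then bit (leq (+ v) (+ j)) else 0ℤ) ≡ single v j
  eq-single j v = trans (nz-∧ (bit (leq (+ j) (+ v))) (bit (leq (+ v) (+ j))))
    (trans (cong₂ _∧_ (nz-bit (leq (+ j) (+ v))) (nz-bit (leq (+ v) (+ j))))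
      (⇔-≡ (λ e → let p , q = ∧-elim e in
              dec-true (j ℕ.≟ v) (ℕP.≤-antisym (ℤP.drop‿+≤+ (leq-true p)) (ℤP.drop‿+≤+ (leq-true q))))
           (λ e → let p = single-eq {v} {j} e in
              ∧-intro (≤-leq (ℤP.≤-reflexive (cong +_ p))) (≤-leq (ℤP.≤-reflexive (cong +_ (sym p)))))))

  least : ℤ → ℤ → ℤ
  least a b = if nz (bit (leq a b)) then a else b

  least≤ˡ : ∀ a b → least a b ≤ a
  least≤ˡ a b rewrite nz-bit (leq a b) with leq a b in e
  ... | true  = ℤP.≤-refl
  ... | false = ℤP.<⇒≤ (leq-false {a} {b} e)

  least≤ʳ : ∀ a b → least a b ≤ b
  least≤ʳ a b rewrite nz-bit (leq a b) with leq a b in e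
  ... | true  = leq-true {a} {b} e
  ... | false = ℤP.≤-refl

  least-sel : ∀ a b → least a b ≡ a ⊎ least a b ≡ b
  least-sel a b with nz (bit (leq a b))
  ... | true  = inj₁ refl
  ... | false = inj₂ refl

  row : St → ℕ → NodeSet
  row σ x j = nz (σ x 0 j)

  rel : St → Relation
  rel σ v j = nz (σ REL v j)

  scalar : St → ℕ → ℤ
  scalar σ x = σ x 0 0

  ∑-indicator : ∀ m X c → ∑ m (λ j → if X j then c else 0ℤ) ≡ c * count m X
  ∑-indicator m X c = trans (∑-cong m λ j _ → pt (X j)) (∑-* m c (λ j → bit (X j)))
    where
    pt : ∀ b → (if b then c else 0ℤ) ≡ c * bit b
    pt true  = sym (ℤP.*-identityʳ c)
    pt false = sym (ℤP.*-zeroʳ c)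

  module Specs (n : ℕ) (f : SetFunction n) where
    open Semantics n f public
    open Values n f

    -- An interface to `step`: the loop proofs use it for arbitrary states, so the command is
    -- evaluated in one place only.
    record StepSpec (i v : ℕ) (σ σ′ : St) : Set where
      ok : Bool
      ok = not (row σ MK v) ∧ leq (σ POS 0 v) (+ i)
      field
        REL≡ : σ′ REL ≡ σ REL
        BETA≡ : σ′ BETA ≡ σ BETA
        POS≡ : σ′ POS ≡ σ POS
        MK₀≡ : σ′ MK₀ ≡ σ MK₀
        BASE≡ : σ′ BASE ≡ σ BASE
        SET≡ : ∀ j → row σ′ SET j ≡ row σ SET j ∨ (ok ∧ rel σ v j)
        MK≡  : ∀ j → row σ′ MK j ≡ row σ MK j ∨ (ok ∧ single v j)
        HT≡  : scalar σ′ HT ≡ F (row σ′ SET) + scalar σ BETA * count (suc n) (row σ′ SET ∖ row σ′ MK)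
        SUM≡ : ∀ j → σ′ SUM 0 j ≡ σ SUM 0 j + (if single v j then scalar σ′ HT - scalar σ HT else 0ℤ)
        BEST≤ : scalar σ′ BEST ≤ scalar σ BEST
        BEST≤F : scalar σ′ BEST ≤ F (row σ′ SET)
        BEST-sel : scalar σ′ BEST ≡ F (row σ′ SET) ⊎ scalar σ′ BEST ≡ scalar σ BEST

    step-spec : ∀ {d} (ρ : Vec ℕ d) i v σ → StepSpec i v σ (⟪ step ⟫ (v ∷ i ∷ ρ) σ)
    step-spec ρ i v σ = record
      { REL≡ = refl
      ; BETA≡ = refl
      ; POS≡ = refl
      ; MK₀≡ = refl
      ; BASE≡ = refl
      ; SET≡ = λ j → trans (nz-∨ (σ SET 0 j) _) (cong (row σ SET j ∨_)
          (trans (nz-∧ okv (σ REL v j)) (cong (_∧ rel σ v j) ok≡)))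
      ; MK≡ = λ j → trans (nz-∨ (σ MK 0 j) _) (cong (row σ MK j ∨_)
          (trans (nz-∧ okv _) (cong₂ _∧_ ok≡ (eq-single j v))))
      ; HT≡ = cong (λ t → F (row σ′ SET) + t) (trans
          (∑-cong (suc n) λ j _ → cong (λ b → if b then scalar σ BETA else 0ℤ)
            (trans (nz-∧ (σ′ SET 0 j) _) (cong (row σ′ SET j ∧_) (nz-not (σ′ MK 0 j)))))
          (∑-indicator (suc n) (row σ′ SET ∖ row σ′ MK) (scalar σ BETA)))
      ; SUM≡ = λ j → cong (λ b → σ SUM 0 j + (if b then scalar σ′ HT - scalar σ HT else 0ℤ)) (eq-single j v)
      ; BEST≤ = least≤ʳ (F (row σ′ SET)) (scalar σ BEST)
      ; BEST≤F = least≤ˡ (F (row σ′ SET)) (scalar σ BEST)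
      ; BEST-sel = least-sel (F (row σ′ SET)) (scalar σ BEST)
      }
      where
      σ′ = ⟪ step ⟫ (v ∷ i ∷ ρ) σ
      okv : ℤ
      okv = if nz (if nz (σ MK 0 v) then 0ℤ else 1ℤ) then bit (leq (σ POS 0 v) (+ i)) else 0ℤ
      ok≡ : nz okv ≡ not (row σ MK v) ∧ leq (σ POS 0 v) (+ i)
      ok≡ = trans (nz-∧ (if nz (σ MK 0 v) then 0ℤ else 1ℤ) _)
        (cong₂ _∧_ (nz-not (σ MK 0 v)) (nz-bit (leq (σ POS 0 v) (+ i))))

  -- A syntactic check, so that the frame rule applies to concrete commands by computation.
  writes : ∀ {d} → ℕ → Cmd d → Bool
  writes x (fill y e) = does (x ℕ.≟ y)
  writes x (c ▸ c′)   = writes x c ∨ writes x c′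
  writes x (for c)    = writes x c

  module Frames (n : ℕ) (f : SetFunction n) where
    open Semantics n f

    frame : ∀ {d} x (c : Cmd d) → writes x c ≡ false → ∀ ρ σ → ⟪ c ⟫ ρ σ x ≡ σ x
    frame x (fill y e) h ρ σ rewrite h = refl
    frame x (c ▸ c′)   h ρ σ = trans (frame x c′ (proj₂ (∨-false {writes x c} h)) ρ _)
                                     (frame x c (proj₁ (∨-false h)) ρ σ)
    frame x (for c)    h ρ σ = repeat-inv (λ _ τ → τ x ≡ σ x) (λ {i} {τ} _ e → trans (frame x c h (i ∷ ρ) τ) e) refl

    -- The command and the states are explicit, so that the semantics of a concrete loop is never unfolded.
    for-inv : ∀ {d} (c : Cmd (suc d)) ρ σ (I : ℕ → St → Set) →
              (∀ {i τ} → i ℕ.≤ n → I i τ → I (suc i) (⟪ c ⟫ (i ∷ ρ) τ)) → I 0 σ → I (suc n) (⟪ for c ⟫ ρ σ)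
    for-inv c ρ σ I h z = repeat-inv I h z

  -- Correctness of the greedy loop

  module GreedyLoop {n : ℕ} (f : SetFunction n) (sub : Submodular f) (Rel : ℕ → ℕ → ℤ)
    (pre : Preorder (λ v j → nz (Rel v j))) (u : ℕ) (u-alive : nz (Rel u n) ≡ false)
    (m : ℤ) (1≤m : 1ℤ ≤ m) (b₀ : ℤ) where

    r : Relation
    r v j = nz (Rel v j)

    open Run f sub r pre u u-alive m 1≤m b₀
    open Marginals f sub r pre using (N; β)
    open Submodularity n f sub
    open Preorder pre
    open Specs n f
    open Frames n f

    -- `P` holds the ranks computed before the loops. The entries of unmarked nodes have not changed
    -- since, so `P` still orders these by `SUM`. Ranks below i are finished, and the scan for rank
    -- i has passed the nodes below v.
    record GInv (S₀ : ℕ → ℤ) (b : ℤ) (P : ℕ → ℕ → ℤ) (i v : ℕ) (σ : St) : Set where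
      field
        REL≡   : σ REL ≡ Rel
        BETA≡  : scalar σ BETA ≡ β u
        POS≡   : σ POS ≡ P
        inv    : Step.Inv S₀ (σ SUM 0) (row σ MK) (row σ SET) (scalar σ HT) (scalar σ BEST)
        order  : ∀ x y → x ℕ.< N → y ℕ.< N → row σ MK ∌ x → row σ MK ∌ y → P 0 x ≤ P 0 y → σ SUM 0 x ≤ σ SUM 0
            y
        due    : ∀ x → x ℕ.< N → P 0 x < + i → row σ MK ∋ x
        within : ∀ x → x ℕ.< v → P 0 x ≤ + i → row σ MK ∋ x
        BEST≤  : scalar σ BEST ≤ b

    ginv-step : ∀ {S₀ b P i v σ σ′} → v ℕ.< N → GInv S₀ b P i v σ → StepSpec i v σ σ′ → GInv S₀ b P i (suc v)
        σ′
    ginv-step {S₀} {b} {P} {i} {v} {σ} {σ′} v<N g s = by-ok (SS.ok) refl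
      where
      open GInv g
      module SS = StepSpec s
      S S′ : ℕ → ℤ
      S  = σ SUM 0
      S′ = σ′ SUM 0

      HT-canonical : scalar σ′ HT ≡ Step.h S₀ (row σ′ SET) (row σ′ MK)
      HT-canonical = trans SS.HT≡ (cong (λ t → F (row σ′ SET) + t * count N (row σ′ SET ∖ row σ′ MK)) BETA≡)

      mk⊆ : row σ MK ⊆ row σ′ MK
      mk⊆ x p = trans (SS.MK≡ x) (∨-left p)

      fresh : ∀ {x} → row σ′ MK ∌ x → row σ MK ∌ x
      fresh {x} q = ∌-from λ p → absurd (mk⊆ x p) q

      finish : Step.Inv S₀ S′ (row σ′ MK) (row σ′ SET) (scalar σ′ HT) (scalar σ′ BEST) →
               (∀ x → row σ′ MK ∌ x → S′ x ≡ S x) → (P 0 v ≤ + i → row σ′ MK ∋ v) → GInv S₀ b P i (suc v) σ′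
      finish inv′ same now = record
        { REL≡ = trans SS.REL≡ REL≡
        ; BETA≡ = trans (cong (λ t → t 0 0) SS.BETA≡) BETA≡
        ; POS≡ = trans SS.POS≡ POS≡
        ; inv = inv′
        ; order = λ x y lx ly mx my le → subst₂ _≤_ (sym (same x mx)) (sym (same y my))
            (order x y lx ly (fresh mx) (fresh my) le)
        ; due = λ x l p → mk⊆ x (due x l p)
        ; within = in-order
        ; BEST≤ = ℤP.≤-trans SS.BEST≤ BEST≤
        }
        where
        in-order : ∀ x → x ℕ.< suc v → P 0 x ≤ + i → row σ′ MK ∋ x
        in-order x l p with x ℕ.≟ v
        ... | yes refl = now p
        ... | no x≢v   = mk⊆ x (within x (ℕP.≤∧≢⇒< (ℕP.≤-pred l) x≢v) p)

      by-ok : ∀ b → SS.ok ≡ b → GInv S₀ _ P i (suc v) σ′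
      -- An idle step still recomputes the penalised value; since neither the set nor the marks
      -- changed, the increment is zero.
      by-ok false e = finish
        (Step.inv-cong S₀ inv S≡ mk≡ set≡ HT-canonical SS.BEST≤)
        (λ x _ → S≡ x)
        (λ p → trans (mk≡ v) (marked-or-late p))
        where
        mk≡ : row σ′ MK ≗′ row σ MK
        mk≡ j = trans (SS.MK≡ j) (trans (cong (λ t → row σ MK j ∨ (t ∧ single v j)) e) (∨-identityʳ _))
        set≡ : row σ′ SET ≗′ row σ SET
        set≡ j = trans (SS.SET≡ j) (trans (cong (λ t → row σ SET j ∨ (t ∧ rel σ v j)) e) (∨-identityʳ _))
        HT≡HT : scalar σ′ HT ≡ scalar σ HT
        HT≡HT = trans HT-canonical (trans (Step.h-cong S₀ set≡ mk≡) (sym (Step.Inv.H-def inv)))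
        S≡ : ∀ j → S′ j ≡ S j
        S≡ j = trans (SS.SUM≡ j) (trans (cong (λ t → S j + t) (vanish (single v j))) (ℤP.+-identityʳ (S j)))
          where
          vanish : ∀ c → (if c then scalar σ′ HT - scalar σ HT else 0ℤ) ≡ 0ℤ
          vanish true  = ℤP.i≡j⇒i-j≡0 HT≡HT
          vanish false = refl
        marked-or-late : P 0 v ≤ + i → row σ MK ∋ v
        marked-or-late p = decide (row σ MK v) refl
          where
          decide : ∀ c → row σ MK v ≡ c → row σ MK ∋ v
          decide true  q = q
          decide false q = absurd {b = SS.ok}
            (trans (cong₂ (λ a t → not a ∧ leq (t 0 v) (+ i)) q POS≡) (≤-leq p)) e
      by-ok true e = finish
        (Step.inv-cong S₀ (Step.inv-step S₀ inv v<N unmarked least′ SS.BEST≤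
            (subst (scalar σ′ BEST ≤_) (F-cong λ j _ → set≡ j) SS.BEST≤F) S′v S′j)
          (λ _ → refl) mk≡ set≡ HT-canonical ℤP.≤-refl)
        (λ x q → S′j x λ { refl → absurd (trans (mk≡ v) (∨-right {row σ MK v} (single-self v))) q })
        (λ _ → trans (mk≡ v) (∨-right {row σ MK v} (single-self v)))
        where
        unmarked : row σ MK ∌ v
        unmarked = not-elim (proj₁ (∧-elim {not (row σ MK v)} e))
        ripe : P 0 v ≤ + i
        ripe = subst (λ t → t 0 v ≤ + i) POS≡ (leq-true (proj₂ (∧-elim {not (row σ MK v)} e)))
        -- An unmarked j has rank at least i, as smaller ranks are finished, while v has rank at
        -- most i.
        least′ : ∀ j → j ℕ.< N → row σ MK ∌ j → S v ≤ S j
        least′ j l q with P 0 j ℤ.<? + i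
        ... | yes p = absurd (due j l p) q
        ... | no h  = order v j v<N l unmarked q (ℤP.≤-trans ripe (ℤP.≮⇒≥ h))
        mk≡ : row σ′ MK ≗′ (row σ MK ∪ single v)
        mk≡ j = trans (SS.MK≡ j) (cong (λ t → row σ MK j ∨ (t ∧ single v j)) e)
        set≡ : row σ′ SET ≗′ (row σ SET ∪ r v)
        set≡ j = trans (SS.SET≡ j) (cong₂ (λ t R → row σ SET j ∨ (t ∧ nz (R v j))) e REL≡)
        S′v : S′ v ≡ S v + (Step.h S₀ (row σ SET ∪ r v) (row σ MK ∪ single v) - scalar σ HT)
        S′v = trans (SS.SUM≡ v) (cong (λ t → S v + t) (trans (if-true (single-self v))
          (cong (λ t → t - scalar σ HT) (trans HT-canonical (Step.h-cong S₀ set≡ mk≡)))))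
        S′j : ∀ j → j ≢ v → S′ j ≡ S j
        S′j j j≢v = trans (SS.SUM≡ j) (trans (cong (λ t → S j + t) (if-false (dec-false (j ℕ.≟ v) j≢v)))
            (ℤP.+-identityʳ (S j)))

    record Ready (σ : St) : Set where
      field
        REL≡  : σ REL ≡ Rel
        BETA≡ : scalar σ BETA ≡ β u
        FCL≡  : scalar σ FCL ≡ fcl
        MK₀≡  : row σ MK₀ ≗′ mk₀
        BASE≡ : row σ BASE ≗′ r u

    position : (ℕ → ℤ) → ℕ → ℤ
    position S x = ∑ N (λ v → if nz (bit (leq (S x) (S v))) then 0ℤ else 1ℤ)

    position-count : ∀ S x → position S x ≡ count N (λ v → not (leq (S x) (S v)))
    position-count S x = ∑-cong N λ v _ → pt (leq (S x) (S v))
      where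
      pt : ∀ b → (if nz (bit b) then 0ℤ else 1ℤ) ≡ bit (not b)
      pt true  = refl
      pt false = refl

    -- If S y < S x, then every entry counted for y is counted for x, and y itself is counted for x
    -- only.
    position-mono : ∀ S x y → y ℕ.< N → position S x ≤ position S y → S x ≤ S y
    position-mono S x y y<N le with ≤-or-≥ (S x) (S y)
    ... | inj₁ p = p
    ... | inj₂ p with S x ℤP.≤? S y
    ...   | yes q = q
    ...   | no h  = ⊥-elim (ℤP.<-irrefl refl (ℤP.<-≤-trans (ℤP.suc[i]≤j⇒i<j
              (count-strict N {λ v → not (leq (S y) (S v))} {λ v → not (leq (S x) (S v))} y<N sub⊆
                (cong not (≤-leq (ℤP.≤-refl {S y}))) (cong not (∌-from λ e → h (leq-true {S x} {S y} e)))))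
              (subst₂ _≤_ (position-count S x) (position-count S y) le)))
      where
      sub⊆ : (λ v → not (leq (S y) (S v))) ⊆ (λ v → not (leq (S x) (S v)))
      sub⊆ v q = cong not (∌-from λ e → absurd (≤-leq (ℤP.≤-trans p (leq-true {S x} {S v} e))) (not-elim q))

    position<N : ∀ S x → x ℕ.< N → position S x < + N
    position<N S x x<N = ℤP.suc[i]≤j⇒i<j (subst (λ t → 1ℤ + t ≤ + N) (sym (position-count S x))
      (ℤP.≤-trans (count-strict N {λ v → not (leq (S x) (S v))} {λ _ → true} x<N (λ _ _ → refl)
        (cong not (≤-leq (ℤP.≤-refl {S x}))) refl) (count≤ N (λ _ → true))))

    ginv-start : ∀ {d} (ρ : Vec ℕ d) {t σ} → Ready σ → RunInv t (σ SUM 0) (scalar σ GAIN) (scalar σ BEST) →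
      GInv (σ SUM 0) (scalar σ BEST) (⟪ prepare ⟫ ρ σ POS) 0 0 (⟪ prepare ⟫ ρ σ)
    ginv-start ρ {t} {σ} rd ri = record
      { REL≡ = REL≡
      ; BETA≡ = BETA≡
      ; POS≡ = refl
      ; inv = Step.inv-cong S₀ (Step.inv-start S₀ refl (RunInv.b≤fcl ri)) (λ _ → refl) MK₀≡ BASE≡
          (trans FCL≡ (trans (Step.Inv.H-def (Step.inv-start S₀ refl (RunInv.b≤fcl ri)))
              (sym (Step.h-cong S₀ BASE≡ MK₀≡)))) ℤP.≤-refl
      ; order = λ x y _ ly _ _ le → position-mono S₀ x y ly le
      ; due = λ x _ p → ⊥-elim (ℤP.<⇒≱ p (subst (0ℤ ≤_) (sym (position-count S₀ x)) (count-nonneg N λ v →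
          not (leq (S₀ x) (S₀ v)))))
      ; within = λ _ ()
      ; BEST≤ = ℤP.≤-refl
      }
      where
      open Ready rd
      S₀ = σ SUM 0

    greedy-ready : ∀ {d} (ρ : Vec ℕ d) {σ} → Ready σ → Ready (⟪ greedy ⟫ ρ σ)
    greedy-ready ρ {σ} rd = record
      { REL≡ = trans (frame REL greedy refl ρ σ) REL≡
      ; BETA≡ = trans (cong (λ t → t 0 0) (frame BETA greedy refl ρ σ)) BETA≡
      ; FCL≡ = trans (cong (λ t → t 0 0) (frame FCL greedy refl ρ σ)) FCL≡
      ; MK₀≡ = λ j → trans (cong (λ t → nz (t 0 j)) (frame MK₀ greedy refl ρ σ)) (MK₀≡ j)
      ; BASE≡ = λ j → trans (cong (λ t → nz (t 0 j)) (frame BASE greedy refl ρ σ)) (BASE≡ j)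
      }
      where open Ready rd

    greedy-run : ∀ {d} (ρ : Vec ℕ d) {t σ} → Ready σ → RunInv t (σ SUM 0) (scalar σ GAIN) (scalar σ BEST) →
      let σ′ = ⟪ greedy ⟫ ρ σ in RunInv (suc t) (σ′ SUM 0) (scalar σ′ GAIN) (scalar σ′ BEST)
    greedy-run ρ {t} {σ} rd ri =
      subst (λ G → RunInv (suc t) (σ₂ SUM 0) G (scalar σ₂ BEST))
        (cong₂ (λ g c → g 0 0 + (scalar σ₂ BEST - c)) (sym GAIN≡) (sym FCL≡))
        (run-step ri (GInv.BEST≤ final) (GInv.inv final) marked)
      where
      σ₁ = ⟪ prepare ⟫ ρ σ
      σ₂ = ⟪ for (for step) ⟫ ρ σ₁
      P = σ₁ POS
      GAIN≡ : σ₂ GAIN ≡ σ GAIN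
      GAIN≡ = frame GAIN (for (for (step {_}))) refl ρ σ₁
      FCL≡ : scalar σ₂ FCL ≡ fcl
      FCL≡ = trans (cong (λ t → t 0 0) (frame FCL (for (for (step {_}))) refl ρ σ₁)) (Ready.FCL≡ rd)
      outer : ∀ {i τ} → i ℕ.≤ n → GInv (σ SUM 0) (scalar σ BEST) P i 0 τ →
              GInv (σ SUM 0) (scalar σ BEST) P (suc i) 0 (⟪ for step ⟫ (i ∷ ρ) τ)
      outer {i} {τ} _ g = record
        { GInv inner
        ; due = λ x l p → GInv.within inner x l (by (Δ (ℤP.i<j⇒suc[i]≤j p)) (alg (P 0 x) (+ i)))
        ; within = λ _ ()
        }
        where
        alg : ∀ p i → 1ℤ + i - (1ℤ + p) ≡ i - p
        alg = solve-∀
        inner = for-inv step (i ∷ ρ) τ (λ v τ → GInv (σ SUM 0) (scalar σ BEST) P i v τ)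
          (λ {v} {τ} l g → ginv-step (s≤s l) g (step-spec ρ i v τ)) g
      final : GInv (σ SUM 0) (scalar σ BEST) P N 0 σ₂
      final = for-inv (for step) ρ σ₁ (λ i τ → GInv (σ SUM 0) (scalar σ BEST) P i 0 τ) outer
          (ginv-start ρ rd ri)
      marked : ∀ j → j ℕ.< N → row σ₂ MK ∋ j
      marked j l = GInv.due final j l (position<N (σ SUM 0) j l)

    rep-run : ∀ k {d} (ρ : Vec ℕ d) {t σ} → Ready σ → RunInv t (σ SUM 0) (scalar σ GAIN) (scalar σ BEST) →
      let σ′ = ⟪ rep k greedy ⟫ ρ σ in
      Ready σ′ × RunInv (N ℕ.^ k ℕ.+ t) (σ′ SUM 0) (scalar σ′ GAIN) (scalar σ′ BEST)
    rep-run zero    ρ rd ri = greedy-ready ρ rd , greedy-run ρ rd ri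
    rep-run (suc k) ρ {t} {σ} rd ri =
      for-inv (rep k greedy) ρ σ (λ i τ → Ready τ × RunInv (i ℕ.* N ℕ.^ k ℕ.+ t) (τ SUM 0) (scalar τ GAIN)
          (scalar τ BEST))
        (λ {i} {τ} _ (rd , ri) → proj₁ (rep-run k (i ∷ ρ) rd ri) , shift i (⟪ rep k greedy ⟫ (i ∷ ρ) τ) (proj₂ (rep-run k (i ∷ ρ) rd ri)))
        (rd , ri)
      where
      shift : ∀ i τ → RunInv (N ℕ.^ k ℕ.+ (i ℕ.* N ℕ.^ k ℕ.+ t)) (τ SUM 0) (scalar τ GAIN) (scalar τ BEST) →
              RunInv (suc i ℕ.* N ℕ.^ k ℕ.+ t) (τ SUM 0) (scalar τ GAIN) (scalar τ BEST)
      shift i τ = subst (λ q → RunInv q (τ SUM 0) (scalar τ GAIN) (scalar τ BEST))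
          (sym (ℕP.+-assoc (N ℕ.^ k) (i ℕ.* N ℕ.^ k) t))

  nz-take : ∀ h q t v c →
    nz (if nz (if nz (if nz h then 0ℤ else 1ℤ) then 1ℤ else (if nz (bit (leq q t)) then 0ℤ else 1ℤ))
        then (if nz (if nz v then 0ℤ else 1ℤ) then 1ℤ else (if nz (bit (leq c q)) then 0ℤ else 1ℤ)) else 0ℤ)
    ≡ (not (nz h) ∨ not (leq q t)) ∧ (not (nz v) ∨ not (leq c q))
  nz-take h q t v c = trans (nz-∧ (if nz h′ then 1ℤ else t′) (if nz v′ then 1ℤ else c′)) (cong₂ _∧_
    (trans (nz-∨ h′ t′) (cong₂ _∨_ (nz-not h) (trans (nz-not (bit (leq q t))) (cong not (nz-bit (leq q t))))))
    (trans (nz-∨ v′ c′) (cong₂ _∨_ (nz-not v) (trans (nz-not (bit (leq c q)))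
        (cong not (nz-bit (leq c q)))))))
    where
    h′ t′ v′ c′ : ℤ
    h′ = if nz h then 0ℤ else 1ℤ
    t′ = if nz (bit (leq q t)) then 0ℤ else 1ℤ
    v′ = if nz v then 0ℤ else 1ℤ
    c′ = if nz (bit (leq c q)) then 0ℤ else 1ℤ

  refused : ∀ a b c d → (not a ∨ not b) ∧ (not c ∨ not d) ≡ false → (a ≡ true × b ≡ true) ⊎
      (c ≡ true × d ≡ true)
  refused true  true  c    d    e = inj₁ (refl , refl)
  refused true  false true true e = inj₂ (refl , refl)
  refused false b     true true e = inj₂ (refl , refl)

  -- Recording the output

  module Recording (n : ℕ) (f : SetFunction n) where
    open Semantics n f
    open Values n f
    open Frames n f

    on : St → ℕ → Set
    on σ x = nz (scalar σ x) ≡ true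

    -- The output is the least value found so far above the threshold.
    Genuine : St → Set
    Genuine σ = on σ HAVE → scalar σ CUR ≡ F (row σ OUT) × (on σ HTH → scalar σ TH < scalar σ CUR)

    Covers : ℤ → St → Set
    Covers z σ = on σ HAVE × scalar σ CUR ≤ z

    Recorded : St → Set
    Recorded σ = (on σ HTH × scalar σ BEST ≤ scalar σ TH) ⊎ Covers (scalar σ BEST) σ

    -- What the search may do to the recorded output. The relation is transitive, so it is checked
    -- piece by piece; only the ends of a pass change the threshold.
    record _⊑_ (σ σ′ : St) : Set where
      field
        TH≡     : σ′ TH ≡ σ TH
        HTH≡    : σ′ HTH ≡ σ HTH
        genuine : Genuine σ → Genuine σ′
        covers  : ∀ {z} → Covers z σ → Covers z σ′

    record _⊑ᵇ_ (σ σ′ : St) : Set where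
      field
        base     : σ ⊑ σ′
        BEST≤    : scalar σ′ BEST ≤ scalar σ BEST
        recorded : Recorded σ → Recorded σ′
      open _⊑_ base public

    ⊑-trans : ∀ {σ τ υ} → σ ⊑ τ → τ ⊑ υ → σ ⊑ υ
    ⊑-trans p q = record
      { TH≡ = trans (_⊑_.TH≡ q) (_⊑_.TH≡ p)
      ; HTH≡ = trans (_⊑_.HTH≡ q) (_⊑_.HTH≡ p)
      ; genuine = λ g → _⊑_.genuine q (_⊑_.genuine p g)
      ; covers = λ c → _⊑_.covers q (_⊑_.covers p c)
      }

    ⊑ᵇ-trans : ∀ {σ τ υ} → σ ⊑ᵇ τ → τ ⊑ᵇ υ → σ ⊑ᵇ υ
    ⊑ᵇ-trans p q = record
      { base = ⊑-trans (_⊑ᵇ_.base p) (_⊑ᵇ_.base q)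
      ; BEST≤ = ℤP.≤-trans (_⊑ᵇ_.BEST≤ q) (_⊑ᵇ_.BEST≤ p)
      ; recorded = λ r → _⊑ᵇ_.recorded q (_⊑ᵇ_.recorded p r)
      }

    ⊑-quiet : ∀ {σ σ′} → σ′ TH ≡ σ TH → σ′ HTH ≡ σ HTH → σ′ HAVE ≡ σ HAVE → σ′ CUR ≡ σ CUR → σ′ OUT ≡ σ OUT →
        σ ⊑ σ′
    ⊑-quiet t h v c o = record
      { TH≡ = t
      ; HTH≡ = h
      ; genuine = λ g e → subst₂ (λ c o → c 0 0 ≡ F (λ j → nz (o 0 j))) (sym c) (sym o)
            (proj₁ (g (trans (cong (λ t → nz (t 0 0)) (sym v)) e)))
          , λ e′ → subst₂ (λ t c → t 0 0 < c 0 0) (sym t) (sym c)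
            (proj₂ (g (trans (cong (λ t → nz (t 0 0)) (sym v)) e)) (trans (cong (λ t → nz (t 0 0)) (sym h))
                e′))
      ; covers = λ {z} (a , b) → trans (cong (λ t → nz (t 0 0)) v) a , subst (λ c → c 0 0 ≤ z) (sym c) b
      }

    ⊑ᵇ-quiet : ∀ {σ σ′} → σ′ TH ≡ σ TH → σ′ HTH ≡ σ HTH → σ′ HAVE ≡ σ HAVE → σ′ CUR ≡ σ CUR → σ′ OUT ≡ σ OUT →
               σ′ BEST ≡ σ BEST → σ ⊑ᵇ σ′
    ⊑ᵇ-quiet {σ} {σ′} t h v c o b = record
      { base = quiet
      ; BEST≤ = ℤP.≤-reflexive (cong (λ t → t 0 0) b)
      ; recorded = λ
          { (inj₁ (a , l)) → inj₁ (trans (cong (λ t → nz (t 0 0)) h) a , subst₂ (λ b t → b 0 0 ≤ t 0 0)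
              (sym b) (sym t) l)
          ; (inj₂ c) → inj₂ (subst (λ b → Covers (b 0 0) σ′) (sym b) (_⊑_.covers quiet c)) }
      }
      where
      quiet : σ ⊑ σ′
      quiet = ⊑-quiet t h v c o

    quiet-command : ∀ {d} (c : Cmd d) → writes TH c ≡ false → writes HTH c ≡ false → writes HAVE c ≡ false →
      writes CUR c ≡ false → writes OUT c ≡ false → writes BEST c ≡ false → ∀ ρ σ → σ ⊑ᵇ ⟪ c ⟫ ρ σ
    quiet-command c t h v u o b ρ σ =
      ⊑ᵇ-quiet (frame TH c t ρ σ) (frame HTH c h ρ σ) (frame HAVE c v ρ σ) (frame CUR c u ρ σ)
          (frame OUT c o ρ σ) (frame BEST c b ρ σ)

    module _ {d} (ρ : Vec ℕ d) (σ : St) where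
      private
        σ′ : St
        σ′ = ⟪ test ⟫ ρ σ
        q : ℤ
        q = F (row σ SET)
        taken : Bool
        taken = nz (scalar σ′ TAKE)

      test-take : taken ≡ (not (nz (scalar σ HTH)) ∨ not (leq q (scalar σ TH))) ∧
          (not (nz (scalar σ HAVE)) ∨ not (leq (scalar σ CUR) q))
      test-take = nz-take (scalar σ HTH) q (scalar σ TH) (scalar σ HAVE) (scalar σ CUR)

      private
        keep : taken ≡ false → Genuine σ → Genuine σ′
        keep e g h = trans (if-false e) (trans (proj₁ old)
            (sym (F-cong {row σ′ OUT} {row σ OUT} λ j _ → cong nz (if-false e))))
                   , λ t → subst (scalar σ TH <_) (sym (if-false e)) (proj₂ old t)
          where
          old = g (trans (cong nz (sym (if-false e))) h)

        replace : taken ≡ true → Genuine σ′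
        replace e h = trans (if-true e) (sym (F-cong {row σ′ OUT} {row σ SET} λ j _ → cong nz (if-true e)))
                    , λ t → subst (scalar σ TH <_) (sym (if-true e)) (above t)
          where
          first = proj₁ (∧-elim {not (nz (scalar σ HTH)) ∨ not (leq q (scalar σ TH))}
              (trans (sym test-take) e))
          above : on σ HTH → scalar σ TH < q
          above t = [ (λ p → absurd t (not-elim p)) , (λ p → leq-false {q} (not-elim p)) ]′
            (∨-elim {not (nz (scalar σ HTH))} first)

        covers′ : ∀ {z} → Covers z σ → Covers z σ′
        covers′ {z} (h , c) = by-case taken refl
          where
          by-case : ∀ b → taken ≡ b → Covers z σ′
          by-case false e = trans (cong nz (if-false e)) h , subst (_≤ z) (sym (if-false e)) c
          by-case true  e = cong nz (if-true e) , subst (_≤ z) (sym (if-true e)) (ℤP.≤-trans (ℤP.<⇒≤ below) c)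
            where
            below : q < scalar σ CUR
            below = [ (λ p → absurd h (not-elim p)) , (λ p → leq-false {scalar σ CUR} (not-elim p)) ]′
              (∨-elim {not (nz (scalar σ HAVE))}
                (proj₂ (∧-elim {not (nz (scalar σ HTH)) ∨ not (leq q (scalar σ TH))}
                    (trans (sym test-take) e))))

      test-⊑ : σ ⊑ σ′
      test-⊑ = record
        { TH≡ = refl
        ; HTH≡ = refl
        ; genuine = by-case taken refl
        ; covers = covers′
        }
        where
        by-case : ∀ b → taken ≡ b → Genuine σ → Genuine σ′
        by-case false e g = keep e g
        by-case true  e g = replace e

      test-value : (on σ HTH × q ≤ scalar σ TH) ⊎ Covers q σ′
      test-value = by-case taken refl
        where
        by-case : ∀ b → taken ≡ b → (on σ HTH × q ≤ scalar σ TH) ⊎ Covers q σ′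
        by-case true  e = inj₂ (cong nz (if-true e) , ℤP.≤-reflexive (if-true e))
        by-case false e = [ (λ (h , l) → inj₁ (h , leq-true l)) , (λ (h , l) →
            inj₂ (covers′ (h , leq-true {scalar σ CUR} l))) ]′
          (refused _ _ _ _ (trans (sym test-take) e))

      test-BEST : scalar σ′ BEST ≤ q × scalar σ′ BEST ≤ scalar σ BEST × (scalar σ′ BEST ≡ q ⊎ scalar σ′ BEST ≡
          scalar σ BEST)
      test-BEST = least≤ˡ q (scalar σ BEST) , least≤ʳ q (scalar σ BEST) , least-sel q (scalar σ BEST)

      -- The second alternative serves the start of a search, where `BEST` is set to the value of
      -- `SET` before that set has been tested.
      test-recorded : Recorded σ ⊎ scalar σ BEST ≡ q → Recorded σ′
      test-recorded old = [ new , (λ e → [ again e , new ∘′ trans e ]′ old) ]′ (proj₂ (proj₂ test-BEST))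
        where
        _∘′_ : ∀ {A B C : Set} → (B → C) → (A → B) → A → C
        (g ∘′ h) x = g (h x)
        new : scalar σ′ BEST ≡ q → Recorded σ′
        new e = [ (λ (h , l) → inj₁ (h , subst (_≤ scalar σ TH) (sym e) l)) ,
            (λ c → inj₂ (subst (λ z → Covers z σ′) (sym e) c)) ]′ test-value
        again : scalar σ′ BEST ≡ scalar σ BEST → Recorded σ → Recorded σ′
        again e (inj₁ (h , l)) = inj₁ (h , subst (_≤ scalar σ TH) (sym e) l)
        again e (inj₂ c)       = inj₂ (subst (λ z → Covers z σ′) (sym e) (covers′ c))

      test-⊑ᵇ : σ ⊑ᵇ σ′
      test-⊑ᵇ = record { base = test-⊑ ; BEST≤ = proj₁ (proj₂ test-BEST) ; recorded = λ r → test-recorded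
          (inj₁ r) }

    record Quiet {d} (c : Cmd d) : Set where
      constructor quietly
      field
        at : ∀ ρ σ → σ ⊑ᵇ ⟪ c ⟫ ρ σ
    open Quiet public

    infixr 4 _⊙_
    _⊙_ : ∀ {d} {c c′ : Cmd d} → Quiet c → Quiet c′ → Quiet (c ▸ c′)
    at (_⊙_ {c = c} p q) ρ σ = ⊑ᵇ-trans (at p ρ σ) (at q ρ (⟪ c ⟫ ρ σ))

    loop-quiet : ∀ {d} {c : Cmd (suc d)} → Quiet c → Quiet (for c)
    at (loop-quiet {c = c} p) ρ σ = repeat-inv (λ _ τ → σ ⊑ᵇ τ) (λ {i} {τ} _ q → ⊑ᵇ-trans q (at p (i ∷ ρ) τ))
      (⊑ᵇ-quiet refl refl refl refl refl refl)

    test-quiet : ∀ {d} → Quiet (test {d})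
    at test-quiet = test-⊑ᵇ

    isQuiet : ∀ {d} → Cmd d → Bool
    isQuiet c = not (writes TH c ∨ writes HTH c ∨ writes HAVE c ∨ writes CUR c ∨ writes OUT c ∨ writes BEST c)

    quiet : ∀ {d} (c : Cmd d) → isQuiet c ≡ true → Quiet c
    at (quiet c e) = quiet-command c (proj₁ e₁) (proj₁ e₂) (proj₁ e₃) (proj₁ e₄) (proj₁ e₅) (proj₂ e₅)
      where
      e₁ = ∨-false {writes TH c} (not-elim e)
      e₂ = ∨-false {writes HTH c} (proj₂ e₁)
      e₃ = ∨-false {writes HAVE c} (proj₂ e₂)
      e₄ = ∨-false {writes CUR c} (proj₂ e₃)
      e₅ = ∨-false {writes OUT c} (proj₂ e₄)

  ∑-strict : ∀ m v {g h} → v ℕ.< m → (∀ j → j ℕ.< m → g j ≤ h j) → 1ℤ + g v ≤ h v → 1ℤ + ∑ m g ≤ ∑ m h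
  ∑-strict (suc m) v {g} {h} l le s with v ℕ.≟ m
  ... | yes refl = by (Δ (∑-mono m λ j l → le j (ℕP.m≤n⇒m≤1+n l)) ⊹ Δ s) (alg (∑ m g) (∑ m h) (g m) (h m))
    where
    alg : ∀ a b c d → b - a + (d - (1ℤ + c)) ≡ b + d - (1ℤ + (a + c))
    alg = solve-∀
  ... | no v≢m = by (Δ (∑-strict m v (ℕP.≤∧≢⇒< (ℕP.≤-pred l) v≢m) (λ j l → le j (ℕP.m≤n⇒m≤1+n l)) s) ⊹
      Δ (le m ℕP.≤-refl))
      (alg (∑ m g) (∑ m h) (g m) (h m))
    where
    alg : ∀ a b c d → b - (1ℤ + a) + (d - c) ≡ b + d - (1ℤ + (a + c))
    alg = solve-∀

  nz-≢0 : ∀ {z} → z ≢ 0ℤ → nz z ≡ true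
  nz-≢0 {z} h = cong not (dec-false (z ℤ.≟ 0ℤ) h)

  nz-count : ∀ m X w → w ℕ.< m → X ∋ w → nz (count m X) ≡ true
  nz-count m X w l e = nz-≢0 λ z → 1≰0 (subst (1ℤ ≤_) z
    (subst (_≤ count m X) (cong bit e) (∑-term m w {λ j → bit (X j)} l λ j _ → 0≤bit (X j))))

  nz-count⁻¹ : ∀ m X → nz (count m X) ≡ true → ∃[ w ] w ℕ.< m × X ∋ w
  nz-count⁻¹ m X e with ⊆-or-witness m (λ _ → false) X
  ... | inj₁ none = absurd e (cong nz (∑-zero m λ j l → cong bit (∌-from λ p → absurd (none j l p) refl)))
  ... | inj₂ (w , l , p , _) = w , l , p

  clipped : ∀ s → (if nz (bit (leq s 0ℤ)) then s else 0ℤ) ≡ s ⊓ 0ℤ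
  clipped s with s ℤ.≤? 0ℤ
  ... | yes p = sym (ℤP.i≤j⇒i⊓j≡i p)
  ... | no h  = sym (ℤP.i≥j⇒i⊓j≡j (ℤP.<⇒≤ (ℤP.≰⇒> h)))

  -- The runs of a round end in relations that agree pointwise without being the same function; this
  -- moves their certificates to the relation at the start of the round.
  module Congruence {n : ℕ} (f : SetFunction n) (sub : Submodular f) (r s : Relation) (r≡s : ∀ v j → r v j ≡ s v j)
    (pr : Preorder r) (ps : Preorder s) where
    open Values n f
    module R = Marginals f sub r pr
    module S = Marginals f sub s ps

    rise-cong : ∀ v → R.rise v ≡ S.rise v
    rise-cong v = cong₂ (λ a b → pos (a - b)) (F-cong λ j _ → r≡s v j)
      (F-cong λ j _ → cong₂ (λ a b → a ∧ not b) (r≡s v j) (r≡s j v))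

    β-cong : ∀ u → R.β u ≡ S.β u
    β-cong u = cong₂ (λ e p → 1ℤ + (e + e) + pos p)
      (∑-cong (suc n) λ v _ → cong₂ (λ b x → if b then x else 0ℤ) (cong₂ (λ a b → not (a ∨ b)) (r≡s v n)
          (r≡s u v)) (rise-cong v))
      (cong₂ _-_ (F-cong λ j _ → r≡s u j) (F-cong λ j _ → cong not (r≡s j n)))

    closed-cong : ∀ {C} → Closed n s C → Closed n r C
    closed-cong cC = closed (λ {v} {j} p q → up cC p (trans (sym (r≡s v j)) q)) (proper cC)

    certified-cong : ∀ {m} (1≤m : 1ℤ ≤ m) {b₀ u} → Stable.Certified f sub r pr m 1≤m b₀ u → Stable.Certified f
        sub s ps m 1≤m b₀ u
    certified-cong {m} 1≤m {b₀} {u} c = record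
      { u-alive = trans (sym (r≡s u n)) u-alive
      ; tested = subst (b₀ ≤_) F-row tested
      ; near-best = subst₂ (λ x b → m * m * (x - b₀) ≤ Qof b) F-row (β-cong u) near-best
      ; near-minimal = λ C cC C∋u → subst₂ (λ x b → m * m * (x - F C) ≤ Qof b) F-row (β-cong u)
          (near-minimal C (closed-cong cC) C∋u)
      }
      where
      open Stable.Certified c
      F-row : F (r u) ≡ F (s u)
      F-row = F-cong λ j _ → r≡s u j
      Qof : ℤ → ℤ
      Qof b = + suc n * (+ suc n * (m * (+ 2 * + suc n * b)))

  -- Intervals and their minimisers

  module Intervals {n : ℕ} (f : SetFunction n) (A B : NodeSet) where
    open Values n f

    record In (Z : NodeSet) : Set where
      field
        required  : A ⊆ Z
        forbidden : ∀ j → B ∋ j → Z ∌ j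
        proper′   : Z ∌ n

    Minimal : NodeSet → Set
    Minimal Z = In Z × (∀ Y → In Y → F Z ≤ F Y)

    in-∪ : ∀ {X Y} → In X → In Y → In (X ∪ Y)
    in-∪ x y = record
      { required = λ j p → ∨-left (In.required x j p)
      ; forbidden = λ j p → cong₂ _∨_ (In.forbidden x j p) (In.forbidden y j p)
      ; proper′ = cong₂ _∨_ (In.proper′ x) (In.proper′ y)
      }

    in-cong : ∀ {X Y} → X ≗′ Y → In X → In Y
    in-cong e x = record
      { required = λ j p → trans (sym (e j)) (In.required x j p)
      ; forbidden = λ j p → trans (sym (e j)) (In.forbidden x j p)
      ; proper′ = trans (sym (e n)) (In.proper′ x)
      }

    -- When `r` may guide the search on an interval: alive rows belong to the interval, and no
    -- minimiser is lost by passing to closed sets.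
    record Admits (r : Relation) : Set where
      field
        ordered   : Preorder r
        A⊆row     : ∀ v → A ⊆ r v
        B-dead    : ∀ v → B ∋ v → r v ∋ n
        minimal   : ∀ Z → Minimal Z → Closed n r Z

      row-in : ∀ v → r v ∌ n → In (r v)
      row-in v a = record
        { required = A⊆row v
        ; forbidden = λ j b → ∌-from λ p → absurd (Preorder.transitive ordered p (B-dead j b)) a
        ; proper′ = a
        }

    Attained : ℤ → Set
    Attained b = ∃[ Z ] In Z × F Z ≡ b

    attained-≥ : ∀ {b} → Attained b → ∀ Z → Minimal Z → F Z ≤ b
    attained-≥ (Y , y , e) Z (_ , least) = subst (F Z ≤_) e (least Y y)

  module Searching {n : ℕ} (f : SetFunction n) (sub : Submodular f) (A B : NodeSet) where
    open Intervals f A B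
    open Submodularity n f sub
    open Specs n f
    open Frames n f
    open Recording n f

    N : ℕ
    N = suc n

    frame-rep : ∀ x (c : ∀ {d} → Cmd d) → (∀ {d} → writes x (c {d}) ≡ false) → ∀ k {d} (ρ : Vec ℕ d) σ →
        ⟪ rep k c ⟫ ρ σ x ≡ σ x
    frame-rep x c h zero    ρ σ = frame x c h ρ σ
    frame-rep x c h (suc k) ρ σ = for-inv (rep k c) ρ σ (λ _ τ → τ x ≡ σ x) (λ {i} {τ} _ e → trans (frame-rep x c h k (i ∷ ρ) τ) e) refl

    -- Every tested set stays in the interval, so `BEST` is a value attained there and cannot fall
    -- below the minimum; the soundness of new pairs depends on this.
    record Inside (Rel : ℕ → ℕ → ℤ) (τ : St) : Set where
      field
        REL≡     : τ REL ≡ Rel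
        set-in   : In (row τ SET)
        base-in  : In (row τ BASE)
        MK-dead  : ∀ v → nz (Rel v n) ≡ true → row τ MK ∋ v
        MK₀-dead : ∀ v → nz (Rel v n) ≡ true → row τ MK₀ ∋ v
        best-in  : Attained (scalar τ BEST)

    record Outside (Rel : ℕ → ℕ → ℤ) (τ : St) : Set where
      field
        REL≡     : τ REL ≡ Rel
        base-in  : In (row τ BASE)
        MK₀-dead : ∀ v → nz (Rel v n) ≡ true → row τ MK₀ ∋ v
        best-in  : Attained (scalar τ BEST)

    module _ {Rel : ℕ → ℕ → ℤ} (adm : Admits (λ v j → nz (Rel v j))) where
      open Admits adm

      inside-step : ∀ {i v σ σ′} → Inside Rel σ → StepSpec i v σ σ′ → Inside Rel σ′
      inside-step {i} {v} {σ} {σ′} g s = record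
        { REL≡ = trans SS.REL≡ REL≡
        ; set-in = set′
        ; base-in = in-cong (λ j → cong (λ t → nz (t 0 j)) (sym SS.BASE≡)) base-in
        ; MK-dead = λ x p → trans (SS.MK≡ x) (∨-left (MK-dead x p))
        ; MK₀-dead = λ x p → trans (cong (λ t → nz (t 0 x)) SS.MK₀≡) (MK₀-dead x p)
        ; best-in = [ (λ e → row σ′ SET , set′ , sym e) , (λ e → subst Attained (sym e) best-in) ]′
            SS.BEST-sel
        }
        where
        open Inside g
        module SS = StepSpec s
        set-by : ∀ b → SS.ok ≡ b → In (row σ′ SET)
        set-by false e = in-cong (λ j → sym (trans (SS.SET≡ j)
          (trans (cong (λ t → row σ SET j ∨ (t ∧ rel σ v j)) e) (∨-identityʳ _)))) set-in
        set-by true e = in-cong (λ j → sym (trans (SS.SET≡ j) (cong₂ (λ t R → row σ SET j ∨ (t ∧ nz (R v j)))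
            e REL≡)))
          (in-∪ set-in (row-in v (∌-from λ d → absurd (MK-dead v d)
              (not-elim (proj₁ (∧-elim {not (row σ MK v)} e))))))
        set′ : In (row σ′ SET)
        set′ = set-by SS.ok refl

      inside-greedy : ∀ {d} (ρ : Vec ℕ d) {σ} → Outside Rel σ → Outside Rel (⟪ greedy ⟫ ρ σ)
      inside-greedy ρ {σ} g = record { REL≡ = REL≡ ; base-in = base-in ; MK₀-dead = MK₀-dead ; best-in =
          best-in }
        where
        looped : Inside Rel (⟪ for (for step) ⟫ ρ (⟪ prepare ⟫ ρ σ))
        looped = for-inv (for step) ρ (⟪ prepare ⟫ ρ σ) (λ _ → Inside Rel)
          (λ {i} {τ} _ g → for-inv step (i ∷ ρ) τ (λ _ → Inside Rel) (λ {v} {τ} _ g → inside-step g (step-spec ρ i v τ)) g)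
          (record { Outside g ; set-in = Outside.base-in g ; MK-dead = Outside.MK₀-dead g })
        open Inside looped

      inside-rep : ∀ k {d} (ρ : Vec ℕ d) {σ} → Outside Rel σ → Outside Rel (⟪ rep k greedy ⟫ ρ σ)
      inside-rep zero    ρ g = inside-greedy ρ g
      inside-rep (suc k) ρ {σ} g = for-inv (rep k greedy) ρ σ (λ _ → Outside Rel) (λ {i} _ g → inside-rep k (i ∷ ρ) g) g

    step-quiet : ∀ {d} → Quiet (step {d})
    step-quiet = quiet mark refl ⊙ test-quiet ⊙ quiet push refl

    greedy-quiet : ∀ {d} → Quiet (greedy {d})
    greedy-quiet = quiet prepare refl ⊙ loop-quiet (loop-quiet step-quiet) ⊙ quiet credit refl

    rep-quiet : ∀ k {d} → Quiet (rep k greedy {d})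
    rep-quiet zero    = greedy-quiet
    rep-quiet (suc k) = loop-quiet (rep-quiet k)

    select-quiet : ∀ {d} → Quiet (select {d})
    select-quiet = quiet choice refl ⊙ test-quiet

    run-quiet : ∀ {d} → Quiet (run {d})
    run-quiet = select-quiet ⊙ quiet setup refl ⊙ rep-quiet (exponent ℕ.+ exponent) ⊙ quiet arcs refl

    round-quiet : ∀ {d} → Quiet (round {d})
    round-quiet = loop-quiet select-quiet ⊙ loop-quiet run-quiet

  nz-arc : ∀ l g x → nz (if nz (if nz (bit l) then (if nz (bit g) then 0ℤ else 1ℤ) else 0ℤ) then x else 0ℤ) ≡
           (l ∧ not g) ∧ nz x
  nz-arc false g     x = refl
  nz-arc true  false x = refl
  nz-arc true  true  x = refl

  -- One run for a node

  module Runs {n : ℕ} (f : SetFunction n) (sub : Submodular f) (A B : NodeSet) (A-in : Intervals.In f A B A) where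
    open Intervals f A B
    open Submodularity n f sub
    open Specs n f
    open Frames n f
    open Recording n f
    open Searching f sub A B

    record State (σ : St) : Set where
      field
        admits  : Admits (rel σ)
        INA≡    : row σ INA ≗′ A
        best-in : Attained (scalar σ BEST)
        best≤A  : scalar σ BEST ≤ F A

    base-alive : ∀ {d} (ρ : Vec ℕ d) u σ → rel σ u ∌ n → row (⟪ select ⟫ (u ∷ ρ) σ) BASE ≗′ rel σ u
    base-alive ρ u σ e j = cong nz (if-false e)

    base-dead : ∀ {d} (ρ : Vec ℕ d) u σ → rel σ u ∋ n → row (⟪ select ⟫ (u ∷ ρ) σ) BASE ≗′ row σ INA
    base-dead ρ u σ e j = cong nz (if-true e)

    module _ {d} (ρ : Vec ℕ d) (u : ℕ) {σ : St} (st : State σ) where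
      open State st

      selected-in : In (row (⟪ select ⟫ (u ∷ ρ) σ) BASE)
      selected-in = by-case (rel σ u n) refl
        where
        by-case : ∀ b → rel σ u n ≡ b → In (row (⟪ select ⟫ (u ∷ ρ) σ) BASE)
        by-case false e = in-cong (λ j → sym (base-alive ρ u σ e j)) (Admits.row-in admits u e)
        by-case true  e = in-cong (λ j → sym (trans (base-dead ρ u σ e j) (INA≡ j))) A-in

      select-state : State (⟪ select ⟫ (u ∷ ρ) σ)
      select-state = record
        { admits = admits
        ; INA≡ = INA≡
        ; best-in = [ (λ e → row (⟪ select ⟫ (u ∷ ρ) σ) BASE , selected-in , sym e) , (λ e → subst Attained
            (sym e) best-in) ]′
            (proj₂ (proj₂ (test-BEST (u ∷ ρ) (⟪ choice ⟫ (u ∷ ρ) σ))))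
        ; best≤A = ℤP.≤-trans (proj₁ (proj₂ (test-BEST (u ∷ ρ) (⟪ choice ⟫ (u ∷ ρ) σ)))) best≤A
        }

      select-tests : rel σ u ∌ n → scalar (⟪ select ⟫ (u ∷ ρ) σ) BEST ≤ F (rel σ u)
      select-tests e = subst (scalar (⟪ select ⟫ (u ∷ ρ) σ) BEST ≤_) (F-cong λ j _ → base-alive ρ u σ e j)
        (proj₁ (test-BEST (u ∷ ρ) (⟪ choice ⟫ (u ∷ ρ) σ)))

    arc : St → NodeSet
    arc σ w = leq (σ SUM 0 w) 0ℤ ∧ not (leq (∑ N (λ v → σ SUM 0 v ⊓ 0ℤ) - σ SUM 0 w) (scalar σ GAIN))

    arcs-spec : ∀ {d} (ρ : Vec ℕ d) u σ i j → rel (⟪ arcs ⟫ (u ∷ ρ) σ) i j ≡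
                rel σ i j ∨ (rel σ i u ∧ nz (count N (λ w → arc σ w ∧ rel σ w j)))
    arcs-spec ρ u σ i j = trans (nz-∨ (σ REL i j) _) (cong (rel σ i j ∨_) (trans (nz-∧ (σ REL i u) _)
      (cong (λ t → rel σ i u ∧ nz t) (∑-cong N λ w _ → cong bit (each w)))))
      where
      NEG≡ : scalar (⟪ arcs ⟫ (u ∷ ρ) σ) NEG ≡ ∑ N (λ v → σ SUM 0 v ⊓ 0ℤ)
      NEG≡ = ∑-cong N λ v _ → clipped (σ SUM 0 v)
      each : ∀ w → nz (if nz (if nz (bit (leq (σ SUM 0 w) 0ℤ)) then
                         (if nz (bit (leq (scalar (⟪ arcs ⟫ (u ∷ ρ) σ) NEG - σ SUM 0 w) (scalar σ GAIN))) then
                             0ℤ else 1ℤ) else 0ℤ)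
                       then σ REL w j else 0ℤ) ≡ arc σ w ∧ rel σ w j
      each w = trans (nz-arc (leq (σ SUM 0 w) 0ℤ) (leq (scalar (⟪ arcs ⟫ (u ∷ ρ) σ) NEG - σ SUM 0 w)
          (scalar σ GAIN)) (σ REL w j))
        (cong (λ t → (leq (σ SUM 0 w) 0ℤ ∧ not (leq (t - σ SUM 0 w) (scalar σ GAIN))) ∧ rel σ w j) NEG≡)

    record SetupSpec (u : ℕ) (σ σ′ : St) : Set where
      field
        REL≡   : σ′ REL ≡ σ REL
        INA≡   : σ′ INA ≡ σ INA
        BASE≡  : σ′ BASE ≡ σ BASE
        BEST≡  : σ′ BEST ≡ σ BEST
        FCL≡   : scalar σ′ FCL ≡ scalar σ VAL
        MK₀≡   : ∀ j → row σ′ MK₀ j ≡ rel σ u n ∨ (rel σ j n ∨ rel σ u j)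
        RISE≡  : scalar σ′ RISE ≡ ∑ N (λ v → if row σ′ MK₀ v then 0ℤ else
                   pos (F (rel σ v) - F (λ j → rel σ v j ∧ not (rel σ j v))))
        BETA≡  : scalar σ′ BETA ≡ 1ℤ + (scalar σ′ RISE + scalar σ′ RISE)
            + pos (scalar σ VAL - F (λ j → not (rel σ j n)))
        SUM≡   : ∀ j → σ′ SUM 0 j ≡ 0ℤ
        GAIN≡  : scalar σ′ GAIN ≡ 0ℤ

    setup-spec : ∀ {d} (ρ : Vec ℕ d) u σ → SetupSpec u σ (⟪ setup ⟫ (u ∷ ρ) σ)
    setup-spec ρ u σ = record
      { REL≡ = refl
      ; INA≡ = refl
      ; BASE≡ = refl
      ; BEST≡ = refl
      ; FCL≡ = refl
      ; MK₀≡ = λ j → trans (nz-∨ (σ REL u n) (if nz (σ REL j n) then 1ℤ else σ REL u j))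
          (cong (rel σ u n ∨_) (nz-∨ (σ REL j n) (σ REL u j)))
      ; RISE≡ = ∑-cong N λ v _ → cong (λ t → if row (⟪ setup ⟫ (u ∷ ρ) σ) MK₀ v then 0ℤ else pos
          (F (rel σ v) - t))
          (F-cong {λ j → nz (if nz (σ REL v j) then (if nz (σ REL j v) then 0ℤ else 1ℤ) else 0ℤ)} λ j _ →
            trans (nz-∧ (σ REL v j) (if nz (σ REL j v) then 0ℤ else 1ℤ))
                (cong (rel σ v j ∧_) (nz-not (σ REL j v))))
      ; BETA≡ = cong (λ t → 1ℤ + (scalar (⟪ setup ⟫ (u ∷ ρ) σ) RISE + scalar (⟪ setup ⟫ (u ∷ ρ) σ) RISE) + pos
          (scalar σ VAL - t))
          (F-cong {λ j → nz (if nz (σ REL j n) then 0ℤ else 1ℤ)} λ j _ → nz-not (σ REL j n))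
      ; SUM≡ = λ _ → refl
      ; GAIN≡ = refl
      }

    module Extension (r r′ : Relation) (u : ℕ) (arcTo : NodeSet)
      (r′≡ : ∀ i j → r′ i j ≡ r i j ∨ (r i u ∧ nz (count N (λ w → arcTo w ∧ r w j)))) where

      r⊆r′ : ∀ i → r i ⊆ r′ i
      r⊆r′ i j p = trans (r′≡ i j) (∨-left p)

      split : ∀ {i j} → r′ i ∋ j → r i ∋ j ⊎ (r i ∋ u × (∃[ w ] w ℕ.< N × arcTo ∋ w × r w ∋ j))
      split {i} {j} p with ∨-elim {r i j} (trans (sym (r′≡ i j)) p)
      ... | inj₁ q = inj₁ q
      ... | inj₂ q with ∧-elim {r i u} q
      ...   | iu , c with nz-count⁻¹ N (λ w → arcTo w ∧ r w j) c
      ...     | w , l , e = inj₂ (iu , w , l , ∧-elim {arcTo w} e)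

      join : ∀ {i j w} → r i ∋ u → w ℕ.< N → arcTo ∋ w → r w ∋ j → r′ i ∋ j
      join {i} {j} {w} iu l a wj = trans (r′≡ i j) (∨-right {r i j}
        (∧-intro iu (nz-count N (λ w → arcTo w ∧ r w j) w l (∧-intro a wj))))

      module _ (pre : Preorder r) where
        open Preorder pre

        extended : Preorder r′
        extended = record
          { reflexive = λ v → r⊆r′ v v (reflexive v)
          ; transitive = λ {v} {j} {k} p q → compose p (split p) (split q)
          }
          where
          compose : ∀ {v j k} → r′ v ∋ j → r v ∋ j ⊎ (r v ∋ u × (∃[ w ] w ℕ.< N × arcTo ∋ w × r w ∋ j)) →
                    r j ∋ k ⊎ (r j ∋ u × (∃[ w ] w ℕ.< N × arcTo ∋ w × r w ∋ k)) → r′ v ∋ k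
          compose {v} {j} {k} _ (inj₁ p) (inj₁ q) = r⊆r′ v k (transitive p q)
          compose _ (inj₁ p) (inj₂ (ju , w , l , a , wk)) = join (transitive p ju) l a wk
          compose _ (inj₂ (vu , w , l , a , wj)) (inj₁ q) = join vu l a (transitive wj q)
          -- Both new pairs leave `u`, so the first detour can be skipped.
          compose _ (inj₂ (vu , _)) (inj₂ (_ , w , l , a , wk)) = join vu l a wk

        -- Every new pair factors through `u`; if the row of `u` gains nothing, no row does.
        unchanged : (∀ w → w ℕ.< N → r′ u ∋ w → r u ∋ w) → ∀ i j → r′ i j ≡ r i j
        unchanged same i j = ⇔-≡ (λ p → back (split p)) (r⊆r′ i j)
          where
          back : r i ∋ j ⊎ (r i ∋ u × (∃[ w ] w ℕ.< N × arcTo ∋ w × r w ∋ j)) → r i ∋ j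
          back (inj₁ p) = p
          back (inj₂ (iu , w , l , a , wj)) =
            transitive iu (transitive (same w l (join (reflexive u) l a (reflexive w))) wj)

        no-arcs : (∀ w → w ℕ.< N → r′ u ∋ w → r u ∋ w) → ∀ w → w ℕ.< N → r u ∌ w → arcTo ∌ w
        no-arcs same w l e = ∌-from λ a → absurd (same w l (join (reflexive u) l a (reflexive w))) e

    pairs : Relation → ℤ
    pairs r = ∑ N (λ v → count N (r v))

    pairs-mono : ∀ {r s} → (∀ v → r v ⊆ s v) → pairs r ≤ pairs s
    pairs-mono h = ∑-mono N λ v _ → count-mono N (h v)

    pairs-strict : ∀ {r s u w} → (∀ v → r v ⊆ s v) → u ℕ.< N → w ℕ.< N → r u ∌ w → s u ∋ w → 1ℤ + pairs r ≤
        pairs s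
    pairs-strict {u = u} h u<N w<N a b = ∑-strict N u u<N (λ v _ → count-mono N (h v))
        (count-strict N w<N (h u) a b)

    m : ℤ
    m = + (N ℕ.^ exponent)

    1≤m : 1ℤ ≤ m
    1≤m = ℤ.+≤+ (ℕP.m^n>0 N exponent)

    total : + (N ℕ.^ (exponent ℕ.+ exponent) ℕ.+ 0) ≡ m * m
    total = trans (cong +_ (trans (ℕP.+-identityʳ _) (ℕP.^-distribˡ-+-* N exponent exponent)))
        (ℤP.pos-* (N ℕ.^ exponent) (N ℕ.^ exponent))

    -- The intermediate states of a run are kept abstract: unfolding them would be exponential.
    record SelectSpec (u : ℕ) (σ σ₁ : St) : Set where
      field
        REL₁     : σ₁ REL ≡ σ REL
        INA₁     : σ₁ INA ≡ σ INA
        base-in  : In (row σ₁ BASE)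
        base≗    : rel σ u ∌ n → row σ₁ BASE ≗′ rel σ u
        VAL₁     : scalar σ₁ VAL ≡ F (row σ₁ BASE)
        best-in₁ : Attained (scalar σ₁ BEST)
        tested₁  : rel σ u ∌ n → scalar σ₁ BEST ≤ F (rel σ u)
        BEST₁    : scalar σ₁ BEST ≤ scalar σ BEST

    select-spec : ∀ {d} (ρ : Vec ℕ d) u {σ} → State σ → SelectSpec u σ (⟪ select ⟫ (u ∷ ρ) σ)
    select-spec ρ u {σ} st = record
      { REL₁ = refl
      ; INA₁ = refl
      ; base-in = selected-in ρ u st
      ; base≗ = base-alive ρ u σ
      ; VAL₁ = refl
      ; best-in₁ = State.best-in (select-state ρ u st)
      ; tested₁ = select-tests ρ u st
      ; BEST₁ = proj₁ (proj₂ (test-BEST (u ∷ ρ) (⟪ choice ⟫ (u ∷ ρ) σ)))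
      }

    record LoopSpec (u : ℕ) (Rel : ℕ → ℕ → ℤ) (adm : Admits (λ v j → nz (Rel v j))) (σ₂ σ₃ : St) : Set where
      open Admits adm
      field
        outside₃ : Outside Rel σ₂ → Outside Rel σ₃
        INA₃     : σ₃ INA ≡ σ₂ INA
        BEST₃    : scalar σ₃ BEST ≤ scalar σ₂ BEST
        loop₃    : ∀ (a : nz (Rel u n) ≡ false) b₀ → GreedyLoop.Ready f sub Rel ordered u a m 1≤m b₀ σ₂ →
          Run.RunInv f sub (λ v j → nz (Rel v j)) ordered u a m 1≤m b₀ 0 (σ₂ SUM 0)
              (scalar σ₂ GAIN) (scalar σ₂ BEST) →
          Run.RunInv f sub (λ v j → nz (Rel v j)) ordered u a m 1≤m b₀ (N ℕ.^ (exponent ℕ.+ exponent) ℕ.+ 0)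
            (σ₃ SUM 0) (scalar σ₃ GAIN) (scalar σ₃ BEST)

    loop-spec : ∀ {d} (ρ : Vec ℕ d) u Rel adm σ → LoopSpec u Rel adm σ (⟪ rep (exponent ℕ.+ exponent) greedy ⟫
        (u ∷ ρ) σ)
    loop-spec ρ u Rel adm σ = record
      { outside₃ = inside-rep adm (exponent ℕ.+ exponent) (u ∷ ρ) {σ}
      ; INA₃ = frame-rep INA greedy refl (exponent ℕ.+ exponent) (u ∷ ρ) σ
      ; BEST₃ = _⊑ᵇ_.BEST≤ (at (rep-quiet (exponent ℕ.+ exponent)) (u ∷ ρ) σ)
      ; loop₃ = λ a b₀ rd ri → proj₂ (GreedyLoop.rep-run f sub Rel (Admits.ordered adm) u a m 1≤m b₀
          (exponent ℕ.+ exponent) (u ∷ ρ) {0} {σ} rd ri)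
      }

    record ArcsSpec (u : ℕ) (σ₃ σ₄ : St) : Set where
      field
        arcs₄    : ∀ i j → rel σ₄ i j ≡ rel σ₃ i j ∨ (rel σ₃ i u ∧ nz (count N (λ w → arc σ₃ w ∧ rel σ₃ w j)))
        INA₄     : σ₄ INA ≡ σ₃ INA
        BEST₄    : σ₄ BEST ≡ σ₃ BEST

    arcs-result : ∀ {d} (ρ : Vec ℕ d) u σ → ArcsSpec u σ (⟪ arcs ⟫ (u ∷ ρ) σ)
    arcs-result ρ u σ = record { arcs₄ = arcs-spec ρ u σ ; INA₄ = refl ; BEST₄ = refl }

    record Stages (u : ℕ) {σ : St} (st : State σ) (σ₄ : St) : Set where
      constructor stages
      field
        {σ₁ σ₂ σ₃} : St
        selected : SelectSpec u σ σ₁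
        setup₂   : SetupSpec u σ₁ σ₂
        looped   : LoopSpec u (σ REL) (State.admits st) σ₂ σ₃
        arcs′    : ArcsSpec u σ₃ σ₄
      open SelectSpec selected public
      open LoopSpec looped public
      open ArcsSpec arcs′ public

    run-stages : ∀ {d} (ρ : Vec ℕ d) u {σ} (st : State σ) → Stages u st (⟪ run ⟫ (u ∷ ρ) σ)
    run-stages ρ u {σ} st = stages (select-spec ρ u st) (setup-spec ρ u (⟪ select ⟫ (u ∷ ρ) σ))
      (loop-spec ρ u (σ REL) (State.admits st) (⟪ setup ⟫ (u ∷ ρ) (⟪ select ⟫ (u ∷ ρ) σ)))
      (arcs-result ρ u (⟪ rep (exponent ℕ.+ exponent) greedy ⟫ (u ∷ ρ)
          (⟪ setup ⟫ (u ∷ ρ) (⟪ select ⟫ (u ∷ ρ) σ))))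

    module RunFacts (u : ℕ) {σ : St} (st : State σ) {σ₄ : St} (stg : Stages u st σ₄) where
      open State st
      open Admits admits
      open Stages stg

      r : Relation
      r = rel σ

      module Setup = SetupSpec setup₂

      MK₀≡ : ∀ j → row σ₂ MK₀ j ≡ r u n ∨ (r j n ∨ r u j)
      MK₀≡ j = trans (Setup.MK₀≡ j) (cong (λ R → nz (R u n) ∨ (nz (R j n) ∨ nz (R u j))) REL₁)

      outside : Outside (σ REL) σ₃
      outside = outside₃ (record
        { REL≡ = trans Setup.REL≡ REL₁
        ; base-in = in-cong (λ j → cong (λ t → nz (t 0 j)) (sym Setup.BASE≡)) base-in
        ; MK₀-dead = λ v p → trans (MK₀≡ v) (∨-right {r u n} (∨-left p))
        ; best-in = subst (λ t → Attained (t 0 0)) (sym Setup.BEST≡) best-in₁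
        })

      REL₃ : σ₃ REL ≡ σ REL
      REL₃ = Outside.REL≡ outside

      r₄≡ : ∀ i j → rel σ₄ i j ≡ r i j ∨ (r i u ∧ nz (count N (λ w → arc σ₃ w ∧ r w j)))
      r₄≡ i j = trans (arcs₄ i j) (cong (λ R → nz (R i j) ∨
          (nz (R i u) ∧ nz (count N (λ w → arc σ₃ w ∧ nz (R w j))))) REL₃)

      open Extension r (rel σ₄) u (arc σ₃) r₄≡ public

      module Alive (alive-u : r u ∌ n) (b₀ : ℤ) (best≤b₀ : scalar σ BEST ≤ b₀) where

        open GreedyLoop f sub (σ REL) ordered u alive-u m 1≤m b₀ using (Ready)
        open Run f sub r ordered u alive-u m 1≤m b₀ using (RunInv; run-start; arc-sound; near-best; near-minimal)
        module Mg = Marginals f sub r ordered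

        MK₀≗ : ∀ j → row σ₂ MK₀ j ≡ r j n ∨ r u j
        MK₀≗ j = trans (MK₀≡ j) (cong (_∨ (r j n ∨ r u j)) alive-u)

        VAL≡ : scalar σ₁ VAL ≡ F (r u)
        VAL≡ = trans VAL₁ (F-cong λ j _ → base≗ alive-u j)

        RISE≡ : scalar σ₂ RISE ≡ Mg.E u
        RISE≡ = trans Setup.RISE≡ (trans (cong (λ R → ∑ N (λ v → if row σ₂ MK₀ v then 0ℤ else
            pos (F (λ j → nz (R v j)) - F (λ j → nz (R v j) ∧ not (nz (R j v)))))) REL₁) (∑-cong N λ v _ →
          trans (cong (λ b → if b then 0ℤ else Mg.rise v) (MK₀≗ v)) (flip (r v n ∨ r u v) (Mg.rise v))))
          where
          flip : ∀ b x → (if b then 0ℤ else x) ≡ (if not b then x else 0ℤ)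
          flip true  x = refl
          flip false x = refl

        ready : Ready σ₂
        ready = record
          { REL≡ = trans Setup.REL≡ REL₁
          ; BETA≡ = trans Setup.BETA≡ (trans (cong (λ R → 1ℤ + (scalar σ₂ RISE + scalar σ₂ RISE) +
              pos (scalar σ₁ VAL - F (λ j → not (nz (R j n))))) REL₁) (cong₂ (λ e p → 1ℤ + (e + e) + pos
                  (p - F Mg.Full)) RISE≡ VAL≡))
          ; FCL≡ = trans Setup.FCL≡ VAL≡
          ; MK₀≡ = MK₀≗
          ; BASE≡ = λ j → trans (cong (λ t → nz (t 0 j)) Setup.BASE≡) (base≗ alive-u j)
          }

        started : RunInv 0 (σ₂ SUM 0) (scalar σ₂ GAIN) (scalar σ₂ BEST)
        started = subst₂ (RunInv 0 (σ₂ SUM 0)) (sym Setup.GAIN≡) (cong (λ t → t 0 0) (sym Setup.BEST≡))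
          (run-start Setup.SUM≡ (ℤP.≤-trans BEST₁ best≤b₀) (tested₁ alive-u))

        finished : RunInv (N ℕ.^ (exponent ℕ.+ exponent) ℕ.+ 0) (σ₃ SUM 0) (scalar σ₃ GAIN) (scalar σ₃ BEST)
        finished = loop₃ alive-u b₀ ready started

        negative₃ : ℤ
        negative₃ = ∑ N (λ v → σ₃ SUM 0 v ⊓ 0ℤ)

        sound-arcs : ∀ Z → Minimal Z → Z ∋ u → ∀ w → w ℕ.< N → arc σ₃ w ≡ true → Z ∋ w
        sound-arcs Z min Z∋u w l a with Z w in e
        ... | true  = refl
        ... | false = absurd
          (≤-leq (arc-sound finished (minimal Z min) Z∋u (attained-≥ (Outside.best-in outside) Z min) w l e
              (leq-true (proj₁ a′))))
          (not-elim (proj₂ a′))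
          where
          a′ = ∧-elim {leq (σ₃ SUM 0 w) 0ℤ} a

        certified : b₀ ≤ F (r u) → (∀ w → w ℕ.< N → rel σ₄ u ∋ w → r u ∋ w) →
                    Stable.Certified f sub r ordered m 1≤m b₀ u
        certified tested same = record
          { u-alive = alive-u
          ; tested = tested
          ; near-best = near-best total finished quiet-arcs
          ; near-minimal = near-minimal total finished quiet-arcs
          }
          where
          quiet-arcs : ∀ w → w ℕ.< N → r u ∌ w → σ₃ SUM 0 w ≤ 0ℤ → negative₃ - σ₃ SUM 0 w ≤ scalar σ₃ GAIN
          quiet-arcs w l e s≤0 = decide _ refl
            where
            decide : ∀ b → leq (negative₃ - σ₃ SUM 0 w) (scalar σ₃ GAIN) ≡ b → negative₃ - σ₃ SUM 0 w ≤ scalar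
                σ₃ GAIN
            decide true  q = leq-true q
            decide false q = absurd (∧-intro (≤-leq s≤0) (cong not q)) (no-arcs ordered same w l e)

      best₄ : scalar σ₄ BEST ≤ scalar σ BEST
      best₄ = ℤP.≤-trans (ℤP.≤-reflexive (cong (λ t → t 0 0) BEST₄))
        (ℤP.≤-trans BEST₃ (ℤP.≤-trans (ℤP.≤-reflexive (cong (λ t → t 0 0) Setup.BEST≡)) BEST₁))

      run-state : State σ₄
      run-state = record
        { admits = record
            { ordered = extended ordered
            ; A⊆row = λ v j p → r⊆r′ v j (A⊆row v j p)
            ; B-dead = λ v p → r⊆r′ v n (B-dead v p)
            ; minimal = closed₄
            }
        ; INA≡ = λ j → trans (cong (λ t → nz (t 0 j)) (trans INA₄ (trans INA₃ (trans Setup.INA≡ INA₁))))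
            (INA≡ j)
        ; best-in = subst (λ t → Attained (t 0 0)) (sym BEST₄) (Outside.best-in outside)
        ; best≤A = ℤP.≤-trans best₄ best≤A
        }
        where
        closed₄ : ∀ Z → Minimal Z → Closed n (rel σ₄) Z
        closed₄ Z min = closed (λ p q → follow p (split q)) (proper cZ)
          where
          cZ : Closed n r Z
          cZ = minimal Z min
          follow : ∀ {v j} → Z ∋ v → r v ∋ j ⊎ (r v ∋ u × (∃[ w ] w ℕ.< N × arc σ₃ w ≡ true × r w ∋ j)) →
              Z ∋ j
          follow p (inj₁ q) = up cZ p q
          -- A pair through `u` matters only if Z contains `u`. Then `u` is alive and the run was
          -- genuine; whatever a run for a dead node records is harmless.
          follow p (inj₂ (vu , w , l , a , wj)) =
            up cZ (Alive.sound-arcs (alive cZ (up cZ p vu)) (scalar σ BEST) ℤP.≤-refl Z min (up cZ p vu) w l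
                a) wj

      outcome : ∀ b₀ → scalar σ BEST ≤ b₀ → u ℕ.< N → (r u ∌ n → b₀ ≤ F (r u)) →
        ((∀ v j → rel σ₄ v j ≡ r v j) × (r u ∌ n → Stable.Certified f sub r ordered m 1≤m b₀ u))
        ⊎ 1ℤ + pairs r ≤ pairs (rel σ₄)
      outcome b₀ le u<N tested =
        [ (λ same → inj₁ (unchanged ordered same , λ a → Alive.certified a b₀ le (tested a) same))
        , (λ (w , l , p , q) → inj₂ (pairs-strict r⊆r′ u<N l q p)) ]′ (⊆-or-witness N (r u) (rel σ₄ u))

    record RunResult (u : ℕ) {σ : St} (st : State σ) (σ′ : St) : Set where
      field
        state    : State σ′
        BEST≤    : scalar σ′ BEST ≤ scalar σ BEST
        pairs≤   : pairs (rel σ) ≤ pairs (rel σ′)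
        outcome  : ∀ b₀ → scalar σ BEST ≤ b₀ → u ℕ.< N → (rel σ u ∌ n → b₀ ≤ F (rel σ u)) →
          ((∀ v j → rel σ′ v j ≡ rel σ v j) ×
            (rel σ u ∌ n → Stable.Certified f sub (rel σ) (Admits.ordered (State.admits st)) m 1≤m b₀ u))
          ⊎ 1ℤ + pairs (rel σ) ≤ pairs (rel σ′)

    run-result : ∀ {d} (ρ : Vec ℕ d) u {σ} (st : State σ) → RunResult u st (⟪ run ⟫ (u ∷ ρ) σ)
    run-result ρ u st = result (run-stages ρ u st)
      where
      result : ∀ {σ} {st : State σ} {σ₄} → Stages u st σ₄ → RunResult u st σ₄
      result {st = st} stg = record { state = run-state ; BEST≤ = best₄ ; pairs≤ = pairs-mono r⊆r′ ; outcome =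
          outcome }
        where open RunFacts u st stg

  power-large : ∀ k → 2 ℕ.≤ k → 40 ℕ.* (k ℕ.* k ℕ.* k ℕ.* k) ℕ.≤ k ℕ.^ 10
  power-large k 2≤k = begin
    40 ℕ.* (k ℕ.* k ℕ.* k ℕ.* k)    ≡⟨ cong (40 ℕ.*_) fourth ⟨
    40 ℕ.* k ℕ.^ 4                  ≤⟨ ℕP.*-monoˡ-≤ (k ℕ.^ 4)
        (ℕP.≤-trans (ℕP.m≤m+n 40 24) (ℕP.^-monoˡ-≤ 6 2≤k)) ⟩
    k ℕ.^ 6 ℕ.* k ℕ.^ 4             ≡⟨ ℕP.^-distribˡ-+-* k 6 4 ⟨
    k ℕ.^ 10                        ∎
    where
    open ℕP.≤-Reasoning
    fourth : k ℕ.^ 4 ≡ k ℕ.* k ℕ.* k ℕ.* k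
    fourth = trans (cong (λ t → k ℕ.* (k ℕ.* (k ℕ.* t))) (ℕP.*-identityʳ k))
      (trans (cong (k ℕ.*_) (sym (ℕP.*-assoc k k k))) (trans (sym (ℕP.*-assoc k (k ℕ.* k) k))
          (cong (ℕ._* k) (sym (ℕP.*-assoc k k k)))))

  -- Rounds

  module Loops {n : ℕ} (f : SetFunction n) (sub : Submodular f) (A B : NodeSet) (A-in : Intervals.In f A B A) where
    open Intervals f A B
    open Submodularity n f sub
    open Specs n f
    open Frames n f
    open Recording n f
    open Searching f sub A B
    open Runs f sub A B A-in

    large : 1 ℕ.≤ n → + 40 * (+ N * + N * + N * + N) ≤ m
    large 1≤n = subst (_≤ m) cast (ℤ.+≤+ (subst (λ e → 40 ℕ.* (N ℕ.* N ℕ.* N ℕ.* N) ℕ.≤ N ℕ.^ e)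
        (sym exponent-def) (power-large N (s≤s 1≤n))))
      where
      cast : + (40 ℕ.* (N ℕ.* N ℕ.* N ℕ.* N)) ≡ + 40 * (+ N * + N * + N * + N)
      cast = trans (ℤP.pos-* 40 (N ℕ.* N ℕ.* N ℕ.* N)) (cong (+ 40 *_)
        (trans (ℤP.pos-* (N ℕ.* N ℕ.* N) N) (cong (_* + N)
            (trans (ℤP.pos-* (N ℕ.* N) N) (cong (_* + N) (ℤP.pos-* N N))))))

    Done : St → Set
    Done σ = ∀ Z → Minimal Z → scalar σ BEST ≤ F Z

    record Tested (R : ℕ → ℕ → ℤ) (i : ℕ) (τ : St) : Set where
      field
        state : State τ
        REL≡  : τ REL ≡ R
        rows  : ∀ u → u ℕ.< i → nz (R u n) ≡ false → scalar τ BEST ≤ F (λ j → nz (R u j))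

    tested-step : ∀ {d} (ρ : Vec ℕ d) {R u τ} → Tested R u τ → Tested R (suc u) (⟪ select ⟫ (u ∷ ρ) τ)
    tested-step ρ {R} {u} {τ} t = record
      { state = select-state ρ u state
      ; REL≡ = REL≡
      ; rows = rows′
      }
      where
      open Tested t
      rows′ : ∀ v → v ℕ.< suc u → nz (R v n) ≡ false → scalar (⟪ select ⟫ (u ∷ ρ) τ) BEST ≤ F (λ j →
          nz (R v j))
      rows′ v l e with v ℕ.≟ u
      ... | yes refl = subst (λ Q → nz (Q u n) ≡ false → scalar (⟪ select ⟫ (u ∷ ρ) τ) BEST ≤ F (λ j →
          nz (Q u j))) REL≡
                         (select-tests ρ u state) e
      ... | no v≢u   = ℤP.≤-trans (_⊑ᵇ_.BEST≤ (at select-quiet (u ∷ ρ) τ))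
          (rows v (ℕP.≤∧≢⇒< (ℕP.≤-pred l) v≢u) e)

    Certified′ : ∀ {σ} → State σ → ℤ → ℕ → Set
    Certified′ {σ} st b₀ u = Stable.Certified f sub (rel σ) (Admits.ordered (State.admits st)) m 1≤m b₀ u

    -- All certificates of a round refer to the relation and the best value at its start, although
    -- `BEST` keeps falling: the argument for a round without new pairs needs one common reference.
    record Progress {σ} (st : State σ) (b₀ : ℤ) (i : ℕ) (τ : St) : Set where
      field
        state   : State τ
        BEST≤   : scalar τ BEST ≤ b₀
        outcome′ : ((∀ v j → rel τ v j ≡ rel σ v j) × (∀ u → u ℕ.< i → rel σ u ∌ n → Certified′ st b₀ u))
                  ⊎ 1ℤ + pairs (rel σ) ≤ pairs (rel τ)

    progress-step : ∀ {σ} (st : State σ) {b₀ u τ τ′} → u ℕ.< N → (rel σ u ∌ n → b₀ ≤ F (rel σ u)) →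
      (p : Progress st b₀ u τ) → RunResult u (Progress.state p) τ′ → Progress st b₀ (suc u) τ′
    progress-step {σ} st {b₀} {u} {τ} {τ′} u<N tested p res = record
      { state = R.state
      ; BEST≤ = ℤP.≤-trans R.BEST≤ BEST≤
      ; outcome′ = [ (λ (eq , certs) → first eq certs (R.outcome b₀ BEST≤ u<N λ a →
            subst (b₀ ≤_) (F-cong λ j _ → sym (eq u j)) (tested (trans (sym (eq u n)) a))))
                   , (λ q → inj₂ (ℤP.≤-trans q R.pairs≤)) ]′ outcome′
      }
      where
      open Progress p
      module R = RunResult res
      first : (∀ v j → rel τ v j ≡ rel σ v j) → (∀ v → v ℕ.< u → rel σ v ∌ n → Certified′ st b₀ v) →
        ((∀ v j → rel τ′ v j ≡ rel τ v j) × (rel τ u ∌ n → Certified′ state b₀ u)) ⊎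
            1ℤ + pairs (rel τ) ≤ pairs (rel τ′) →
        ((∀ v j → rel τ′ v j ≡ rel σ v j) × (∀ v → v ℕ.< suc u → rel σ v ∌ n → Certified′ st b₀ v)) ⊎
            1ℤ + pairs (rel σ) ≤ pairs (rel τ′)
      first eq certs (inj₂ q) = inj₂ (subst (λ t → 1ℤ + t ≤ pairs (rel τ′)) (∑-cong N λ v _ → count-cong N
          (eq v)) q)
      first eq certs (inj₁ (same , cert)) = inj₁ ((λ v j → trans (same v j) (eq v j)) , certs′)
        where
        transported : rel σ u ∌ n → Certified′ st b₀ u
        transported a = Congruence.certified-cong f sub (rel τ) (rel σ) eq
          (Admits.ordered (State.admits state)) (Admits.ordered (State.admits st)) 1≤m
              (cert (trans (eq u n) a))
        certs′ : ∀ v → v ℕ.< suc u → rel σ v ∌ n → Certified′ st b₀ v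
        certs′ v l a = [ (λ v<u → certs v v<u a) , (λ { refl → transported a }) ]′ (ℕP.m≤n⇒m<n∨m≡n (ℕP.≤-pred l))

    selected : ∀ {d} (ρ : Vec ℕ d) {σ} → State σ → Tested (σ REL) N (⟪ for select ⟫ ρ σ)
    selected ρ {σ} st = for-inv select ρ σ (Tested (σ REL)) (λ _ t → tested-step ρ t)
        (record { state = st ; REL≡ = refl ; rows = λ _ () })

    progressed : ∀ {d} (ρ : Vec ℕ d) {R τ} (t : Tested R N τ) →
      Progress (Tested.state t) (scalar τ BEST) N (⟪ for run ⟫ ρ τ)
    progressed ρ {R} {τ} t = for-inv run ρ τ (Progress stτ (scalar τ BEST)) (λ {u} {υ} → next {u} {υ})
      (record { state = stτ ; BEST≤ = ℤP.≤-refl ; outcome′ = inj₁ ((λ _ _ → refl) , λ _ ()) })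
      where
      stτ : State τ
      stτ = Tested.state t
      tested : ∀ {u} → u ℕ.≤ n → rel τ u ∌ n → scalar τ BEST ≤ F (rel τ u)
      tested {u} l = subst (λ R → nz (R u n) ≡ false → scalar τ BEST ≤ F (λ j → nz (R u j)))
          (sym (Tested.REL≡ t)) (Tested.rows t u (s≤s l))
      next : ∀ {u υ} → u ℕ.≤ n → Progress stτ (scalar τ BEST) u υ → Progress stτ (scalar τ BEST) (suc u)
          (⟪ run ⟫ (u ∷ ρ) υ)
      next {u} {υ} l p = progress-step stτ {scalar τ BEST} {u} {υ} {⟪ run ⟫ (u ∷ ρ) υ} (s≤s l) (tested l) p
          (run-result ρ u {υ} (Progress.state p))

    round-end : ∀ {R τ υ} (t : Tested R N τ) → Progress (Tested.state t) (scalar τ BEST) N υ →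
      State υ × (Done υ ⊎ 1ℤ + pairs (λ v j → nz (R v j)) ≤ pairs (rel υ))
    round-end {R} {τ} {υ} t p = Progress.state p ,
      [ (λ (_ , certs) → inj₁ (done certs))
      , (λ q → inj₂ (subst (λ R → 1ℤ + pairs (λ v j → nz (R v j)) ≤ pairs (rel υ)) (Tested.REL≡ t) q)) ]′
          (Progress.outcome′ p)
      where
      st : State τ
      st = Tested.state t
      done : (∀ u → u ℕ.< N → rel τ u ∌ n → Certified′ st (scalar τ BEST) u) → Done υ
      done certs Z min with n ℕ.≟ 0
      -- For n = 0 the number m is 1 and `large` is out of reach, but then all sets have the same
      -- value.
      ... | yes n≡0 = ℤP.≤-trans (State.best≤A (Progress.state p))
        (ℤP.≤-reflexive (F-cong {A} {Z} λ j l → ⊥-elim (ℕP.n≮0 (subst (j ℕ.<_) n≡0 l))))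
      ... | no n≢0  = ℤP.≤-trans (Progress.BEST≤ p)
        (Stable.stable f sub (rel τ) (Admits.ordered (State.admits st)) m 1≤m (scalar τ BEST) A
            (Admits.A⊆row (State.admits st))
          (large (ℕP.n≢0⇒n>0 n≢0)) (State.best≤A st) certs Z (Admits.minimal (State.admits st) Z min)
              (In.required (proj₁ min)))

    record RoundResult (σ υ : St) : Set where
      field
        state : State υ
        BEST≤ : scalar υ BEST ≤ scalar σ BEST
        gain  : Done υ ⊎ 1ℤ + pairs (rel σ) ≤ pairs (rel υ)

    ended : ∀ {d} (ρ : Vec ℕ d) {R τ} (t : Tested R N τ) →
      State (⟪ for run ⟫ ρ τ) × (Done (⟪ for run ⟫ ρ τ) ⊎ 1ℤ + pairs (λ v j → nz (R v j)) ≤ pairs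
          (rel (⟪ for run ⟫ ρ τ)))
    ended ρ t = round-end t (progressed ρ t)

    round-result : ∀ {d} (ρ : Vec ℕ d) {σ} → State σ → RoundResult σ (⟪ round ⟫ ρ σ)
    round-result ρ {σ} st = record
      { state = proj₁ (ended ρ (selected ρ st))
      ; BEST≤ = _⊑ᵇ_.BEST≤ (at round-quiet ρ σ)
      ; gain = proj₂ (ended ρ (selected ρ st))
      }

    -- While the search is not done, each round adds a pair. The count starts at 1 with the pair (n
    -- , n) and cannot exceed N², so N² rounds are enough.
    record Search (t : ℕ) (σ : St) : Set where
      field
        state : State σ
        measure : Done σ ⊎ + suc t ≤ pairs (rel σ)

    search-step : ∀ {t σ υ} → (s : Search t σ) → RoundResult σ υ → Search (suc t) υ
    search-step {t} {σ} {υ} s res = record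
      { state = R.state
      ; measure = [ (λ done → inj₁ λ Z min → ℤP.≤-trans R.BEST≤ (done Z min))
                  , (λ q → [ inj₁ , (λ p → inj₂ (by (Δ q ⊹ Δ p) (alg (+ suc t) (pairs (rel σ))
                      (pairs (rel υ))))) ]′ R.gain) ]′
                  (Search.measure s)
      }
      where
      module R = RoundResult res
      alg : ∀ t p q → p - t + (q - (1ℤ + p)) ≡ q - (1ℤ + t)
      alg = solve-∀

    search-end : ∀ {υ} → Search (N ℕ.* N ℕ.+ 0) υ → State υ × Done υ
    search-end {υ} s = Search.state s , [ (λ d → d) , (λ q →
        ⊥-elim (1≰0 (by (Δ q ⊹ Δ bound) (alg (+ (N ℕ.* N ℕ.+ 0)) (pairs (rel υ)))))) ]′ (Search.measure s)
      where
      alg : ∀ t p → p - (1ℤ + t) + (t - p) ≡ 0ℤ - 1ℤ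
      alg = solve-∀
      bound : pairs (rel υ) ≤ + (N ℕ.* N ℕ.+ 0)
      bound = ℤP.≤-trans (∑-mono N λ v _ → count≤ N (rel υ v))
        (ℤP.≤-reflexive (trans (∑-const N (+ N))
            (trans (sym (ℤP.pos-* N N)) (cong +_ (sym (ℕP.+-identityʳ _))))))

    search-start : ∀ {σ} → State σ → Search 0 σ
    search-start {σ} st = record
      { state = st
      ; measure = inj₂ (ℤP.≤-trans (ℤP.≤-trans
          (ℤP.≤-reflexive (sym (cong bit (Preorder.reflexive (Admits.ordered (State.admits st)) n))))
          (∑-term N n {λ j → bit (rel σ n j)} ℕP.≤-refl λ j _ → 0≤bit (rel σ n j)))
        (∑-term N n {λ v → count N (rel σ v)} ℕP.≤-refl λ v _ → count-nonneg N (rel σ v)))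
      }

    search : ∀ {d} (ρ : Vec ℕ d) {σ} → State σ → let σ′ = ⟪ for (for round) ⟫ ρ σ in State σ′ × Done σ′
    search ρ {σ} st = search-end
      (for-inv (for round) ρ σ (λ i → Search (i ℕ.* N ℕ.+ 0)) (λ {i} {τ} _ s → regroup i
            (for-inv round (i ∷ ρ) τ (λ j → Search (j ℕ.+ (i ℕ.* N ℕ.+ 0))) (λ {j} _ s → search-step s (round-result (j ∷ i ∷ ρ) (Search.state s))) s))
        (search-start st))
      where
      regroup : ∀ i {τ} → Search (N ℕ.+ (i ℕ.* N ℕ.+ 0)) τ → Search (suc i ℕ.* N ℕ.+ 0) τ
      regroup i {τ} = subst (λ t → Search t τ) (sym (ℕP.+-assoc N (i ℕ.* N) 0))

  -- Minimisation on one interval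

  module Solving {n : ℕ} (f : SetFunction n) (sub : Submodular f) where
    open Values n f
    open Specs n f
    open Recording n f

    requiredBy : St → NodeSet
    requiredBy σ j = row σ CA j ∧ not (leq (+ n) (+ j))

    forbiddenBy : St → NodeSet
    forbiddenBy σ = row σ CB

    solve-quiet : ∀ {d} (ρ : Vec ℕ d) σ → σ ⊑ ⟪ solve ⟫ ρ σ
    solve-quiet ρ σ = ⊑-trans (⊑-trans (⊑-quiet {σ} {⟪ frontier ⟫ ρ σ} refl refl refl refl refl)
        (test-⊑ ρ (⟪ frontier ⟫ ρ σ)))
      (_⊑ᵇ_.base (at (loop-quiet (loop-quiet (Searching.round-quiet f sub (requiredBy σ) (forbiddenBy σ)))) ρ
          (⟪ initialise ⟫ ρ σ)))

    module _ {d} (ρ : Vec ℕ d) (σ : St) where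
      private
        A B : NodeSet
        A = requiredBy σ
        B = forbiddenBy σ
        τ : St
        τ = ⟪ initialise ⟫ ρ σ

      open Intervals f A B

      INA≗ : row τ INA ≗′ A
      INA≗ j = trans (nz-∧ (σ CA 0 j) _) (cong (row σ CA j ∧_) (trans (nz-not (bit (leq (+ n) (+ j))))
          (cong not (nz-bit (leq (+ n) (+ j))))))

      rel≡ : ∀ i j → rel τ i j ≡ single j i ∨ (A j ∨ (single n j ∧ B i))
      rel≡ i j = trans (nz-∨ (if nz (bit (leq (+ i) (+ j))) then bit (leq (+ j) (+ i)) else 0ℤ) _)
        (cong₂ _∨_ (eq-single i j) (trans (nz-∨ (τ INA 0 j) _)
          (cong₂ _∨_ (INA≗ j) (trans (nz-∧ (if nz (bit (leq (+ j) (+ n))) then bit (leq (+ n) (+ j)) else 0ℤ)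
              (σ CB 0 i))
            (cong (_∧ B i) (eq-single j n))))))

      data Initial (i j : ℕ) : Set where
        same : i ≡ j → Initial i j
        toA  : A ∋ j → Initial i j
        toB  : j ≡ n → B ∋ i → Initial i j

      initial⇒ : ∀ {i j} → rel τ i ∋ j → Initial i j
      initial⇒ {i} {j} e with ∨-elim {single j i} (trans (sym (rel≡ i j)) e)
      ... | inj₁ p = same (single-eq p)
      ... | inj₂ q with ∨-elim {A j} q
      ...   | inj₁ p = toA p
      ...   | inj₂ p = toB (single-eq (proj₁ (∧-elim {single n j} p))) (proj₂ (∧-elim {single n j} p))

      initial⇐ : ∀ {i j} → Initial i j → rel τ i ∋ j
      initial⇐ {i} {j} (same refl)  = trans (rel≡ i i) (∨-left (single-self i))
      initial⇐ {i} {j} (toA p)      = trans (rel≡ i j) (∨-right {single j i} (∨-left p))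
      initial⇐ {i} {j} (toB refl p) = trans (rel≡ i n)
          (∨-right {single n i} (∨-right {A n} (∧-intro (single-self n) p)))

      module _ (A-in : In A) where
        open Runs f sub A B A-in using (State)
        open Loops f sub A B A-in using (search)

        initial-state : State τ
        initial-state = record
          { admits = record
              { ordered = record
                  { reflexive = λ v → initial⇐ {v} {v} (same refl)
                  ; transitive = λ {v} {j} {k} p q → initial⇐ {v} {k} (compose (initial⇒ {v} {j} p) (initial⇒ {j} {k} q))
                  }
              ; A⊆row = λ v j p → initial⇐ {v} {j} (toA p)
              ; B-dead = λ v p → initial⇐ {v} {n} (toB refl p)
              ; minimal = λ Z (z , _) → closed (λ {v} {j} p q → follow z p (initial⇒ {v} {j} q)) (In.proper′ z)
              }
          ; INA≡ = INA≗
          ; best-in = A , A-in , sym best≡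
          ; best≤A = ℤP.≤-reflexive best≡
          }
          where
          compose : ∀ {i j k} → Initial i j → Initial j k → Initial i k
          compose (same refl) q           = q
          compose p           (same refl) = p
          compose p           (toA q)     = toA q
          -- The only chain without a shortcut leads through an element both required and forbidden.
          compose (toA p)     (toB refl q) = absurd p (In.forbidden A-in _ q)
          compose (toB refl p) (toB refl q) = toB refl p
          follow : ∀ {Z v j} → In Z → Z ∋ v → Initial v j → Z ∋ j
          follow z p (same refl) = p
          follow z p (toA q)     = In.required z _ q
          follow z p (toB _ q)   = absurd p (In.forbidden z _ q)
          q≡ : F (row τ SET) ≡ F A
          q≡ = F-cong λ j _ → INA≗ j
          best≡ : scalar τ BEST ≡ F A
          best≡ = trans ([ (λ e → e) , (λ e → e) ]′ (proj₂ (proj₂ (test-BEST ρ (⟪ frontier ⟫ ρ σ))))) q≡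

        -- The final `BEST` is attained in the interval and at most F Z, hence equal to it. Being
        -- recorded, it is either matched by the output or not above the threshold, and the latter
        -- contradicts the hypothesis on F Z.
        solve-covers : ∀ Z → Minimal Z → (on σ HTH → scalar σ TH < F Z) → Covers (F Z) (⟪ solve ⟫ ρ σ)
        solve-covers Z min above = [ (λ (h , l) →
            ⊥-elim (ℤP.<⇒≱ (above (trans (cong (λ t → nz (t 0 0)) (sym (_⊑_.HTH≡ kept))) h))
              (ℤP.≤-trans (attained-≥ (State.best-in (proj₁ found)) Z min)
                (ℤP.≤-trans l (ℤP.≤-reflexive (cong (λ t → t 0 0) (_⊑_.TH≡ kept)))))))
            , (λ (h , l) → h , ℤP.≤-trans l (proj₂ found Z min)) ]′ recorded
          where
          kept = solve-quiet ρ σ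
          found = search ρ initial-state
          recorded : Recorded (⟪ solve ⟫ ρ σ)
          recorded = _⊑ᵇ_.recorded (at (loop-quiet (loop-quiet (Searching.round-quiet f sub A B))) ρ τ)
            (test-recorded ρ (⟪ frontier ⟫ ρ σ) (inj₂ refl))

  -- Enumeration of the intervals

  _==_ : ℕ → ℕ → ℤ
  j == p = if nz (bit (leq (+ j) (+ p))) then bit (leq (+ p) (+ j)) else 0ℤ

  ==-single : ∀ j p → j == p ≡ bit (single p j)
  ==-single j p = trans (pt (leq (+ j) (+ p)) (leq (+ p) (+ j)))
    (cong bit (trans (sym (nz-bit _)) (trans (cong nz (sym (pt (leq (+ j) (+ p)) (leq (+ p) (+ j)))))
        (eq-single j p))))
    where
    pt : ∀ a b → (if nz (bit a) then bit b else 0ℤ) ≡ bit (a ∧ b)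
    pt true  b = refl
    pt false b = refl

  -- The newest choice is added on the right, as `bump` does, so that the counters of the program
  -- match by definition.
  occurrences : List ℕ → ℕ → ℤ
  occurrences []       j = 0ℤ
  occurrences (p ∷ ps) j = occurrences ps j + (j == p)

  absent : ∀ p ps j → single p j ≡ false → occurrences (p ∷ ps) j ≡ occurrences ps j
  absent p ps j e = trans (cong (λ t → occurrences ps j + t) (trans (==-single j p) (cong bit e)))
      (ℤP.+-identityʳ (occurrences ps j))

  0≤occurrences : ∀ ps j → 0ℤ ≤ occurrences ps j
  0≤occurrences []       j = ℤP.≤-refl
  0≤occurrences (p ∷ ps) j = 0≤occurrences ps j ⊹ subst (0ℤ ≤_) (sym (==-single j p)) (0≤bit (single p j))

  occurs-head : ∀ p ps → nz (occurrences (p ∷ ps) p) ≡ true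
  occurs-head p ps = nz-≢0 {occurrences (p ∷ ps) p} λ e → 1≰0 (subst (1ℤ ≤_) e
    (by (0≤occurrences ps p) (trans (alg (occurrences ps p)) (cong (λ t → occurrences ps p + t - 1ℤ)
        (sym (trans (==-single p p) (cong bit (single-self p))))))))
    where
    alg : ∀ a → a ≡ a + 1ℤ - 1ℤ
    alg = solve-∀

  occurs-tail : ∀ p ps j → nz (occurrences ps j) ≡ true → nz (occurrences (p ∷ ps) j) ≡ true
  occurs-tail p ps j h = by-cases (single p j) refl
    where
    by-cases : ∀ b → single p j ≡ b → nz (occurrences (p ∷ ps) j) ≡ true
    by-cases true  e = subst (λ t → nz (occurrences (p ∷ ps) t) ≡ true) (sym (single-eq e)) (occurs-head p ps)
    by-cases false e = trans (cong nz (absent p ps j e)) h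

  occurs-cases : ∀ p ps j → nz (occurrences (p ∷ ps) j) ≡ true → j ≡ p ⊎ nz (occurrences ps j) ≡ true
  occurs-cases p ps j h = by-cases (single p j) refl
    where
    by-cases : ∀ b → single p j ≡ b → j ≡ p ⊎ nz (occurrences ps j) ≡ true
    by-cases true  e = inj₁ (single-eq e)
    by-cases false e = inj₂ (trans (cong nz (sym (absent p ps j e))) h)

  Choices : ℕ → Set
  Choices k = Vec (ℕ × ℕ) k

  lowers uppers : ∀ {k} → Choices k → List ℕ → List ℕ
  lowers []             ps = ps
  lowers ((p , _) ∷ cs) ps = lowers cs (p ∷ ps)
  uppers []             qs = qs
  uppers ((_ , q) ∷ cs) qs = uppers cs (q ∷ qs)

  data Within (n : ℕ) : ∀ {k} → Choices k → Set where
    []  : Within n []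
    _∷_ : ∀ {k p q} {cs : Choices k} → p ℕ.≤ n × q ℕ.≤ n → Within n cs → Within n ((p , q) ∷ cs)

  module Nesting {n : ℕ} (f : SetFunction n) (sub : Submodular f) where
    open Values n f
    open Specs n f
    open Frames n f
    open Recording n f
    open Solving f sub

    lower : List ℕ → NodeSet
    lower ps j = nz (occurrences ps j) ∧ not (leq (+ n) (+ j))

    upper : List ℕ → NodeSet
    upper qs j = nz (occurrences qs j)

    Above : St → ℤ → Set
    Above σ z = on σ HTH → scalar σ TH < z

    above-⊑ : ∀ {σ τ z} → σ ⊑ τ → Above σ z → Above τ z
    above-⊑ {z = z} p a h = subst (λ t → t 0 0 < z)
        (sym (_⊑_.TH≡ p)) (a (trans (cong (λ t → nz (t 0 0)) (sym (_⊑_.HTH≡ p))) h))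

    -- The first component says that the choices are consistent. The loops visit contradictory
    -- choices too; there nothing is claimed to be found, only that the recorded output survives.
    Minimum : List ℕ → List ℕ → NodeSet → Set
    Minimum ps qs Z = Intervals.In f (lower ps) (upper qs) (lower ps) × Intervals.Minimal f (lower ps)
        (upper qs) Z

    Hit : List ℕ → List ℕ → St → St → Set
    Hit ps qs σ τ = ∀ Z → Minimum ps qs Z → Above σ (F Z) → Covers (F Z) τ

    record Counts (ps qs : List ℕ) (σ : St) : Set where
      field
        CA≡ : ∀ j → σ CA 0 j ≡ occurrences ps j
        CB≡ : ∀ j → σ CB 0 j ≡ occurrences qs j

    record Explored (k : ℕ) (ps qs : List ℕ) (σ τ : St) : Set where
      field
        counts : Counts ps qs τ
        kept   : σ ⊑ τ
        hits   : ∀ (cs : Choices k) → Within n cs → Hit (lowers cs ps) (uppers cs qs) σ τ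

    module Transport {A B A′ B′ : NodeSet} (a : A ≗′ A′) (b : B ≗′ B′) where
      in-to : ∀ {Z} → Intervals.In f A B Z → Intervals.In f A′ B′ Z
      in-to i = record
        { required = λ j p → Intervals.In.required i j (trans (a j) p)
        ; forbidden = λ j p → Intervals.In.forbidden i j (trans (b j) p)
        ; proper′ = Intervals.In.proper′ i
        }

    writes-rep : ∀ x (c : ∀ {d} → Cmd d) → (∀ {d} → writes x (c {d}) ≡ false) → ∀ k {d} →
        writes x (rep k c {d}) ≡ false
    writes-rep x c h zero    = h
    writes-rep x c h (suc k) = writes-rep x c h k

    solve-CA : ∀ {d} → writes CA (solve {d}) ≡ false
    solve-CA = trans (cong (_∨ false) (writes-rep CA greedy refl (exponent ℕ.+ exponent))) refl

    solve-CB : ∀ {d} → writes CB (solve {d}) ≡ false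
    solve-CB = trans (cong (_∨ false) (writes-rep CB greedy refl (exponent ℕ.+ exponent))) refl

    explore-solve : ∀ {d} (ρ : Vec ℕ d) σ {ps qs} → Counts ps qs σ → Explored 0 ps qs σ (⟪ solve ⟫ ρ σ)
    explore-solve ρ σ {ps} {qs} c = record
      { counts = record
          { CA≡ = λ j → trans (cong (λ t → t 0 j) (frame CA solve solve-CA ρ σ)) (Counts.CA≡ c j)
          ; CB≡ = λ j → trans (cong (λ t → t 0 j) (frame CB solve solve-CB ρ σ)) (Counts.CB≡ c j)
          }
      ; kept = solve-quiet ρ σ
      ; hits = λ { [] [] → hit }
      }
      where
      A≗ : requiredBy σ ≗′ lower ps
      A≗ j = cong (λ t → nz t ∧ not (leq (+ n) (+ j))) (Counts.CA≡ c j)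
      B≗ : forbiddenBy σ ≗′ upper qs
      B≗ j = cong nz (Counts.CB≡ c j)
      module To = Transport {requiredBy σ} {forbiddenBy σ} {lower ps} {upper qs} A≗ B≗
      module From = Transport {lower ps} {upper qs} {requiredBy σ} {forbiddenBy σ} (λ j → sym (A≗ j)) (λ j → sym (B≗ j))
      hit : Hit ps qs σ (⟪ solve ⟫ ρ σ)
      hit Z (valid , z , least) above = solve-covers ρ σ
        (Intervals.in-cong f (requiredBy σ) (forbiddenBy σ) (λ j → sym (A≗ j)) (From.in-to valid)) Z
        (From.in-to z , λ Y y → least Y (To.in-to y)) above

    counts-bump : ∀ {d} (ρ : Vec ℕ d) p q {σ ps qs} → Counts ps qs σ → Counts (p ∷ ps) (q ∷ qs)
        (⟪ bump ⟫ (q ∷ p ∷ ρ) σ)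
    counts-bump ρ p q c = record
      { CA≡ = λ j → cong (λ t → t + (j == p)) (Counts.CA≡ c j)
      ; CB≡ = λ j → cong (λ t → t + (j == q)) (Counts.CB≡ c j)
      }

    counts-unbump : ∀ {d} (ρ : Vec ℕ d) p q {σ ps qs} → Counts (p ∷ ps) (q ∷ qs) σ → Counts ps qs
        (⟪ unbump ⟫ (q ∷ p ∷ ρ) σ)
    counts-unbump ρ p q {ps = ps} {qs} c = record
      { CA≡ = λ j → trans (cong (λ t → t - (j == p)) (Counts.CA≡ c j)) (alg (occurrences ps j) (j == p))
      ; CB≡ = λ j → trans (cong (λ t → t - (j == q)) (Counts.CB≡ c j)) (alg (occurrences qs j) (j == q))
      }
      where
      alg : ∀ a e → a + e - e ≡ a
      alg = solve-∀

    bump-⊑ : ∀ {d} (ρ : Vec ℕ (suc (suc d))) σ → σ ⊑ ⟪ bump ⟫ ρ σ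
    bump-⊑ ρ σ = ⊑-quiet refl refl refl refl refl

    unbump-⊑ : ∀ {d} (ρ : Vec ℕ (suc (suc d))) σ → σ ⊑ ⟪ unbump ⟫ ρ σ
    unbump-⊑ ρ σ = ⊑-quiet refl refl refl refl refl

    explore : ∀ k {d} (ρ : Vec ℕ d) σ {ps qs} → Counts ps qs σ → Explored k ps qs σ (⟪ nest k ⟫ ρ σ)
    explore zero    ρ σ c = explore-solve ρ σ c
    explore (suc k) ρ σ {ps} {qs} c = record
      { counts = Row.counts rows ; kept = Row.kept rows
      ; hits = λ { ((p , q) ∷ cs) ((p≤n , q≤n) ∷ w) → Row.hits rows p q cs (s≤s p≤n) q≤n w } }
      where
      record Row (i : ℕ) (τ : St) : Set where
        field
          counts : Counts ps qs τ
          kept   : σ ⊑ τ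
          hits   : ∀ p q (cs : Choices k) → p ℕ.< i → q ℕ.≤ n → Within n cs → Hit (lowers cs (p ∷ ps))
              (uppers cs (q ∷ qs)) σ τ

      record Cell (i j : ℕ) (τ : St) : Set where
        field
          done   : Row i τ
          hits   : ∀ q (cs : Choices k) → q ℕ.< j → Within n cs → Hit (lowers cs (i ∷ ps))
              (uppers cs (q ∷ qs)) σ τ

      hit-⊑ : ∀ ps qs {τ υ} → τ ⊑ υ → Hit ps qs σ τ → Hit ps qs σ υ
      hit-⊑ _ _ le h Z min a = _⊑_.covers le (h Z min a)

      body : ∀ i j {τ υ} → Cell i j τ → τ ⊑ υ → Counts ps qs υ →
             (∀ (cs : Choices k) → Within n cs → Hit (lowers cs (i ∷ ps)) (uppers cs (j ∷ qs)) σ υ) →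
                 Cell i (suc j) υ
      body i j {τ} {υ} cell le counts new = record
        { done = record
            { counts = counts
            ; kept = ⊑-trans (Row.kept (Cell.done cell)) le
            ; hits = λ p q cs l l′ w → hit-⊑ (lowers cs (p ∷ ps)) (uppers cs (q ∷ qs)) le
                (Row.hits (Cell.done cell) p q cs l l′ w)
            }
        ; hits = λ q cs l w → [ (λ q<j → hit-⊑ (lowers cs (i ∷ ps)) (uppers cs (q ∷ qs)) le (Cell.hits cell q cs q<j w)) , (λ { refl → new cs w }) ]′ (ℕP.m≤n⇒m<n∨m≡n (ℕP.≤-pred l))
        }

      inner : ∀ i j {τ} → Cell i j τ → Cell i (suc j) (⟪ bump ▸ nest k ▸ unbump ⟫ (j ∷ i ∷ ρ) τ)
      inner i j {τ} cell = body i j cell whole (counts-unbump ρ i j (Explored.counts deep))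
        λ cs w Z min a → _⊑_.covers last (Explored.hits deep cs w Z min
            (above-⊑ (⊑-trans (Row.kept (Cell.done cell)) first) a))
        where
        τ₁ τ₂ : St
        τ₁ = ⟪ bump ⟫ (j ∷ i ∷ ρ) τ
        τ₂ = ⟪ nest k ⟫ (j ∷ i ∷ ρ) τ₁
        first : τ ⊑ τ₁
        first = bump-⊑ (j ∷ i ∷ ρ) τ
        deep : Explored k (i ∷ ps) (j ∷ qs) τ₁ τ₂
        deep = explore k (j ∷ i ∷ ρ) τ₁ (counts-bump ρ i j (Row.counts (Cell.done cell)))
        last : τ₂ ⊑ ⟪ unbump ⟫ (j ∷ i ∷ ρ) τ₂
        last = unbump-⊑ (j ∷ i ∷ ρ) τ₂
        whole : τ ⊑ ⟪ unbump ⟫ (j ∷ i ∷ ρ) τ₂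
        whole = ⊑-trans first (⊑-trans (Explored.kept deep) last)

      outer : ∀ i {τ} → Row i τ → Row (suc i) (⟪ for (bump ▸ nest k ▸ unbump) ⟫ (i ∷ ρ) τ)
      outer i {τ} row = record
        { counts = Row.counts (Cell.done cells)
        ; kept = Row.kept (Cell.done cells)
        ; hits = λ p q cs l l′ w → [ (λ p<i → Row.hits (Cell.done cells) p q cs p<i l′ w)
                                    , (λ { refl → Cell.hits cells q cs (s≤s l′) w }) ]′ (ℕP.m≤n⇒m<n∨m≡n (ℕP.≤-pred l))
        }
        where
        cells : Cell i (suc n) (⟪ for (bump ▸ nest k ▸ unbump) ⟫ (i ∷ ρ) τ)
        cells = for-inv (bump ▸ nest k ▸ unbump) (i ∷ ρ) τ (Cell i) (λ {j} _ cell → inner i j cell)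
          (record { done = row ; hits = λ _ _ () })

      rows : Row (suc n) (⟪ nest (suc k) ⟫ ρ σ)
      rows = for-inv (for (bump ▸ nest k ▸ unbump)) ρ σ Row (λ {i} _ row → outer i row)
        (record { counts = c ; kept = ⊑-quiet refl refl refl refl refl ; hits = λ _ _ _ () })

  -- The sorted list of values

  insert : ℤ → List ℤ → List ℤ
  insert x []       = x ∷ []
  insert x (y ∷ ys) with ℤP.<-cmp x y
  ... | tri< _ _ _ = x ∷ y ∷ ys
  ... | tri≈ _ _ _ = y ∷ ys
  ... | tri> _ _ _ = y ∷ insert x ys

  insert-∈ : ∀ x ys → x ∈ insert x ys
  insert-∈ x []       = here refl
  insert-∈ x (y ∷ ys) with ℤP.<-cmp x y
  ... | tri< _ _ _ = here refl
  ... | tri≈ _ e _ = here e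
  ... | tri> _ _ _ = there (insert-∈ x ys)

  insert-⊆ : ∀ x ys {z} → z ∈ ys → z ∈ insert x ys
  insert-⊆ x (y ∷ ys) p with ℤP.<-cmp x y
  insert-⊆ x (y ∷ ys) p         | tri< _ _ _ = there p
  insert-⊆ x (y ∷ ys) p         | tri≈ _ _ _ = p
  insert-⊆ x (y ∷ ys) (here e)  | tri> _ _ _ = here e
  insert-⊆ x (y ∷ ys) (there p) | tri> _ _ _ = there (insert-⊆ x ys p)

  insert-All : ∀ {P : ℤ → Set} x ys → P x → All P ys → All P (insert x ys)
  insert-All x []       px []         = px ∷ []
  insert-All x (y ∷ ys) px (py ∷ pys) with ℤP.<-cmp x y
  ... | tri< _ _ _ = px ∷ py ∷ pys
  ... | tri≈ _ _ _ = py ∷ pys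
  ... | tri> _ _ _ = py ∷ insert-All x ys px pys

  insert-sorted : ∀ x ys → AllPairs _<_ ys → AllPairs _<_ (insert x ys)
  insert-sorted x []       []       = [] ∷ []
  insert-sorted x (y ∷ ys) (a ∷ as) with ℤP.<-cmp x y
  ... | tri< l _ _ = (l ∷ All.map (ℤP.<-trans l) a) ∷ a ∷ as
  ... | tri≈ _ _ _ = a ∷ as
  ... | tri> _ _ l = insert-All x ys l a ∷ insert-sorted x ys as

  sort : List ℤ → List ℤ
  sort = List.foldr insert []

  sort-sorted : ∀ xs → AllPairs _<_ (sort xs)
  sort-sorted []       = []
  sort-sorted (x ∷ xs) = insert-sorted x (sort xs) (sort-sorted xs)

  sort-⊆ : ∀ {z} xs → z ∈ xs → z ∈ sort xs
  sort-⊆ (x ∷ xs) (here refl) = insert-∈ x (sort xs)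
  sort-⊆ (x ∷ xs) (there p)   = insert-⊆ x (sort xs) (sort-⊆ xs p)

  sort-All : ∀ {P : ℤ → Set} xs → All P xs → All P (sort xs)
  sort-All []       []       = []
  sort-All (x ∷ xs) (p ∷ ps) = insert-All x (sort xs) p (sort-All xs ps)

  lookup-All : ∀ {P : ℤ → Set} {xs} → All P xs → ∀ i → P (List.lookup xs i)
  lookup-All (p ∷ ps) Fin.zero    = p
  lookup-All (p ∷ ps) (Fin.suc i) = lookup-All ps i

  lookup-increasing : ∀ {xs} → AllPairs _<_ xs → ∀ {i j} → i Fin.< j → List.lookup xs i < List.lookup xs j
  lookup-increasing (a ∷ as) {Fin.zero}  {Fin.suc j} _       = lookup-All a j
  lookup-increasing (a ∷ as) {Fin.suc i} {Fin.suc j} (s≤s l) = lookup-increasing as l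

  allSubsets : ∀ n → List (Subset n)
  allSubsets zero    = [] ∷ []
  allSubsets (suc n) = List.map (true ∷_) (allSubsets n) ++ List.map (false ∷_) (allSubsets n)

  ∈-allSubsets : ∀ {n} (X : Subset n) → X ∈ allSubsets n
  ∈-allSubsets []            = here refl
  ∈-allSubsets (true ∷ X)  = ∈-++⁺ˡ (∈-map⁺ (true ∷_) (∈-allSubsets X))
  ∈-allSubsets {suc n} (false ∷ X) = ∈-++⁺ʳ (List.map (true ∷_) (allSubsets n))
      (∈-map⁺ (false ∷_) (∈-allSubsets X))

  sortedValues : ∀ {n} (f : SetFunction n) → ∃[ m ] SortedValues f m
  sortedValues {n} f = length values , record
    { value = List.lookup values
    ; increasing = lookup-increasing (sort-sorted unsorted)
    ; attained = lookup-All {λ v → ∃[ X ] f X ≡ v} (sort-All {λ v → ∃[ X ] f X ≡ v} unsorted (All.tabulate λ p → let X , _ , e = ∈-map⁻ f p in X , sym e))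
    ; complete = λ X → let p = sort-⊆ unsorted (∈-map⁺ f (∈-allSubsets X)) in Any.index p , index-value p
    }
    where
    unsorted values : List ℤ
    unsorted = List.map f (allSubsets n)
    values = sort unsorted
    index-value : ∀ {z xs} (p : z ∈ xs) → z ≡ List.lookup xs (Any.index p)
    index-value (here e)  = e
    index-value (there p) = index-value p

  distinct≤ : ∀ {n} {f : SetFunction n} {m k} → SortedValues f m → HasDistinctValues k f → k ℕ.≤ m
  distinct≤ {f = f} S (X , inj) = injective⇒≤ {f = λ i → proj₁ (complete (X i))} λ {i} {j} e →
    inj (trans (proj₂ (complete (X i))) (trans (cong value e) (sym (proj₂ (complete (X j))))))
    where open SortedValues S

  -- Reaching a value through minima on intervals

  module Reach {n : ℕ} (f : SetFunction n) (sub : Submodular f) where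
    open Submodularity n f sub
    open Nesting f sub using (lower; upper; Minimum)

    -- An entry `n` imposes nothing, so lists of fixed length also encode fewer constraints, or a
    -- constraint on one side only.
    record Fits (ps qs : List ℕ) (Z : NodeSet) : Set where
      constructor fits
      field
        has   : All (λ p → p ℕ.< n → Z ∋ p) ps
        lacks : All (λ q → q ℕ.< n → Z ∌ q) qs
    open Fits

    Low : List ℕ → List ℕ → ℤ → NodeSet → Set
    Low ps qs μ Z = Fits ps qs Z × F Z ≤ μ

    fits-∩ : ∀ {ps qs Y Z} → Fits ps qs Y → Fits ps qs Z → Fits ps qs (Y ∩ Z)
    fits-∩ {Y = Y} y z = fits (All.zipWith (λ (a , b) l → ∧-intro (a l) (b l)) (has y , has z))
                              (All.map (λ a l → cong (_∧ _) (a l)) (lacks y))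

    fits-∪ : ∀ {ps qs Y Z} → Fits ps qs Y → Fits ps qs Z → Fits ps qs (Y ∪ Z)
    fits-∪ y z = fits (All.map (λ a l → ∨-left (a l)) (has y))
                      (All.zipWith (λ (a , b) l → cong₂ _∨_ (a l) (b l)) (lacks y , lacks z))

    fits-cong : ∀ {ps qs Y Z} → (∀ j → j ℕ.< n → Y j ≡ Z j) → Fits ps qs Y → Fits ps qs Z
    fits-cong e y = fits (All.map (λ {p} a l → trans (sym (e p l)) (a l)) (has y))
                         (All.map (λ {p} a l → trans (sym (e p l)) (a l)) (lacks y))

    fits-tail : ∀ {p q ps qs Z} → Fits (p ∷ ps) (q ∷ qs) Z → Fits ps qs Z
    fits-tail (fits (_ ∷ a) (_ ∷ b)) = fits a b

    toSet : Subset n → NodeSet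
    toSet X j with j ℕ.<? n
    ... | yes l = lookup X (fromℕ< l)
    ... | no _  = false

    toSet-tabulate : ∀ Z j → j ℕ.< n → toSet (tabulate λ i → Z (toℕ i)) j ≡ Z j
    toSet-tabulate Z j l with j ℕ.<? n
    ... | yes l′ = trans (lookup∘tabulate (λ i → Z (toℕ i)) (fromℕ< l′)) (cong Z (toℕ-fromℕ< l′))
    ... | no h   = ⊥-elim (h l)

    -- Decided by exhaustive search over all subsets, which serves the proof and not the program.
    decide-low : ∀ ps qs μ → (∃[ Z ] Low ps qs μ Z) ⊎ (∀ Z → ¬ Low ps qs μ Z)
    decide-low ps qs μ with anySubset? (λ X →
        All.all? (λ p → (p ℕ.<? n) →-dec (toSet X p Data.Bool.≟ true)) ps ×-dec
        All.all? (λ q → (q ℕ.<? n) →-dec (toSet X q Data.Bool.≟ false)) qs ×-dec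
        (F (toSet X) ℤ.≤? μ))
    ... | yes (X , a , b , c) = inj₁ (toSet X , fits a b , c)
    ... | no none = inj₂ λ Z (z , le) →
      let X = tabulate λ i → Z (toℕ i)
          fits a b = fits-cong (λ j l → sym (toSet-tabulate Z j l)) z
      in none (X , a , b , subst (_≤ μ) (F-cong λ j l → sym (toSet-tabulate Z j l)) le)

    module _ (ps qs : List ℕ) (μ : ℤ) (bound : ∀ Y → Fits ps qs Y → μ ≤ F Y) where

      -- The union has value at least μ already because it fits the outer lists, so submodularity
      -- pushes the intersection down to μ; both constraints `p` pass to it.
      low-∩ : ∀ {p Y Z} → Low (p ∷ ps) qs μ Y → Low (p ∷ ps) qs μ Z → Low (p ∷ ps) qs μ (Y ∩ Z)
      low-∩ {p} {Y} {Z} (y , a) (z , b) = fits-∩ y z ,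
        by (Δ (F-sub Y Z) ⊹ Δ a ⊹ Δ b ⊹ Δ (bound (Y ∪ Z) (drop (fits-∪ y z))))
            (alg (F Y) (F Z) (F (Y ∪ Z)) (F (Y ∩ Z)) μ)
        where
        drop : Fits (p ∷ ps) qs (Y ∪ Z) → Fits ps qs (Y ∪ Z)
        drop (fits (_ ∷ a) b) = fits a b
        alg : ∀ y z u i μ → y + z - (u + i) + (μ - y) + (μ - z) + (u - μ) ≡ μ - i
        alg = solve-∀

      low-∪ : ∀ {Y Z} → Low ps qs μ Y → Low ps qs μ Z → Low ps qs μ (Y ∪ Z)
      low-∪ {Y} {Z} (y , a) (z , b) = fits-∪ y z ,
        by (Δ (F-sub Y Z) ⊹ Δ a ⊹ Δ b ⊹ Δ (bound (Y ∩ Z) (fits-∩ y z)))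
            (alg (F Y) (F Z) (F (Y ∪ Z)) (F (Y ∩ Z)) μ)
        where
        alg : ∀ y z u i μ → y + z - (u + i) + (μ - y) + (μ - z) + (i - μ) ≡ μ - u
        alg = solve-∀

      module _ (X : NodeSet) (X-fits : Fits ps qs X) where

        Escape : Set
        Escape = ∃[ p ] ∃[ q ] p ℕ.≤ n × q ℕ.≤ n × Fits (p ∷ ps) (q ∷ qs) X × (∀ Z → ¬ Low (p ∷ ps) (q ∷ qs) μ
            Z)

        try : ∀ p q → p ℕ.≤ n → q ℕ.≤ n → (p ℕ.< n → X ∋ p) → (q ℕ.< n → X ∌ q) →
              Escape ⊎ (∃[ Z ] Low (p ∷ ps) (q ∷ qs) μ Z)
        try p q p≤n q≤n a b = [ inj₂ , (λ none → inj₁ (p , q , p≤n , q≤n , fits (a ∷ has X-fits)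
            (b ∷ lacks X-fits) , none)) ]′
          (decide-low (p ∷ ps) (q ∷ qs) μ)

        -- Intersecting, over the q outside X, minimisers that contain `p` and avoid q yields one
        -- inside X. A q for which there is none gives the escape.
        shrink : ∀ p → p ℕ.≤ n → (p ℕ.< n → X ∋ p) → ∀ m → m ℕ.≤ n →
                 Escape ⊎ (∃[ W ] Low (p ∷ ps) qs μ W × (∀ q → q ℕ.< m → X ∌ q → W ∌ q))
        shrink p p≤n a zero m≤n with try p n p≤n ℕP.≤-refl a (λ l → ⊥-elim (ℕP.<-irrefl refl l))
        ... | inj₁ e = inj₁ e
        ... | inj₂ (Z , fits h (_ ∷ l) , le) = inj₂ (Z , (fits h l , le) , λ _ ())
        shrink p p≤n a (suc m) m<n with shrink p p≤n a m (ℕP.<⇒≤ m<n) | X m in xm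
        ... | inj₁ e | _ = inj₁ e
        ... | inj₂ (W , w , out) | true = inj₂ (W , w , λ q l e →
          [ (λ q<m → out q q<m e) , (λ { refl → absurd xm e }) ]′ (ℕP.m≤n⇒m<n∨m≡n (ℕP.≤-pred l)))
        ... | inj₂ (W , w , out) | false with try p m p≤n (ℕP.<⇒≤ m<n) a (λ _ → xm)
        ...   | inj₁ e = inj₁ e
        ...   | inj₂ (Z , fits h (z ∷ l) , le) = inj₂ (W ∩ Z , low-∩ {Y = W} {Z} w (fits h l , le) , λ q l e →
          [ (λ q<m → cong (_∧ Z q) (out q q<m e)) , (λ { refl → trans (cong (W m ∧_) (z m<n)) (∧-zeroʳ (W m)) }) ]′
            (ℕP.m≤n⇒m<n∨m≡n (ℕP.≤-pred l)))

        -- The union over the p in X of the sets from `shrink` is X itself, so X is a minimiser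
        -- unless an escape was met. Starting with the void constraint p = n covers the empty X.
        grow : ∀ m → m ℕ.≤ n → Escape ⊎ (∃[ W ] Low ps qs μ W × (∀ q → q ℕ.< n → X ∌ q → W ∌ q) ×
            (∀ p → p ℕ.< m → X ∋ p → W ∋ p))
        grow zero m≤n with shrink n ℕP.≤-refl (λ l → ⊥-elim (ℕP.<-irrefl refl l)) n ℕP.≤-refl
        ... | inj₁ e = inj₁ e
        ... | inj₂ (W , (fits (_ ∷ h) l , le) , out) = inj₂ (W , (fits h l , le) , out , λ _ ())
        grow (suc m) m<n with grow m (ℕP.<⇒≤ m<n) | X m in xm
        ... | inj₁ e | _ = inj₁ e
        ... | inj₂ (W , w , out , into) | false = inj₂ (W , w , out , λ p l e →
          [ (λ p<m → into p p<m e) , (λ { refl → absurd e xm }) ]′ (ℕP.m≤n⇒m<n∨m≡n (ℕP.≤-pred l)))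
        ... | inj₂ (W , w , out , into) | true with shrink m (ℕP.<⇒≤ m<n) (λ _ → xm) n ℕP.≤-refl
        ...   | inj₁ e = inj₁ e
        ...   | inj₂ (Z , (fits (z ∷ h) l , le) , out′) = inj₂ (W ∪ Z , low-∪ {W} {Z} w (fits h l , le)
          , (λ q l e → cong₂ _∨_ (out q l e) (out′ q l e))
          , λ p l e → [ (λ p<m → ∨-left (into p p<m e)) , (λ { refl → ∨-right {W m} (z m<n) }) ]′ (ℕP.m≤n⇒m<n∨m≡n (ℕP.≤-pred l)))

        escape : Escape ⊎ F X ≤ μ
        escape = [ inj₁ , (λ (W , (_ , le) , out , into) → inj₂ (subst (_≤ μ) (F-cong λ j l →
          ⇔-≡ (λ w → by-X (X j) refl w (out j l)) (into j l)) le)) ]′ (grow n ℕP.≤-refl)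
          where
          by-X : ∀ {w : Bool} {j} b → X j ≡ b → w ≡ true → (X ∌ j → w ≡ false) → X ∋ j
          by-X true  e _ _ = e
          by-X false e w h = absurd w (h e)

    Optimum : ℕ → List ℕ → List ℕ → NodeSet → Set
    Optimum k ps qs X = ∃[ cs ] Within n {k} cs × Fits (lowers cs ps) (uppers cs qs) X ×
      (∀ Y → Fits (lowers cs ps) (uppers cs qs) Y → F X ≤ F Y)

    pad : ∀ k ps qs X → Fits ps qs X → (∀ Y → Fits ps qs Y → F X ≤ F Y) → Optimum k ps qs X
    pad zero    ps qs X x least = [] , [] , x , least
    pad (suc k) ps qs X (fits h l) least
      with pad k (n ∷ ps) (n ∷ qs) X
             (fits ((λ n<n → ⊥-elim (ℕP.<-irrefl refl n<n)) ∷ h) ((λ n<n → ⊥-elim (ℕP.<-irrefl refl n<n)) ∷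
                 l))
             (λ Y y → least Y (fits-tail y))
    ... | cs , w , x , best = (n , n) ∷ cs , (ℕP.≤-refl , ℕP.≤-refl) ∷ w , x , best

    module _ {m : ℕ} (S : SortedValues f m) where
      open SortedValues S

      index : NodeSet → Fin m
      index Z = proj₁ (complete (tabulate λ i → Z (toℕ i)))

      F-index : ∀ Z → F Z ≡ value (index Z)
      F-index Z = proj₂ (complete (tabulate λ i → Z (toℕ i)))

      value-mono : ∀ {i j} → toℕ i ℕ.≤ toℕ j → value i ≤ value j
      value-mono l = [ (λ i<j → ℤP.<⇒≤ (increasing i<j)) , (λ e → ℤP.≤-reflexive
          (cong value (toℕ-injective e))) ]′
        (ℕP.m≤n⇒m<n∨m≡n l)

      value-cancel : ∀ {i j} → value i ≤ value j → toℕ i ℕ.≤ toℕ j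
      value-cancel l = ℕP.≮⇒≥ λ j<i → ℤP.<⇒≱ (increasing j<i) l

      -- Ranks of the interval minima grow strictly along the descent, so g steps suffice.
      reach : ∀ g k i ps qs X → g ℕ.≤ k → i ℕ.+ g ≡ toℕ (index X) → (∀ Y → Fits ps qs Y → i ℕ.≤ toℕ (index Y))
          →
              Fits ps qs X → Optimum k ps qs X
      reach zero k i ps qs X _ e lb x = pad k ps qs X x λ Y y →
        subst₂ _≤_ (sym (F-index X)) (sym (F-index Y))
            (value-mono (subst (ℕ._≤ toℕ (index Y)) (trans (sym (ℕP.+-identityʳ i)) e) (lb Y y)))
      reach (suc g) (suc k) i ps qs X (s≤s g≤k) e lb x =
        [ (λ _ → descend (escape ps qs μ bound X x))
        , (λ none → reach g (suc k) (suc i) ps qs X (ℕP.m≤n⇒m≤1+n g≤k) e′ (λ Y y → raise Y (lb Y y) λ le →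
            none Y (y , le)) x) ]′
        (decide-low ps qs μ)
        where
        e′ : suc i ℕ.+ g ≡ toℕ (index X)
        e′ = trans (sym (ℕP.+-suc i g)) e
        i<X : i ℕ.< toℕ (index X)
        i<X = subst (suc i ℕ.≤_) e′ (ℕP.m≤m+n (suc i) g)
        i<m : i ℕ.< m
        i<m = ℕP.<-trans i<X (toℕ<n (index X))
        μ : ℤ
        μ = value (fromℕ< i<m)
        bound : ∀ Y → Fits ps qs Y → μ ≤ F Y
        bound Y y = subst (μ ≤_) (sym (F-index Y))
            (value-mono (subst (ℕ._≤ toℕ (index Y)) (sym (toℕ-fromℕ< i<m)) (lb Y y)))
        raise : ∀ Y → i ℕ.≤ toℕ (index Y) → ¬ F Y ≤ μ → suc i ℕ.≤ toℕ (index Y)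
        raise Y l h = [ (λ p → p) , (λ i≡ → ⊥-elim (h (subst (_≤ μ) (sym (F-index Y))
          (value-mono (ℕP.≤-reflexive (trans (sym i≡) (sym (toℕ-fromℕ< i<m)))))))) ]′ (ℕP.m≤n⇒m<n∨m≡n l)
        descend : Escape ps qs μ bound X x ⊎ F X ≤ μ → Optimum (suc k) ps qs X
        descend (inj₂ le) = ⊥-elim (ℕP.<⇒≱ i<X (subst (toℕ (index X) ℕ.≤_) (toℕ-fromℕ< i<m)
          (value-cancel (subst (_≤ μ) (F-index X) le))))
        descend (inj₁ (p , q , p≤n , q≤n , x′ , none)) with reach g k (suc i) (p ∷ ps) (q ∷ qs) X g≤k e′
          (λ Y y → raise Y (lb Y (fits-tail y)) λ le → none Y (y , le)) x′
        ... | cs , w , best = (p , q) ∷ cs , (p≤n , q≤n) ∷ w , best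

      truncate : NodeSet → NodeSet
      truncate Z j = Z j ∧ not (leq (+ n) (+ j))

      truncate-< : ∀ Z j → j ℕ.< n → truncate Z j ≡ Z j
      truncate-< Z j l = trans (cong (λ t → Z j ∧ not t) (dec-false ((+ n) ℤ.≤? (+ j)) λ { (ℤ.+≤+ q) → ℕP.<⇒≱ l q })) (∧-identityʳ (Z j))

      lower⁻¹ : ∀ ps j → lower ps ∋ j → nz (occurrences ps j) ≡ true × j ℕ.< n
      lower⁻¹ ps j e = let a , b = ∧-elim {nz (occurrences ps j)} e in
        a , ℤP.drop‿+<+ (leq-false {+ n} {+ j} (not-elim b))

      has⁺ : ∀ ps Z → (∀ j → nz (occurrences ps j) ≡ true → j ℕ.< n → Z ∋ j) → All (λ p → p ℕ.< n → Z ∋ p) ps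
      has⁺ []       Z h = []
      has⁺ (p ∷ ps) Z h = h p (occurs-head p ps) ∷ has⁺ ps Z λ j e → h j (occurs-tail p ps j e)

      lacks⁺ : ∀ qs Z → (∀ j → nz (occurrences qs j) ≡ true → Z ∌ j) → All (λ q → q ℕ.< n → Z ∌ q) qs
      lacks⁺ []       Z h = []
      lacks⁺ (q ∷ qs) Z h = (λ _ → h q (occurs-head q qs)) ∷ lacks⁺ qs Z λ j e → h j (occurs-tail q qs j e)

      occurs-All : ∀ {P : ℕ → Set} ps → All P ps → ∀ j → nz (occurrences ps j) ≡ true → P j
      occurs-All (p ∷ ps) (a ∷ as) j e = [ (λ { refl → a }) , occurs-All ps as j ]′ (occurs-cases p ps j e)

      minimum : ∀ ps qs X → Fits ps qs X → (∀ Y → Fits ps qs Y → F X ≤ F Y) → Minimum ps qs (truncate X)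
      minimum ps qs X x least = valid , x-in , λ Y y → ℤP.≤-trans (ℤP.≤-reflexive (F-cong (truncate-< X)))
          (least Y (fits (has⁺ ps Y λ j e l → In.required y j (∧-intro e (lower-< j l)))
                         (lacks⁺ qs Y (In.forbidden y))))
        where
        open Intervals f (lower ps) (upper qs)
        lower-< : ∀ j → j ℕ.< n → not (leq (+ n) (+ j)) ≡ true
        lower-< j l = cong not (dec-false ((+ n) ℤ.≤? (+ j)) λ { (ℤ.+≤+ q) → ℕP.<⇒≱ l q })
        n-excluded : ∀ b → b ∧ not (leq (+ n) (+ n)) ≡ false
        n-excluded b = trans (cong (λ t → b ∧ not t) (≤-leq (ℤP.≤-refl {+ n}))) (∧-zeroʳ b)
        absent-in-X : ∀ j → upper qs ∋ j → truncate X ∌ j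
        absent-in-X j e with j ℕ.<? n
        ... | yes l = trans (truncate-< X j l) (occurs-All qs (lacks x) j e l)
        ... | no h  = trans (cong (λ t → X j ∧ not t) (≤-leq (ℤ.+≤+ (ℕP.≮⇒≥ h)))) (∧-zeroʳ (X j))
        x-in : In (truncate X)
        x-in = record
          { required = λ j e → let a , l = lower⁻¹ ps j e in trans (truncate-< X j l) (occurs-All ps (has x) j a l)
          ; forbidden = absent-in-X
          ; proper′ = n-excluded (X n)
          }
        valid : In (lower ps)
        valid = record
          { required = λ _ p → p
          ; forbidden = λ j e → ∌-from λ p → absurd (In.required x-in j p) (absent-in-X j e)
          ; proper′ = n-excluded (nz (occurrences ps n))
          }

      represented : ∀ (i : Fin m) → ∃[ X ] F X ≡ value i
      represented i = X , trans (cong f (trans (tabulate-cong same) (tabulate∘lookup A))) (proj₂ (attained i))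
        where
        A : Subset n
        A = proj₁ (attained i)
        X : NodeSet
        X = toSet A
        same : ∀ j → X (toℕ j) ≡ lookup A j
        same j with toℕ j ℕ.<? n
        ... | yes l = cong (lookup A) (fromℕ<-toℕ j l)
        ... | no h  = ⊥-elim (h (toℕ<n j))

      -- The descent starts at the whole power set with the bound 0 on ranks, so a value of index i
      -- takes at most i pairs; the remaining choices are filled with `n`.
      reachable : ∀ (i : Fin m) k → toℕ i ℕ.≤ k →
        ∃[ cs ] Within n {k} cs × (∃[ Z ] Minimum (lowers cs []) (uppers cs []) Z × F Z ≡ value i)
      reachable i k i≤k =
        let X , FX = represented i
            rank = ℕP.≤-antisym (value-cancel (ℤP.≤-reflexive (trans (sym FX) (F-index X))))
                                (value-cancel (ℤP.≤-reflexive (trans (sym (F-index X)) FX)))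
            cs , w , x , least = reach (toℕ i) k 0 [] [] X i≤k rank (λ _ _ → z≤n) (fits [] [])
        in cs , w , truncate X , minimum (lowers cs []) (uppers cs []) X x least ,
            trans (F-cong (truncate-< X)) FX

  -- Passes through the values

  module Passes {n : ℕ} (f : SetFunction n) (sub : Submodular f) {m : ℕ} (S : SortedValues f m) where
    open Values n f
    open Specs n f
    open Recording n f
    open Nesting f sub
    open Reach f sub
    open SortedValues S

    record After (i : Fin m) (σ : St) : Set where
      field
        counts : Counts [] [] σ
        active : on σ HTH
        TH≡    : scalar σ TH ≡ value i
        OUT≡   : F (row σ OUT) ≡ value i

    -- The output is at most `value i`, which is the minimum on one of the visited intervals. It is
    -- at least `value i` because it is a genuine value above the threshold and `value i` is the
    -- least of these.
    pass-correct : ∀ k (i : Fin m) {σ} → toℕ i ℕ.≤ k → Counts [] [] σ → Above σ (value i) →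
      (∀ i′ → Above σ (value i′) → value i ≤ value i′) → After i (⟪ pass k ⟫ [] σ)
    pass-correct k i {σ} i≤k counts above next = record
      { counts = record { CA≡ = Counts.CA≡ (Explored.counts explored) ; CB≡ = Counts.CB≡
          (Explored.counts explored) }
      ; active = refl
      ; TH≡ = CUR≡
      ; OUT≡ = trans (sym (proj₁ real)) CUR≡
      }
      where
      σ₀ τ : St
      σ₀ = ⟪ fill HAVE (lit 0ℤ) ⟫ [] σ
      τ = ⟪ nest k ⟫ [] σ₀
      explored : Explored k [] [] σ₀ τ
      explored = explore k [] σ₀ (record { CA≡ = Counts.CA≡ counts ; CB≡ = Counts.CB≡ counts })
      covered : Covers (value i) τ
      covered with reachable S i k i≤k
      ... | cs , w , Z , min , FZ = subst (λ z → Covers z τ) FZ (Explored.hits explored cs w Z min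
          (subst (Above σ) (sym FZ) above))
      real : scalar τ CUR ≡ F (row τ OUT) × (on τ HTH → scalar τ TH < scalar τ CUR)
      real = _⊑_.genuine (Explored.kept explored) (λ ()) (proj₁ covered)
      above′ : Above σ (value (index S (row τ OUT)))
      above′ h = subst₂ _<_ (cong (λ t → t 0 0) (_⊑_.TH≡ (Explored.kept explored)))
          (trans (proj₁ real) (F-index S (row τ OUT)))
        (proj₂ real (trans (cong (λ t → nz (t 0 0)) (_⊑_.HTH≡ (Explored.kept explored))) h))
      CUR≡ : scalar τ CUR ≡ value i
      CUR≡ = ℤP.≤-antisym (proj₂ covered)
        (subst (value i ≤_) (sym (trans (proj₁ real) (F-index S (row τ OUT))))
            (next (index S (row τ OUT)) above′))

    passes-correct : ∀ k j (j<m : j ℕ.< m) → j ℕ.≤ k → After (fromℕ< j<m) (⟪ passes k j ⟫ [] blank)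
    passes-correct k zero j<m _ = pass-correct k (fromℕ< j<m) (subst (ℕ._≤ k) (sym (toℕ-fromℕ< j<m)) z≤n)
      (record { CA≡ = λ _ → refl ; CB≡ = λ _ → refl }) (λ ())
      (λ i′ _ → value-mono S (subst (ℕ._≤ toℕ i′) (sym (toℕ-fromℕ< j<m)) z≤n))
    passes-correct k (suc j) j<m j<k = pass-correct k (fromℕ< j<m) (subst (ℕ._≤ k) (sym (toℕ-fromℕ< j<m)) j<k)
      counts
      (λ _ → subst (_< value (fromℕ< j<m)) (sym TH≡)
          (increasing (subst₂ ℕ._<_ (sym (toℕ-fromℕ< j<m′)) (sym (toℕ-fromℕ< j<m)) ℕP.≤-refl)))
      (λ i′ a → value-mono S (subst (ℕ._≤ toℕ i′) (trans (cong suc (toℕ-fromℕ< j<m′)) (sym (toℕ-fromℕ< j<m)))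
        (ℕP.≰⇒> λ le → ℤP.<⇒≱ (subst (_< value i′) TH≡ (a active)) (value-mono S le))))
      where
      j<m′ : j ℕ.< m
      j<m′ = ℕP.<-trans ℕP.≤-refl j<m
      open After (passes-correct k j j<m′ (ℕP.<⇒≤ j<k))

open import Defs
open import Data.Fin using (fromℕ<)
open import Data.Fin.Properties using (toℕ-fromℕ<)
open import Data.Nat using (ℕ; _≤_; suc)
open import Data.Nat.Properties using (≤-refl)
open import Data.Product using (_,_)
open import Relation.Binary.PropositionalEquality using (sym; cong)
open Compilation using (realise)
open Minimisation

corollary4p3 : ∀ (k : ℕ) → 1 ≤ k →
    PolynomialTime Submodular (λ f X → HasDistinctValues k f → KthSmallestValue k f (f X))
corollary4p3 (suc k) _ = realise
  {Submodular} {λ f X → HasDistinctValues (suc k) f → KthSmallestValue (suc k) f (f X)}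
  -- Indices start at 0, so value number k + 1 has index k: it is found by the last of k + 1 passes,
  -- and its interval fixes at most k elements on each side.
  (passes k k) λ n f sub distinct →
    let m , S = sortedValues f
        k<m = distinct≤ S distinct
    in m , S , fromℕ< k<m , cong suc (toℕ-fromℕ< k<m) ,
       sym (Passes.After.OUT≡ (Passes.passes-correct f sub S k k k<m ≤-refl))
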